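{- Let $K$ be an imaginary quadratic field of discriminant $d_K$, let $\mathfrak{n}$ be a nontrivial (nonzero) ideal of $\mathcal{O}_K$, and let $N$ be the least positive integer in $\mathfrak{n}$. Then the canonical map $$\phi_\mathfrak{n}:\mathcal{Q}_N(d_K)/\sim_\mathfrak{n}\;\rightarrow\;\mathcal{C}(\mathfrak{n}),\qquad [Q]\mapsto[[\omega_Q,\,1]]$$ is a well-defined bijection. Consequently the set of equivalence classes $\mathcal{Q}_N(d_K)/\sim_\mathfrak{n}$ can be regarded (via $\phi_\mathfrak{n}$) as a group isomorphic to $\mathcal{C}(\mathfrak{n})$.
   Context: $\mathcal{Q}(d_K)$ is the set of primitive positive definite binary quadratic forms $Q(x,y)=ax^2+bxy+cy^2$ with integer coefficients and discriminant $b^2-4ac=d_K$, and $\mathcal{Q}_N(d_K)=\{ax^2+bxy+cy^2\in\mathcal{Q}(d_K)\mid\gcd(N,a)=1\}$. For $Q=ax^2+bxy+cy^2\in\mathcal{Q}(d_K)$, $\omega_Q=\frac{ -b+\sqrt{d_K}}{2a}$ is the zero of $Q(x,1)$ in the complex upper half-plane. For $\alpha,\beta\in K$, $[\alpha,\beta]$ denotes the lattice $\mathbb{Z}\alpha+\mathbb{Z}\beta$. The lattice $[\omega_Q,1]$ is a fractional ideal of $K$ of norm $1/a$, hence it is relatively prime to $\mathfrak{n}$ for $Q\in\mathcal{Q}_N(d_K)$. $\mathcal{C}(\mathfrak{n})=I_K(\mathfrak{n})/P_{K,1}(\mathfrak{n})$ is the ray class group of $K$ modulo $\mathfrak{n}$,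 where $I_K(\mathfrak{n})$ is the group of fractional ideals of $K$ relatively prime to $\mathfrak{n}$ and $P_{K,1}(\mathfrak{n})=\{\nu\mathcal{O}_K\mid\nu\in K^*,\ \nu\equiv^*1\pmod{\mathfrak{n}}\}$ ($\equiv^*$ is multiplicative congruence). $[\mathfrak{a}]$ denotes the class of $\mathfrak{a}$ in $\mathcal{C}(\mathfrak{n})$. The equivalence relation $\sim_\mathfrak{n}$ on $\mathcal{Q}_N(d_K)$ is defined by: $Q\sim_\mathfrak{n}Q'$ if and only if $[[\omega_Q,1]]=[[\omega_{Q'},1]]$ in $\mathcal{C}(\mathfrak{n})$. -}

module Defs where

open import Algebra.Bundles using (CommutativeRing; AbelianGroup)
open import Algebra.Bundles.Raw using (RawGroup)
open import Algebra.Core using (Op₁; Op₂)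
import Algebra.Solver.Ring.NaturalCoefficients.Default as NaturalSolver
open import Algebra.Structures using (IsCommutativeRing)
open import Data.Empty using (⊥-elim)
open import Data.Integer.Base as ℤ using (ℤ; 0ℤ; 1ℤ; +_)
import Data.Integer.DivMod as ℤ
import Data.Integer.GCD as ℤ
import Data.Integer.Properties as ℤ
import Data.Integer.Solver as ℤSolver
open import Data.List.Base using (List; []; _∷_; length; map; _++_; cartesianProductWith)
open import Data.List.Membership.Propositional using () renaming (_∈_ to _∈ˡ_)
import Data.List.Membership.Propositional.Properties as ∈ˡ
open import Data.List.Relation.Unary.All as All using (All; []; _∷_)
import Data.List.Relation.Unary.All.Properties as All
open import Data.List.Relation.Unary.Any using (here; there)
open import Data.Nat.Base as ℕ using (ℕ; zero; suc)
open import Data.Nat.Coprimality as Coprimality using (Coprime; coprime-divisor; recompute)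
import Data.Nat.Divisibility as ℕ
open import Data.Nat.GCD as GCD using (module Bézout)
open import Data.Nat.Induction using (<-rec)
import Data.Nat.Properties as ℕ
open import Data.Product.Base using (∃-syntax; _×_; _,_; proj₁; proj₂)
open import Data.Rational.Base as ℚ using (ℚ; mkℚ; 0ℚ; 1ℚ)
open import Data.Rational.Literals using (fromℤ)
import Data.Rational.Properties as ℚ
import Data.Rational.Solver as ℚSolver
import Data.Rational.Unnormalised.Base as ℚᵘ
import Data.Rational.Unnormalised.Properties as ℚᵘ
open import Data.Sum.Base using (inj₁; inj₂)
open import Level using (0ℓ)
open import Relation.Binary.Bundles using (Setoid)
open import Relation.Binary.PropositionalEquality
  using (_≡_; _≢_; refl; sym; trans; cong; cong₂; subst; subst₂; isEquivalence; module ≡-Reasoning)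
import Relation.Binary.Reasoning.Setoid
open import Relation.Nullary using (¬_; Dec; yes; no)
open import Relation.Unary using (Pred; _∈_; _⊆_; _≐_)

module ℚS = ℚSolver.+-*-Solver

fromℤ-injective : ∀ {a b} → fromℤ a ≡ fromℤ b → a ≡ b
fromℤ-injective = cong ℚ.numerator

fromℤ-+ : ∀ a b → fromℤ (a ℤ.+ b) ≡ fromℤ a ℚ.+ fromℤ b
fromℤ-+ a b = ℚ.toℚᵘ-injective (ℚᵘ.≃-trans
  (ℚᵘ.*≡* (cong (ℤ._* 1ℤ) (cong₂ ℤ._+_ (sym (ℤ.*-identityʳ a)) (sym (ℤ.*-identityʳ b)))))
  (ℚᵘ.≃-sym (ℚ.toℚᵘ-homo-+ (fromℤ a) (fromℤ b))))

fromℤ-* : ∀ a b → fromℤ (a ℤ.* b) ≡ fromℤ a ℚ.* fromℤ b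
fromℤ-* a b = ℚ.toℚᵘ-injective (ℚᵘ.≃-trans
  (ℚᵘ.*≡* refl)
  (ℚᵘ.≃-sym (ℚ.toℚᵘ-homo-* (fromℤ a) (fromℤ b))))

fromℤ-neg : ∀ a → fromℤ (ℤ.- a) ≡ ℚ.- fromℤ a
fromℤ-neg a = ℚ.toℚᵘ-injective (ℚᵘ.≃-trans
  (ℚᵘ.*≡* refl)
  (ℚᵘ.≃-sym (ℚ.toℚᵘ-homo‿- (fromℤ a))))

IsInt : ℚ → Set
IsInt q = ∃[ z ] q ≡ fromℤ z

int-fromℤ : ∀ z → IsInt (fromℤ z)
int-fromℤ z = z , refl

int-+ : ∀ {p q} → IsInt p → IsInt q → IsInt (p ℚ.+ q)
int-+ (a , refl) (b , refl) = a ℤ.+ b , sym (fromℤ-+ a b)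

int-* : ∀ {p q} → IsInt p → IsInt q → IsInt (p ℚ.* q)
int-* (a , refl) (b , refl) = a ℤ.* b , sym (fromℤ-* a b)

int-neg : ∀ {p} → IsInt p → IsInt (ℚ.- p)
int-neg (a , refl) = ℤ.- a , sym (fromℤ-neg a)

infixr 8 _^ℚ_
_^ℚ_ : ℚ → ℕ → ℚ
q ^ℚ zero  = 1ℚ
q ^ℚ suc k = q ℚ.* q ^ℚ k

fromℤ-^ : ∀ z k → fromℤ (z ℤ.^ k) ≡ fromℤ z ^ℚ k
fromℤ-^ z zero    = refl
fromℤ-^ z (suc k) = trans (fromℤ-* z (z ℤ.^ k)) (cong (fromℤ z ℚ.*_) (fromℤ-^ z k))

^ℚ-* : ∀ p q k → (p ℚ.* q) ^ℚ k ≡ p ^ℚ k ℚ.* q ^ℚ k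
^ℚ-* p q zero    = refl
^ℚ-* p q (suc k) = trans (cong ((p ℚ.* q) ℚ.*_) (^ℚ-* p q k))
  (ℚS.solve 4 (λ a b c d → (a ℚS.:* b) ℚS.:* (c ℚS.:* d) ℚS.:= (a ℚS.:* c) ℚS.:* (b ℚS.:* d)) refl
    p q (p ^ℚ k) (q ^ℚ k))

q*denominator : ∀ q → q ℚ.* fromℤ (ℚ.denominator q) ≡ fromℤ (ℚ.numerator q)
q*denominator q@(mkℚ n d _) = ℚ.toℚᵘ-injective (ℚᵘ.≃-trans
  (ℚ.toℚᵘ-homo-* q (fromℤ (ℚ.denominator q)))
  (ℚᵘ.*≡* (trans (ℤ.*-identityʳ _) (cong (λ t → n ℤ.* (+ t)) (sym (ℕ.*-identityʳ (suc d)))))))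

coprime-* : ∀ {a b c} → Coprime a c → Coprime b c → Coprime (a ℕ.* b) c
coprime-* {a} {b} {c} ac bc {e} (e∣ab , e∣c) =
  bc (coprime-divisor {e} {a} {b} (λ { (f∣e , f∣a) → ac (f∣a , ℕ.∣-trans f∣e e∣c) }) e∣ab , e∣c)

coprime-^ˡ : ∀ {a c} k → Coprime a c → Coprime (a ℕ.^ k) c
coprime-^ˡ zero    ac = Coprimality.1-coprimeTo _
coprime-^ˡ {a} (suc k) ac = coprime-* {a} ac (coprime-^ˡ k ac)

coprime-^ : ∀ {a c} k → Coprime a c → Coprime (a ℕ.^ k) (c ℕ.^ k)
coprime-^ {a} {c} k ac =
  Coprimality.sym (coprime-^ˡ k (Coprimality.sym (coprime-^ˡ k ac)))

n<2^n : ∀ n → n ℕ.< 2 ℕ.^ n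
n<2^n zero    = ℕ.s≤s ℕ.z≤n
n<2^n (suc n) = ℕ.≤-trans (ℕ.+-mono-≤ (ℕ.m^n>0 2 n) (n<2^n n))
  (ℕ.≤-reflexive (cong (2 ℕ.^ n ℕ.+_) (sym (ℕ.+-identityʳ (2 ℕ.^ n)))))

abs-^ : ∀ z k → ℤ.∣ z ℤ.^ k ∣ ≡ ℤ.∣ z ∣ ℕ.^ k
abs-^ z zero    = refl
abs-^ z (suc k) = trans (ℤ.abs-* z (z ℤ.^ k)) (cong (ℤ.∣ z ∣ ℕ.*_) (abs-^ z k))

-- A rational number all of whose powers have a common denominator is an integer.
bounded⇒int : ∀ D → 0 ℕ.< D → ∀ q → (∀ k → IsInt (fromℤ (+ D) ℚ.* q ^ℚ k)) → IsInt q
bounded⇒int D 0<D (mkℚ n zero c) h = n , refl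
bounded⇒int D 0<D q@(mkℚ n d@(suc _) c) h =
  ⊥-elim (ℕ.<-irrefl refl (ℕ.≤-trans (n<2^n D)
    (ℕ.≤-trans (ℕ.^-monoˡ-≤ D (ℕ.s≤s (ℕ.s≤s ℕ.z≤n))) bound)))
  where
  den = ℚ.denominator q
  z   = proj₁ (h D)
  powers : + D ℤ.* n ℤ.^ D ≡ z ℤ.* den ℤ.^ D
  powers = fromℤ-injective (begin
    fromℤ (+ D ℤ.* n ℤ.^ D)                                ≡⟨ fromℤ-* (+ D) (n ℤ.^ D) ⟩
    fromℤ (+ D) ℚ.* fromℤ (n ℤ.^ D)                        ≡⟨ cong (fromℤ (+ D) ℚ.*_) (fromℤ-^ n D) ⟩
    fromℤ (+ D) ℚ.* fromℤ n ^ℚ D                           ≡⟨ cong (λ t → fromℤ (+ D) ℚ.* t ^ℚ D) (sym (q*denominator q)) ⟩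
    fromℤ (+ D) ℚ.* (q ℚ.* fromℤ den) ^ℚ D                 ≡⟨ cong (fromℤ (+ D) ℚ.*_) (^ℚ-* q (fromℤ den) D) ⟩
    fromℤ (+ D) ℚ.* (q ^ℚ D ℚ.* fromℤ den ^ℚ D)            ≡⟨ sym (ℚ.*-assoc (fromℤ (+ D)) (q ^ℚ D) (fromℤ den ^ℚ D)) ⟩
    fromℤ (+ D) ℚ.* q ^ℚ D ℚ.* fromℤ den ^ℚ D              ≡⟨ cong₂ ℚ._*_ (proj₂ (h D)) (sym (fromℤ-^ den D)) ⟩
    fromℤ z ℚ.* fromℤ (den ℤ.^ D)                          ≡⟨ sym (fromℤ-* z (den ℤ.^ D)) ⟩
    fromℤ (z ℤ.* den ℤ.^ D)                                ∎)
    where open ≡-Reasoning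
  powersℕ : ℤ.∣ n ∣ ℕ.^ D ℕ.* D ≡ ℤ.∣ z ∣ ℕ.* suc d ℕ.^ D
  powersℕ = trans (ℕ.*-comm (ℤ.∣ n ∣ ℕ.^ D) D)
    (trans (cong (D ℕ.*_) (sym (abs-^ n D)))
    (trans (sym (ℤ.abs-* (+ D) (n ℤ.^ D)))
    (trans (cong ℤ.∣_∣ powers)
    (trans (ℤ.abs-* z (den ℤ.^ D)) (cong (ℤ.∣ z ∣ ℕ.*_) (abs-^ den D))))))
  bound : suc d ℕ.^ D ℕ.≤ D
  bound = ℕ.∣⇒≤ ⦃ ℕ.>-nonZero 0<D ⦄ (coprime-divisor {o = D}
    (coprime-^ D (Coprimality.sym (recompute c)))
    (ℕ.divides ℤ.∣ z ∣ powersℕ))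

module ℤS = ℤSolver.+-*-Solver

abstract
  invℚ : ∀ q → q ≢ 0ℚ → ∃[ r ] q ℚ.* r ≡ 1ℚ
  invℚ q q≢0 = (ℚ.1/ q) ⦃ nz ⦄ , ℚ.*-inverseʳ q ⦃ nz ⦄
    where
    nz : ℚ.NonZero q
    nz = ℚ.≢-nonZero q≢0

ℚ-cancel : ∀ p q → p ℚ.* q ≡ 0ℚ → p ≢ 0ℚ → q ≡ 0ℚ
ℚ-cancel p q pq≡0 p≢0 with invℚ p p≢0
... | r , pr≡1 = begin
  q                  ≡⟨ sym (ℚ.*-identityˡ q) ⟩
  1ℚ ℚ.* q           ≡⟨ cong (ℚ._* q) (sym pr≡1) ⟩
  p ℚ.* r ℚ.* q      ≡⟨ ℚS.solve 3 (λ a b c → a ℚS.:* b ℚS.:* c ℚS.:= b ℚS.:* (a ℚS.:* c)) refl p r q ⟩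
  r ℚ.* (p ℚ.* q)    ≡⟨ cong (r ℚ.*_) pq≡0 ⟩
  r ℚ.* 0ℚ           ≡⟨ ℚ.*-zeroʳ r ⟩
  0ℚ                 ∎
  where open ≡-Reasoning

sign : ∀ a → ∃[ s ] (+ ℤ.∣ a ∣ ≡ s ℤ.* a) × (a ≡ s ℤ.* + ℤ.∣ a ∣)
sign (+ n)      = 1ℤ , sym (ℤ.*-identityˡ _) , sym (ℤ.*-identityˡ _)
sign ℤ.-[1+ n ] = ℤ.-1ℤ , sym (ℤ.-1*i≡-i ℤ.-[1+ n ]) , sym (ℤ.-1*i≡-i (+ suc n))

record CommonDivisor (a b : ℤ) : Set where
  field
    g u v x y : ℤ
    a≡  : a ≡ u ℤ.* g
    b≡  : b ≡ v ℤ.* g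
    g≡  : g ≡ x ℤ.* a ℤ.+ y ℤ.* b

private
  pushℕ : ∀ {d y n x m} → d ℕ.+ y ℕ.* n ≡ x ℕ.* m →
          + d ≡ + x ℤ.* + m ℤ.+ (ℤ.- (+ y)) ℤ.* + n
  pushℕ {d} {y} {n} {x} {m} eq = begin
    + d                                                ≡⟨ ℤS.solve 3 (λ d y n → d ℤS.:= (d ℤS.:+ y ℤS.:* n) ℤS.:+ (ℤS.:- y) ℤS.:* n) refl (+ d) (+ y) (+ n) ⟩
    (+ d ℤ.+ + y ℤ.* + n) ℤ.+ (ℤ.- (+ y)) ℤ.* + n      ≡⟨ cong (λ t → (+ d ℤ.+ t) ℤ.+ (ℤ.- (+ y)) ℤ.* + n) (sym (ℤ.pos-* y n)) ⟩
    + (d ℕ.+ y ℕ.* n) ℤ.+ (ℤ.- (+ y)) ℤ.* + n          ≡⟨ cong (λ t → + t ℤ.+ (ℤ.- (+ y)) ℤ.* + n) eq ⟩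
    + (x ℕ.* m) ℤ.+ (ℤ.- (+ y)) ℤ.* + n                ≡⟨ cong (ℤ._+ (ℤ.- (+ y)) ℤ.* + n) (ℤ.pos-* x m) ⟩
    + x ℤ.* + m ℤ.+ (ℤ.- (+ y)) ℤ.* + n                ∎
    where open ≡-Reasoning

commonDivisorℕ : ∀ m n → CommonDivisor (+ m) (+ n)
commonDivisorℕ m n with Bézout.lemma m n
... | Bézout.result d isGCD identity with GCD.GCD.commonDivisor isGCD
... | ℕ.divides u eu , ℕ.divides v ev = build identity
  where
  build : Bézout.Identity d m n → CommonDivisor (+ m) (+ n)
  build (Bézout.+- x y eq) = record
    { g = + d ; u = + u ; v = + v ; x = + x ; y = ℤ.- (+ y)
    ; a≡ = trans (cong +_ eu) (ℤ.pos-* u d) ; b≡ = trans (cong +_ ev) (ℤ.pos-* v d)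
    ; g≡ = pushℕ {y = y} {n} {x} {m} eq }
  build (Bézout.-+ x y eq) = record
    { g = + d ; u = + u ; v = + v ; x = ℤ.- (+ x) ; y = + y
    ; a≡ = trans (cong +_ eu) (ℤ.pos-* u d) ; b≡ = trans (cong +_ ev) (ℤ.pos-* v d)
    ; g≡ = trans (pushℕ {y = x} {m} {y} {n} eq) (ℤ.+-comm (+ y ℤ.* + n) _) }

commonDivisor : ∀ a b → CommonDivisor a b
commonDivisor a b with sign a | sign b | commonDivisorℕ ℤ.∣ a ∣ ℤ.∣ b ∣
... | s , s1 , s2 | t , t1 , t2 | c = record
  { g = C.g ; u = s ℤ.* C.u ; v = t ℤ.* C.v ; x = C.x ℤ.* s ; y = C.y ℤ.* t
  ; a≡ = trans s2 (trans (cong (s ℤ.*_) C.a≡) (sym (ℤ.*-assoc s C.u C.g)))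
  ; b≡ = trans t2 (trans (cong (t ℤ.*_) C.b≡) (sym (ℤ.*-assoc t C.v C.g)))
  ; g≡ = trans C.g≡ (cong₂ ℤ._+_
      (trans (cong (C.x ℤ.*_) s1) (sym (ℤ.*-assoc C.x s a)))
      (trans (cong (C.y ℤ.*_) t1) (sym (ℤ.*-assoc C.y t b)))) }
  where module C = CommonDivisor c

record CommonDivisorℚ (p q : ℚ) : Set where
  field
    g : ℚ
    u v x y : ℤ
    p≡  : p ≡ fromℤ u ℚ.* g
    q≡  : q ≡ fromℤ v ℚ.* g
    g≡  : g ≡ fromℤ x ℚ.* p ℚ.+ fromℤ y ℚ.* q

fromℤ-≢0 : ∀ {z} → z ≢ 0ℤ → fromℤ z ≢ 0ℚ
fromℤ-≢0 z≢0 eq = z≢0 (cong ℚ.numerator eq)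

denominator≢0 : ∀ q → fromℤ (ℚ.denominator q) ≢ 0ℚ
denominator≢0 q@(mkℚ _ _ _) eq with cong ℚ.numerator eq
... | ()

commonDivisorℚ : ∀ p q → CommonDivisorℚ p q
commonDivisorℚ p q
  with invℚ (fromℤ (ℚ.denominator p)) (denominator≢0 p)
     | invℚ (fromℤ (ℚ.denominator q)) (denominator≢0 q)
... | r , dr | s , es = record
  { g = fromℤ C.g ℚ.* (r ℚ.* s) ; u = C.u ; v = C.v ; x = C.x ; y = C.y
  ; p≡ = trans p≡ae (scale C.u C.a≡)
  ; q≡ = trans q≡be (scale C.v C.b≡)
  ; g≡ = begin
      fromℤ C.g ℚ.* (r ℚ.* s)
        ≡⟨ cong (λ t → fromℤ t ℚ.* (r ℚ.* s)) C.g≡ ⟩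
      fromℤ (C.x ℤ.* a ℤ.+ C.y ℤ.* b) ℚ.* (r ℚ.* s)
        ≡⟨ cong (ℚ._* (r ℚ.* s)) (trans (fromℤ-+ (C.x ℤ.* a) (C.y ℤ.* b)) (cong₂ ℚ._+_ (fromℤ-* C.x a) (fromℤ-* C.y b))) ⟩
      (fromℤ C.x ℚ.* fromℤ a ℚ.+ fromℤ C.y ℚ.* fromℤ b) ℚ.* (r ℚ.* s)
        ≡⟨ ℚS.solve 5 (λ x a y b e → (x ℚS.:* a ℚS.:+ y ℚS.:* b) ℚS.:* e ℚS.:= x ℚS.:* (a ℚS.:* e) ℚS.:+ y ℚS.:* (b ℚS.:* e)) refl
             (fromℤ C.x) (fromℤ a) (fromℤ C.y) (fromℤ b) (r ℚ.* s) ⟩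
      fromℤ C.x ℚ.* (fromℤ a ℚ.* (r ℚ.* s)) ℚ.+ fromℤ C.y ℚ.* (fromℤ b ℚ.* (r ℚ.* s))
        ≡⟨ cong₂ (λ t t′ → fromℤ C.x ℚ.* t ℚ.+ fromℤ C.y ℚ.* t′) (sym p≡ae) (sym q≡be) ⟩
      fromℤ C.x ℚ.* p ℚ.+ fromℤ C.y ℚ.* q ∎ }
  where
  open ≡-Reasoning
  d e a b : ℤ
  d = ℚ.denominator p
  e = ℚ.denominator q
  a = ℚ.numerator p ℤ.* e
  b = ℚ.numerator q ℤ.* d
  module C = CommonDivisor (commonDivisor a b)
  scale : ∀ {a′ g′} u → a′ ≡ u ℤ.* g′ → fromℤ a′ ℚ.* (r ℚ.* s) ≡ fromℤ u ℚ.* (fromℤ g′ ℚ.* (r ℚ.* s))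
  scale {g′ = g′} u refl = trans (cong (ℚ._* (r ℚ.* s)) (fromℤ-* u g′)) (ℚ.*-assoc (fromℤ u) (fromℤ g′) (r ℚ.* s))
  expand : ∀ t d e r s → fromℤ d ℚ.* r ≡ 1ℚ → fromℤ e ℚ.* s ≡ 1ℚ →
           t ≡ (t ℚ.* fromℤ d) ℚ.* fromℤ e ℚ.* (r ℚ.* s)
  expand t d e r s dr es = begin
    t                                                   ≡⟨ ℚS.solve 1 (λ t → t ℚS.:= t ℚS.:* (ℚS.con 1ℚ ℚS.:* ℚS.con 1ℚ)) refl t ⟩
    t ℚ.* (1ℚ ℚ.* 1ℚ)                                   ≡⟨ cong₂ (λ x y → t ℚ.* (x ℚ.* y)) (sym dr) (sym es) ⟩
    t ℚ.* ((fromℤ d ℚ.* r) ℚ.* (fromℤ e ℚ.* s))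
      ≡⟨ ℚS.solve 5 (λ t d r e s → t ℚS.:* ((d ℚS.:* r) ℚS.:* (e ℚS.:* s)) ℚS.:= (t ℚS.:* d) ℚS.:* e ℚS.:* (r ℚS.:* s)) refl
           t (fromℤ d) r (fromℤ e) s ⟩
    (t ℚ.* fromℤ d) ℚ.* fromℤ e ℚ.* (r ℚ.* s)           ∎
  numer : ∀ t f {e} → e ≡ ℚ.denominator t → (t ℚ.* fromℤ e) ℚ.* fromℤ f ≡ fromℤ (ℚ.numerator t ℤ.* f)
  numer t f refl = trans (cong (ℚ._* fromℤ f) (q*denominator t)) (sym (fromℤ-* (ℚ.numerator t) f))
  p≡ae : p ≡ fromℤ a ℚ.* (r ℚ.* s)
  p≡ae = trans (expand p d e r s dr es) (cong (ℚ._* (r ℚ.* s)) (numer p e refl))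
  q≡be : q ≡ fromℤ b ℚ.* (r ℚ.* s)
  q≡be = trans (expand q e d s r es dr) (trans (cong (ℚ._* (s ℚ.* r)) (numer q d refl))
    (cong (fromℤ b ℚ.*_) (ℚ.*-comm s r)))

-- Finitely generated subgroups of ℚ are cyclic.
record Generator (qs : List ℚ) : Set₁ where
  field
    g        : ℚ
    multiple : All (λ q → ∃[ z ] q ≡ fromℤ z ℚ.* g) qs
    combo    : (P : Pred ℚ 0ℓ) → P 0ℚ → (∀ {p q} → P p → P q → P (p ℚ.+ q)) →
               (∀ z {p} → P p → P (fromℤ z ℚ.* p)) → All P qs → P g

abstract
  generator : ∀ qs → Generator qs
  generator []       = record { g = 0ℚ ; multiple = [] ; combo = λ _ P0 _ _ _ → P0 }
  generator (q ∷ qs) = record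
    { g        = C.g
    ; multiple = (C.u , C.p≡) ∷ lift G.multiple
    ; combo    = λ { P P0 P+ P* (Pq ∷ Pqs) →
        subst P (sym C.g≡) (P+ (P* C.x Pq) (P* C.y (G.combo P P0 P+ P* Pqs))) }
    }
    where
    module G = Generator (generator qs)
    module C = CommonDivisorℚ (commonDivisorℚ q G.g)
    lift : ∀ {ps} → All (λ p → ∃[ z ] p ≡ fromℤ z ℚ.* G.g) ps → All (λ p → ∃[ z ] p ≡ fromℤ z ℚ.* C.g) ps
    lift [] = []
    lift ((z , refl) ∷ rest) = (z ℤ.* C.v ,
      trans (cong (fromℤ z ℚ.*_) C.q≡)
      (trans (sym (ℚ.*-assoc (fromℤ z) (fromℤ C.v) C.g)) (cong (ℚ._* C.g) (sym (fromℤ-* z C.v))))) ∷ lift rest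

-- Every imaginary quadratic field is ℚ(√m) for exactly one negative squarefree integer m.
record ImaginaryQuadraticField : Set where
  field
    m          : ℤ
    m<0        : m ℤ.< 0ℤ
    squarefree : ∀ k → k ℕ.* k ℕ.∣ ℤ.∣ m ∣ → k ≡ 1

module QuadraticField (F : ImaginaryQuadraticField) where
  open ImaginaryQuadraticField F

  √m² : ℚ
  √m² = fromℤ m

  -- K = ℚ(√m); the element a +√ b is a + b√m.
  infix 5 _+√_
  record K : Set where
    no-eta-equality
    pattern
    constructor _+√_
    field
      re im : ℚ

  infixl 6 _+_ _-_
  infixl 7 _*_
  infix  8 -_
  infixr 8 _^_

  _+_ _*_ : K → K → K
  (a +√ b) + (c +√ d) = a ℚ.+ c +√ b ℚ.+ d
  (a +√ b) * (c +√ d) = a ℚ.* c ℚ.+ √m² ℚ.* (b ℚ.* d) +√ a ℚ.* d ℚ.+ b ℚ.* c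

  -_ : K → K
  - (a +√ b) = ℚ.- a +√ ℚ.- b

  _-_ : K → K → K
  x - y = x + (- y)

  ratK : ℚ → K
  ratK q = q +√ 0ℚ

  intK : ℤ → K
  intK z = ratK (fromℤ z)

  0# 1# : K
  0# = ratK 0ℚ
  1# = ratK 1ℚ

  _^_ : K → ℕ → K
  x ^ zero  = 1#
  x ^ suc n = x * x ^ n

  +√-cong : ∀ {a b c d} → a ≡ c → b ≡ d → (a +√ b) ≡ (c +√ d)
  +√-cong refl refl = refl

  infix 4 _≟_
  _≟_ : (x y : K) → Dec (x ≡ y)
  (a +√ b) ≟ (c +√ d) with a ℚ.≟ c | b ℚ.≟ d
  ... | yes refl | yes refl = yes refl
  ... | no a≢c   | _        = no λ { refl → a≢c refl }
  ... | yes _    | no b≢d   = no λ { refl → b≢d refl }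

  open ℚS using (solve; _:=_; _:+_; _:*_; :-_; con)

  isCommutativeRing : IsCommutativeRing _≡_ _+_ _*_ -_ 0# 1#
  isCommutativeRing = record
    { isRing = record
      { +-isAbelianGroup = record
        { isGroup = record
          { isMonoid = record
            { isSemigroup = record
              { isMagma = record { isEquivalence = isEquivalence ; ∙-cong = cong₂ _+_ }
              ; assoc   = λ { (a +√ b) (c +√ d) (e +√ f) → +√-cong (ℚ.+-assoc a c e) (ℚ.+-assoc b d f) }
              }
            ; identity = (λ { (a +√ b) → +√-cong (ℚ.+-identityˡ a) (ℚ.+-identityˡ b) })
                       , (λ { (a +√ b) → +√-cong (ℚ.+-identityʳ a) (ℚ.+-identityʳ b) })
            }
          ; inverse = (λ { (a +√ b) → +√-cong (ℚ.+-inverseˡ a) (ℚ.+-inverseˡ b) })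
                    , (λ { (a +√ b) → +√-cong (ℚ.+-inverseʳ a) (ℚ.+-inverseʳ b) })
          ; ⁻¹-cong = cong (-_)
          }
        ; comm = λ { (a +√ b) (c +√ d) → +√-cong (ℚ.+-comm a c) (ℚ.+-comm b d) }
        }
      ; *-cong     = cong₂ _*_
      ; *-assoc    = λ { (a +√ b) (c +√ d) (e +√ f) → +√-cong
          (solve 7 (λ a b c d e f m → (a :* c :+ m :* (b :* d)) :* e :+ m :* ((a :* d :+ b :* c) :* f)
                                    := a :* (c :* e :+ m :* (d :* f)) :+ m :* (b :* (c :* f :+ d :* e)))
             refl a b c d e f √m²)
          (solve 7 (λ a b c d e f m → (a :* c :+ m :* (b :* d)) :* f :+ (a :* d :+ b :* c) :* e
                                    := a :* (c :* f :+ d :* e) :+ b :* (c :* e :+ m :* (d :* f)))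
             refl a b c d e f √m²) }
      ; *-identity = (λ { (a +√ b) → +√-cong
                            (solve 3 (λ a b m → con 1ℚ :* a :+ m :* (con 0ℚ :* b) := a) refl a b √m²)
                            (solve 2 (λ a b → con 1ℚ :* b :+ con 0ℚ :* a := b) refl a b) })
                   , (λ { (a +√ b) → +√-cong
                            (solve 3 (λ a b m → a :* con 1ℚ :+ m :* (b :* con 0ℚ) := a) refl a b √m²)
                            (solve 2 (λ a b → a :* con 0ℚ :+ b :* con 1ℚ := b) refl a b) })
      ; distrib    = (λ { (a +√ b) (c +√ d) (e +√ f) → +√-cong
                            (solve 7 (λ a b c d e f m → a :* (c :+ e) :+ m :* (b :* (d :+ f))
                               := (a :* c :+ m :* (b :* d)) :+ (a :* e :+ m :* (b :* f))) refl a b c d e f √m²)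
                            (solve 6 (λ a b c d e f → a :* (d :+ f) :+ b :* (c :+ e)
                               := (a :* d :+ b :* c) :+ (a :* f :+ b :* e)) refl a b c d e f) })
                   , (λ { (a +√ b) (c +√ d) (e +√ f) → +√-cong
                            (solve 7 (λ a b c d e f m → (c :+ e) :* a :+ m :* ((d :+ f) :* b)
                               := (c :* a :+ m :* (d :* b)) :+ (e :* a :+ m :* (f :* b))) refl a b c d e f √m²)
                            (solve 6 (λ a b c d e f → (c :+ e) :* b :+ (d :+ f) :* a
                               := (c :* b :+ d :* a) :+ (e :* b :+ f :* a)) refl a b c d e f) })
      }
    ; *-comm = λ { (a +√ b) (c +√ d) → +√-cong
        (solve 5 (λ a b c d m → a :* c :+ m :* (b :* d) := c :* a :+ m :* (d :* b)) refl a b c d √m²)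
        (solve 4 (λ a b c d → a :* d :+ b :* c := c :* b :+ d :* a) refl a b c d) }
    }

  commutativeRing : CommutativeRing 0ℓ 0ℓ
  commutativeRing = record { isCommutativeRing = isCommutativeRing }

  open CommutativeRing commutativeRing using
    ( commutativeSemiring; *-comm; *-assoc; +-assoc; +-comm; zeroˡ; zeroʳ; distribˡ; distribʳ
    ; +-identityˡ; +-identityʳ; *-identityˡ; *-identityʳ; -‿inverseˡ; -‿inverseʳ)

  module KS = NaturalSolver commutativeSemiring

  ratK-+ : ∀ p q → ratK (p ℚ.+ q) ≡ ratK p + ratK q
  ratK-+ p q = +√-cong refl refl

  ratK-* : ∀ p q → ratK (p ℚ.* q) ≡ ratK p * ratK q
  ratK-* p q = +√-cong
    (solve 3 (λ p q m → p :* q := p :* q :+ m :* (con 0ℚ :* con 0ℚ)) refl p q √m²)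
    (solve 2 (λ p q → con 0ℚ := p :* con 0ℚ :+ con 0ℚ :* q) refl p q)

  ratK-^ : ∀ q k → ratK q ^ k ≡ ratK (q ^ℚ k)
  ratK-^ q zero    = refl
  ratK-^ q (suc k) = trans (cong (ratK q *_) (ratK-^ q k)) (sym (ratK-* q (q ^ℚ k)))

  intK-+ : ∀ a b → intK (a ℤ.+ b) ≡ intK a + intK b
  intK-+ a b = trans (cong ratK (fromℤ-+ a b)) (ratK-+ (fromℤ a) (fromℤ b))

  intK-* : ∀ a b → intK (a ℤ.* b) ≡ intK a * intK b
  intK-* a b = trans (cong ratK (fromℤ-* a b)) (ratK-* (fromℤ a) (fromℤ b))

  -1*x≡-x : ∀ x → intK ℤ.-1ℤ * x ≡ - x
  -1*x≡-x (a +√ b) = +√-cong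
    (solve 3 (λ a b m → con (ℚ.- 1ℚ) :* a :+ m :* (con 0ℚ :* b) := :- a) refl a b √m²)
    (solve 2 (λ a b → con (ℚ.- 1ℚ) :* b :+ con 0ℚ :* a := :- b) refl a b)

  ^-distrib-* : ∀ x y k → (x * y) ^ k ≡ x ^ k * y ^ k
  ^-distrib-* x y zero    = sym (*-identityˡ 1#)
  ^-distrib-* x y (suc k) = trans (cong ((x * y) *_) (^-distrib-* x y k))
    (KS.solve 4 (λ x y p q → (x KS.:* y) KS.:* (p KS.:* q) KS.:= (x KS.:* p) KS.:* (y KS.:* q)) refl
      x y (x ^ k) (y ^ k))

  conj : K → K
  conj (a +√ b) = a +√ ℚ.- b

  trace norm : K → ℚ
  trace (a +√ b) = a ℚ.+ a
  norm  (a +√ b) = a ℚ.* a ℚ.+ ℚ.- (√m² ℚ.* (b ℚ.* b))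

  conj-+ : ∀ x y → conj (x + y) ≡ conj x + conj y
  conj-+ (a +√ b) (c +√ d) = +√-cong refl (ℚ.neg-distrib-+ b d)

  conj-* : ∀ x y → conj (x * y) ≡ conj x * conj y
  conj-* (a +√ b) (c +√ d) = +√-cong
    (solve 5 (λ a b c d m → a :* c :+ m :* (b :* d) := a :* c :+ m :* (:- b :* :- d)) refl a b c d √m²)
    (solve 4 (λ a b c d → :- (a :* d :+ b :* c) := a :* :- d :+ :- b :* c) refl a b c d)

  conj-involutive : ∀ x → conj (conj x) ≡ x
  conj-involutive (a +√ b) = +√-cong refl (solve 1 (λ b → :- (:- b) := b) refl b)

  x+conj : ∀ x → x + conj x ≡ ratK (trace x)
  x+conj (a +√ b) = +√-cong refl (ℚ.+-inverseʳ b)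

  x*conj : ∀ x → x * conj x ≡ ratK (norm x)
  x*conj (a +√ b) = +√-cong
    (solve 3 (λ a b m → a :* a :+ m :* (b :* :- b) := a :* a :+ :- (m :* (b :* b))) refl a b √m²)
    (solve 2 (λ a b → a :* :- b :+ b :* a := con 0ℚ) refl a b)

  norm-* : ∀ x y → norm (x * y) ≡ norm x ℚ.* norm y
  norm-* (a +√ b) (c +√ d) =
    solve 5 (λ a b c d m →
      (a :* c :+ m :* (b :* d)) :* (a :* c :+ m :* (b :* d)) :+ :- (m :* ((a :* d :+ b :* c) :* (a :* d :+ b :* c)))
      := (a :* a :+ :- (m :* (b :* b))) :* (c :* c :+ :- (m :* (d :* d)))) refl a b c d √m²

  norm-conj : ∀ x → norm (conj x) ≡ norm x
  norm-conj (a +√ b) = solve 3 (λ a b m → a :* a :+ :- (m :* (:- b :* :- b)) := a :* a :+ :- (m :* (b :* b))) refl a b √m²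

  norm-ratK : ∀ q → norm (ratK q) ≡ q ℚ.* q
  norm-ratK q = solve 2 (λ q m → q :* q :+ :- (m :* (con 0ℚ :* con 0ℚ)) := q :* q) refl q √m²

  trace-ratK* : ∀ q x → trace (ratK q * x) ≡ q ℚ.* trace x
  trace-ratK* q (a +√ b) = solve 4 (λ q a b m →
    (q :* a :+ m :* (con 0ℚ :* b)) :+ (q :* a :+ m :* (con 0ℚ :* b)) := q :* (a :+ a)) refl q a b √m²

  norm-ratK* : ∀ q x → norm (ratK q * x) ≡ q ℚ.* q ℚ.* norm x
  norm-ratK* q x = trans (norm-* (ratK q) x) (cong (ℚ._* norm x) (norm-ratK q))

  square-nonNeg : ∀ q → 0ℚ ℚ.≤ q ℚ.* q
  square-nonNeg q with ℚ.≤-total 0ℚ q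
  ... | inj₁ 0≤q = ℚ.nonNegative⁻¹ (q ℚ.* q) ⦃ ℚ.nonNeg*nonNeg⇒nonNeg q ⦃ ℚ.nonNegative 0≤q ⦄ q ⦃ ℚ.nonNegative 0≤q ⦄ ⦄
  ... | inj₂ q≤0 = ℚ.nonNegative⁻¹ (q ℚ.* q) ⦃ ℚ.nonPos*nonPos⇒nonPos q ⦃ ℚ.nonPositive q≤0 ⦄ q ⦃ ℚ.nonPositive q≤0 ⦄ ⦄

  square≡0 : ∀ q → q ℚ.* q ≡ 0ℚ → q ≡ 0ℚ
  square≡0 q qq≡0 with q ℚ.≟ 0ℚ
  ... | yes q≡0 = q≡0
  ... | no q≢0  = ℚ-cancel q q qq≡0 q≢0

  nonNeg+nonNeg≡0 : ∀ p q → 0ℚ ℚ.≤ p → 0ℚ ℚ.≤ q → p ℚ.+ q ≡ 0ℚ → p ≡ 0ℚ × q ≡ 0ℚ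
  nonNeg+nonNeg≡0 p q 0≤p 0≤q eq =
      ℚ.≤-antisym (subst₂ ℚ._≤_ (ℚ.+-identityʳ p) eq (ℚ.+-monoʳ-≤ p 0≤q)) 0≤p
    , ℚ.≤-antisym (subst₂ ℚ._≤_ (ℚ.+-identityˡ q) eq (ℚ.+-monoˡ-≤ q 0≤p)) 0≤q

  m≢0 : √m² ≢ 0ℚ
  m≢0 = fromℤ-≢0 (λ { refl → ℤ.<-irrefl refl m<0 })

  √m²<0 : √m² ℚ.< 0ℚ
  √m²<0 = ℚ.*<* (subst₂ ℤ._<_ (sym (ℤ.*-identityʳ m)) refl m<0)

  norm≡0 : ∀ x → norm x ≡ 0ℚ → x ≡ 0#
  norm≡0 (a +√ b) eq = +√-cong (square≡0 a (proj₁ both)) (square≡0 b (ℚ-cancel √m² (b ℚ.* b) mbb≡0 m≢0))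
    where
    mbb = √m² ℚ.* (b ℚ.* b)
    0≤-mbb : 0ℚ ℚ.≤ ℚ.- mbb
    0≤-mbb = ℚ.neg-antimono-≤ (ℚ.nonPositive⁻¹ mbb
      ⦃ ℚ.nonPos*nonNeg⇒nonPos √m² ⦃ ℚ.nonPositive (ℚ.<⇒≤ √m²<0) ⦄ (b ℚ.* b) ⦃ ℚ.nonNegative (square-nonNeg b) ⦄ ⦄)
    both = nonNeg+nonNeg≡0 (a ℚ.* a) (ℚ.- mbb) (square-nonNeg a) 0≤-mbb eq
    mbb≡0 : mbb ≡ 0ℚ
    mbb≡0 = trans (solve 1 (λ t → t := :- (:- t)) refl mbb) (cong ℚ.-_ (proj₂ both))

  abstract
    inverse : ∀ x → x ≢ 0# → ∃[ y ] x * y ≡ 1#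
    inverse x x≢0 with invℚ (norm x) (λ eq → x≢0 (norm≡0 x eq))
    ... | r , nr≡1 = conj x * ratK r , (begin
      x * (conj x * ratK r)      ≡⟨ sym (*-assoc x (conj x) (ratK r)) ⟩
      x * conj x * ratK r        ≡⟨ cong (_* ratK r) (x*conj x) ⟩
      ratK (norm x) * ratK r     ≡⟨ sym (ratK-* (norm x) r) ⟩
      ratK (norm x ℚ.* r)        ≡⟨ cong ratK nr≡1 ⟩
      1#                         ∎)
      where open ≡-Reasoning

  *-cancel : ∀ x y → x * y ≡ 0# → x ≢ 0# → y ≡ 0#
  *-cancel x y xy≡0 x≢0 = begin
    y              ≡⟨ sym (*-identityˡ y) ⟩
    1# * y         ≡⟨ cong (_* y) (sym (proj₂ (inverse x x≢0))) ⟩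
    x * z * y      ≡⟨ trans (cong (_* y) (*-comm x z)) (*-assoc z x y) ⟩
    z * (x * y)    ≡⟨ cong (z *_) xy≡0 ⟩
    z * 0#         ≡⟨ zeroʳ z ⟩
    0#             ∎
    where
    open ≡-Reasoning
    z = proj₁ (inverse x x≢0)

  1≢0 : 1# ≢ 0#
  1≢0 ()

  -- Value at x of the monic polynomial c₀ + c₁X + ⋯ + Xⁿ with lower coefficients c₀, …, cₙ₋₁.
  evalMonic : List ℤ → K → K
  evalMonic []       x = 1#
  evalMonic (c ∷ cs) x = intK c + x * evalMonic cs x

  -- The ring of integers of K.
  𝒪 : Pred K 0ℓ
  𝒪 x = ∃[ cs ] evalMonic cs x ≡ 0#

  -- ℤ[√m]
  record L (x : K) : Set where
    constructor _,_
    field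
      re-int : IsInt (K.re x)
      im-int : IsInt (K.im x)

  L-0 : L 0#
  L-0 = (0ℤ , refl) , (0ℤ , refl)

  L-+ : ∀ x y → L x → L y → L (x + y)
  L-+ (_ +√ _) (_ +√ _) (a , b) (c , d) = int-+ a c , int-+ b d

  L-* : ∀ x y → L x → L y → L (x * y)
  L-* (_ +√ _) (_ +√ _) (a , b) (c , d) =
    int-+ (int-* a c) (int-* (int-fromℤ m) (int-* b d)) , int-+ (int-* a d) (int-* b c)

  L-intK : ∀ z → L (intK z)
  L-intK z = (z , refl) , (0ℤ , refl)

  L-conj : ∀ x → L x → L (conj x)
  L-conj (_ +√ _) (a , b) = a , int-neg b

  -- D⁻¹ℤ[√m]
  record L/ (D : ℕ) (z : K) : Set where
    constructor clears
    field
      cleared : L (intK (+ D) * z)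

  L/-0 : ∀ D → L/ D 0#
  L/-0 D = clears (subst L (sym (zeroʳ (intK (+ D)))) L-0)

  L/-+ : ∀ D x y → L/ D x → L/ D y → L/ D (x + y)
  L/-+ D x y (clears lx) (clears ly) = clears (subst L (sym (distribˡ (intK (+ D)) x y))
    (L-+ (intK (+ D) * x) (intK (+ D) * y) lx ly))

  L/-* : ∀ D E x y → L/ D x → L/ E y → L/ (D ℕ.* E) (x * y)
  L/-* D E x y (clears lx) (clears ly) = clears (subst L eq (L-* (intK (+ D) * x) (intK (+ E) * y) lx ly))
    where
    eq : intK (+ D) * x * (intK (+ E) * y) ≡ intK (+ (D ℕ.* E)) * (x * y)
    eq = trans
      (KS.solve 4 (λ d e x y → (d KS.:* x) KS.:* (e KS.:* y) KS.:= (d KS.:* e) KS.:* (x KS.:* y)) refl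
        (intK (+ D)) (intK (+ E)) x y)
      (cong (_* (x * y)) (trans (sym (intK-* (+ D) (+ E))) (cong intK (sym (ℤ.pos-* D E)))))

  L/-intK : ∀ D z x → L/ D x → L/ D (intK z * x)
  L/-intK D z x (clears lx) = clears (subst L
    (KS.solve 3 (λ d z x → z KS.:* (d KS.:* x) KS.:= d KS.:* (z KS.:* x)) refl (intK (+ D)) (intK z) x)
    (L-* (intK z) (intK (+ D) * x) (L-intK z) lx))

  L/-1 : ∀ D → L/ D 1#
  L/-1 D = clears (subst L (sym (*-identityʳ (intK (+ D)))) (L-intK (+ D)))

  L/-mono : ∀ D E x → L/ D x → L/ (D ℕ.* E) x
  L/-mono D E x lx = subst (L/ (D ℕ.* E)) (*-identityʳ x) (L/-* D E x 1# lx (L/-1 E))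

  -- x is integral iff its powers have a common denominator with respect to ℤ[√m].
  Bounded : Pred K 0ℓ
  Bounded x = ∃[ D ] 0 ℕ.< D × (∀ k → L/ D (x ^ k))

  clear : ∀ x → ∃[ D ] 0 ℕ.< D × L/ D x
  clear (a +√ b) = d ℕ.* e , ℕ.s≤s ℕ.z≤n , clears (subst L (sym eq)
    (int-* (e′ , refl) (ℚ.numerator a , q*denominator a) , int-* (d′ , refl) (ℚ.numerator b , q*denominator b)))
    where
    d = ℚ.denominatorℕ a
    e = ℚ.denominatorℕ b
    d′ e′ : ℤ
    d′ = + d
    e′ = + e
    eq : intK (+ (d ℕ.* e)) * (a +√ b) ≡ (fromℤ e′ ℚ.* (a ℚ.* fromℤ d′) +√ fromℤ d′ ℚ.* (b ℚ.* fromℤ e′))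
    eq = trans (cong (λ t → ratK t * (a +√ b)) (trans (cong fromℤ (ℤ.pos-* d e)) (fromℤ-* d′ e′))) (+√-cong
      (solve 5 (λ d e a b m → (d :* e) :* a :+ m :* (con 0ℚ :* b) := e :* (a :* d)) refl (fromℤ d′) (fromℤ e′) a b √m²)
      (solve 4 (λ d e a b → (d :* e) :* b :+ con 0ℚ :* a := d :* (b :* e)) refl (fromℤ d′) (fromℤ e′) a b))

  0<* : ∀ {a b} → 0 ℕ.< a → 0 ℕ.< b → 0 ℕ.< a ℕ.* b
  0<* {suc a} {suc b} _ _ = ℕ.s≤s ℕ.z≤n

  commonDenominator : ∀ x n → ∃[ D ] 0 ℕ.< D × (∀ k → k ℕ.< n → L/ D (x ^ k))
  commonDenominator x zero = 1 , ℕ.s≤s ℕ.z≤n , λ _ ()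
  commonDenominator x (suc n) with commonDenominator x n | clear (x ^ n)
  ... | D , 0<D , f | E , 0<E , l = D ℕ.* E , 0<* 0<D 0<E , λ k k<sn → case k k<sn
    where
    case : ∀ k → k ℕ.< suc n → L/ (D ℕ.* E) (x ^ k)
    case k k<sn with ℕ.m≤n⇒m<n∨m≡n (ℕ.≤-pred k<sn)
    ... | inj₁ k<n  = L/-mono D E (x ^ k) (f k k<n)
    ... | inj₂ refl = subst (λ t → L/ t (x ^ n)) (ℕ.*-comm E D) (L/-mono E D (x ^ n) l)

  topPower : ∀ D x cs k → (∀ i → i ℕ.< length cs → L/ D (x ^ (k ℕ.+ i))) →
             L/ D (x ^ k * evalMonic cs x) → L/ D (x ^ (k ℕ.+ length cs))
  topPower D x [] k _ l = subst (λ t → L/ D (x ^ t)) (sym (ℕ.+-identityʳ k)) (subst (L/ D) (*-identityʳ _) l)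
  topPower D x (c ∷ cs) k low l = subst (λ t → L/ D (x ^ t)) (sym (ℕ.+-suc k (length cs)))
    (topPower D x cs (suc k)
      (λ i i<n → subst (λ t → L/ D (x ^ t)) (ℕ.+-suc k i) (low (suc i) (ℕ.s≤s i<n)))
      (subst (L/ D) eq (L/-+ D (x ^ k * evalMonic (c ∷ cs) x) _ l (L/-intK D ℤ.-1ℤ (intK c * x ^ k) (L/-intK D c (x ^ k)
        (subst (λ t → L/ D (x ^ t)) (ℕ.+-identityʳ k) (low 0 (ℕ.s≤s ℕ.z≤n))))))))
    where
    open ≡-Reasoning
    eq : x ^ k * evalMonic (c ∷ cs) x + intK ℤ.-1ℤ * (intK c * x ^ k) ≡ x ^ suc k * evalMonic cs x
    eq = begin
      x ^ k * (intK c + x * evalMonic cs x) + intK ℤ.-1ℤ * (intK c * x ^ k)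
        ≡⟨ KS.solve 5 (λ p c x e n → p KS.:* (c KS.:+ x KS.:* e) KS.:+ n KS.:* (c KS.:* p)
                       KS.:= x KS.:* p KS.:* e KS.:+ (c KS.:* p KS.:+ n KS.:* (c KS.:* p))) refl
             (x ^ k) (intK c) x (evalMonic cs x) (intK ℤ.-1ℤ) ⟩
      x * x ^ k * evalMonic cs x + (intK c * x ^ k + intK ℤ.-1ℤ * (intK c * x ^ k))
        ≡⟨ cong (λ t → x * x ^ k * evalMonic cs x + t) (trans (cong (λ t → intK c * x ^ k + t) (-1*x≡-x (intK c * x ^ k))) (-‿inverseʳ (intK c * x ^ k))) ⟩
      x * x ^ k * evalMonic cs x + 0#
        ≡⟨ +-identityʳ _ ⟩
      x * x ^ k * evalMonic cs x ∎

  abstract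
    integral⇒bounded : ∀ x → x ∈ 𝒪 → Bounded x
    integral⇒bounded x (cs , root) with commonDenominator x (length cs)
    ... | D , 0<D , low = D , 0<D , <-rec (λ k → L/ D (x ^ k)) step
      where
      n : ℕ
      n = length cs
      step : ∀ k → (∀ {j} → j ℕ.< k → L/ D (x ^ j)) → L/ D (x ^ k)
      step k rec with k ℕ.<? n
      ... | yes k<n = low k k<n
      ... | no  k≮n = subst (λ t → L/ D (x ^ t)) j+n≡k
        (topPower D x cs j
          (λ i i<n → rec (subst (j ℕ.+ i ℕ.<_) j+n≡k (ℕ.+-monoʳ-< j i<n)))
          (subst (L/ D) (sym (trans (cong (λ t → x ^ j * t) root) (zeroʳ (x ^ j)))) (L/-0 D)))
        where
        j : ℕ
        j = k ℕ.∸ n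
        j+n≡k : j ℕ.+ n ≡ k
        j+n≡k = ℕ.m∸n+n≡m (ℕ.≮⇒≥ k≮n)

  bounded-* : ∀ x y → Bounded x → Bounded y → Bounded (x * y)
  bounded-* x y (D , 0<D , f) (E , 0<E , g) = D ℕ.* E , 0<* 0<D 0<E , λ k →
    subst (L/ (D ℕ.* E)) (sym (^-distrib-* x y k)) (L/-* D E (x ^ k) (y ^ k) (f k) (g k))

  bounded-+ : ∀ x y → Bounded x → Bounded y → Bounded (x + y)
  bounded-+ x y (D , 0<D , f) (E , 0<E , g) = D ℕ.* E , 0<* 0<D 0<E , λ k →
    subst (L/ (D ℕ.* E)) (trans (*-identityˡ _) (*-identityˡ _)) (mixed 0 0 k)
    where
    mixed : ∀ i j k → L/ (D ℕ.* E) (x ^ i * (y ^ j * (x + y) ^ k))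
    mixed i j zero = subst (L/ (D ℕ.* E)) (cong (λ t → x ^ i * t) (sym (*-identityʳ (y ^ j))))
      (L/-* D E (x ^ i) (y ^ j) (f i) (g j))
    mixed i j (suc k) = subst (L/ (D ℕ.* E))
      (KS.solve 5 (λ x y p q r → (x KS.:* p) KS.:* (q KS.:* r) KS.:+ p KS.:* ((y KS.:* q) KS.:* r)
                   KS.:= p KS.:* (q KS.:* ((x KS.:+ y) KS.:* r))) refl x y (x ^ i) (y ^ j) ((x + y) ^ k))
      (L/-+ (D ℕ.* E) (x ^ suc i * (y ^ j * (x + y) ^ k)) (x ^ i * (y ^ suc j * (x + y) ^ k)) (mixed (suc i) j k) (mixed i (suc j) k))

  conj-^ : ∀ x k → conj (x ^ k) ≡ conj x ^ k
  conj-^ x zero    = refl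
  conj-^ x (suc k) = trans (conj-* x (x ^ k)) (cong (conj x *_) (conj-^ x k))

  bounded-conj : ∀ x → Bounded x → Bounded (conj x)
  bounded-conj x (D , 0<D , f) = D , 0<D , λ k → clears (subst L
    (trans (conj-* (intK (+ D)) (x ^ k)) (cong (intK (+ D) *_) (conj-^ x k)))
    (L-conj (intK (+ D) * x ^ k) (L/.cleared (f k))))

  bounded-rat : ∀ q → Bounded (ratK q) → IsInt q
  bounded-rat q (D , 0<D , f) = bounded⇒int D 0<D q λ k →
    L.re-int (subst L (trans (cong (intK (+ D) *_) (ratK-^ q k)) (sym (ratK-* (fromℤ (+ D)) (q ^ℚ k)))) (L/.cleared (f k)))

  bounded⇒trace : ∀ x → Bounded x → IsInt (trace x)
  bounded⇒trace x bx = bounded-rat _ (subst Bounded (x+conj x) (bounded-+ x (conj x) bx (bounded-conj x bx)))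

  bounded⇒norm : ∀ x → Bounded x → IsInt (norm x)
  bounded⇒norm x bx = bounded-rat _ (subst Bounded (x*conj x) (bounded-* x (conj x) bx (bounded-conj x bx)))

  traceNorm⇒integral : ∀ x → IsInt (trace x) → IsInt (norm x) → x ∈ 𝒪
  traceNorm⇒integral (a +√ b) (t , t≡) (n , n≡) = n ∷ ℤ.- t ∷ [] , eq
    where
    x = a +√ b
    open ≡-Reasoning
    eq : intK n + x * (intK (ℤ.- t) + x * 1#) ≡ 0#
    eq = begin
      ratK (fromℤ n) + x * (ratK (fromℤ (ℤ.- t)) + x * 1#)
        ≡⟨ cong₂ (λ p q → ratK p + x * (ratK q + x * 1#)) (sym n≡) (trans (fromℤ-neg t) (cong ℚ.-_ (sym t≡))) ⟩
      ratK (norm x) + x * (ratK (ℚ.- (trace x)) + x * 1#)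
        ≡⟨ cong (λ z → ratK (norm x) + x * (ratK (ℚ.- (trace x)) + z)) (*-identityʳ x) ⟩
      ratK (norm x) + x * (ratK (ℚ.- (trace x)) + x)
        ≡⟨ +√-cong
             (solve 3 (λ a b m → (a :* a :+ :- (m :* (b :* b))) :+ (a :* (:- (a :+ a) :+ a) :+ m :* (b :* (con 0ℚ :+ b))) := con 0ℚ) refl a b √m²)
             (solve 2 (λ a b → con 0ℚ :+ (a :* (con 0ℚ :+ b) :+ b :* (:- (a :+ a) :+ a)) := con 0ℚ) refl a b) ⟩
      0# ∎

  bounded⇒integral : ∀ x → Bounded x → x ∈ 𝒪
  bounded⇒integral x bx = traceNorm⇒integral x (bounded⇒trace x bx) (bounded⇒norm x bx)

  𝒪-+ : ∀ x y → x ∈ 𝒪 → y ∈ 𝒪 → x + y ∈ 𝒪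
  𝒪-+ x y ox oy = bounded⇒integral (x + y) (bounded-+ x y (integral⇒bounded x ox) (integral⇒bounded y oy))

  𝒪-* : ∀ x y → x ∈ 𝒪 → y ∈ 𝒪 → x * y ∈ 𝒪
  𝒪-* x y ox oy = bounded⇒integral (x * y) (bounded-* x y (integral⇒bounded x ox) (integral⇒bounded y oy))

  𝒪-intK : ∀ z → intK z ∈ 𝒪
  𝒪-intK z = traceNorm⇒integral (intK z) (int-+ (z , refl) (z , refl))
    (int-+ (int-* (z , refl) (z , refl)) (int-neg (int-* (m , refl) (int-* (0ℤ , refl) (0ℤ , refl)))))

  𝒪-neg : ∀ x → x ∈ 𝒪 → - x ∈ 𝒪
  𝒪-neg x ox = subst 𝒪 (-1*x≡-x x) (𝒪-* (intK ℤ.-1ℤ) x (𝒪-intK ℤ.-1ℤ) ox)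

  record IsSubmodule (I : Pred K 0ℓ) : Set where
    field
      0∈      : 0# ∈ I
      +-clos  : ∀ {x y} → x ∈ I → y ∈ I → x + y ∈ I
      *-clos  : ∀ a {x} → a ∈ 𝒪 → x ∈ I → a * x ∈ I

  data Span : List K → Pred K 0ℓ where
    []   : Span [] 0#
    comb : ∀ {g gs y} a → a ∈ 𝒪 → Span gs y → Span (g ∷ gs) (a * g + y)

  -- Nonzero finitely generated 𝒪-submodules of K.
  record IsFractionalIdeal (I : Pred K 0ℓ) : Set where
    field
      isSubmodule : IsSubmodule I
      generators  : List K
      generators∈ : All I generators
      generated   : I ⊆ Span generators
      nonzero     : ∃[ x ] x ∈ I × x ≢ 0#
    open IsSubmodule isSubmodule public

  -- Nonzero ideals of 𝒪. As 𝒪 is Noetherian, asking for generators only makes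
  -- explicit the data that every nonzero ideal classically has.
  record IsIntegralIdeal (I : Pred K 0ℓ) : Set where
    field
      isFractionalIdeal : IsFractionalIdeal I
      ⊆𝒪                : I ⊆ 𝒪
    open IsFractionalIdeal isFractionalIdeal public

  infixl 6 _⊞_
  infixl 7 _·_

  _⊞_ : Pred K 0ℓ → Pred K 0ℓ → Pred K 0ℓ
  (I ⊞ J) x = ∃[ a ] ∃[ b ] a ∈ I × b ∈ J × x ≡ a + b

  -- The product of modules: finite sums of products x y with x ∈ I and y ∈ J.
  data _·_ (I J : Pred K 0ℓ) : Pred K 0ℓ where
    []  : (I · J) 0#
    add : ∀ {x y z} → x ∈ I → y ∈ J → z ∈ I · J → x * y + z ∈ I · J

  ⟨_⟩ : K → Pred K 0ℓ
  ⟨ ν ⟩ x = ∃[ a ] a ∈ 𝒪 × x ≡ ν * a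

  _⁻¹ᴵ : Pred K 0ℓ → Pred K 0ℓ
  (I ⁻¹ᴵ) x = ∀ y → y ∈ I → x * y ∈ 𝒪

  -- I + J = 𝒪, for ideals I, J of 𝒪.
  Comaximal : Pred K 0ℓ → Pred K 0ℓ → Set
  Comaximal I J = 1# ∈ I ⊞ J

  -- 𝔞 = 𝔟𝔠⁻¹ with 𝔟, 𝔠 ideals of 𝒪 that share no prime factor with 𝔫.
  record _PrimeTo_ (𝔞 𝔫 : Pred K 0ℓ) : Set₁ where
    field
      𝔟 𝔠       : Pred K 0ℓ
      𝔟-ideal   : IsIntegralIdeal 𝔟
      𝔠-ideal   : IsIntegralIdeal 𝔠
      𝔟-coprime : Comaximal 𝔟 𝔫
      𝔠-coprime : Comaximal 𝔠 𝔫
      quotient  : 𝔞 · 𝔠 ≐ 𝔟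

  -- Multiplicative congruence ν ≡* 1 (mod 𝔫): ν ∈ K* is a quotient α / β of integers
  -- prime to 𝔫 with α ≡ β (mod 𝔫). When 𝔫 = 𝒪 this says no more than ν ≠ 0.
  record _≡*1mod_ (ν : K) (𝔫 : Pred K 0ℓ) : Set where
    field
      ν≢0        : ν ≢ 0#
      α β        : K
      α∈𝒪        : α ∈ 𝒪
      β∈𝒪        : β ∈ 𝒪
      β≢0        : β ≢ 0#
      α-coprime  : Comaximal ⟨ α ⟩ 𝔫
      β-coprime  : Comaximal ⟨ β ⟩ 𝔫
      congruent  : α - β ∈ 𝔫
      quotient   : ν * β ≡ α

  -- Equality of the cosets of 𝔞 and 𝔟 modulo P_{K,1}(𝔫) = { ν𝒪 ∣ ν ≡* 1 (mod 𝔫) }.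
  SameRayClass : Pred K 0ℓ → Pred K 0ℓ → Pred K 0ℓ → Set
  SameRayClass 𝔫 𝔞 𝔟 = ∃[ ν ] (ν ≡*1mod 𝔫) × (𝔞 ≐ ⟨ ν ⟩ · 𝔟)

  ≐-refl : ∀ {I : Pred K 0ℓ} → I ≐ I
  ≐-refl = (λ p → p) , (λ p → p)

  ≐-sym : ∀ {I J : Pred K 0ℓ} → I ≐ J → J ≐ I
  ≐-sym (f , g) = g , f

  ≐-trans : ∀ {I J L : Pred K 0ℓ} → I ≐ J → J ≐ L → I ≐ L
  ≐-trans (f , g) (h , k) = (λ p → h (f p)) , (λ p → g (k p))

  resp : ∀ (I : Pred K 0ℓ) {x y} → x ≡ y → I x → I y
  resp I = subst I

  ·-cong : ∀ {I I′ J J′ : Pred K 0ℓ} → I ≐ I′ → J ≐ J′ → I · J ≐ I′ · J′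
  ·-cong (f , f′) (g , g′) = mono f g , mono f′ g′
    where
    mono : ∀ {I I′ J J′ : Pred K 0ℓ} → I ⊆ I′ → J ⊆ J′ → I · J ⊆ I′ · J′
    mono f g []            = []
    mono f g (add p q r) = add (f p) (g q) (mono f g r)

  ·-+ : ∀ {I J : Pred K 0ℓ} {x y} → x ∈ I · J → y ∈ I · J → x + y ∈ I · J
  ·-+ {I} {J} {y = y} [] q = resp (I · J) (sym (+-identityˡ y)) q
  ·-+ {I} {J} {y = y} (add {a} {b} {z} p p′ r) q =
    resp (I · J) (sym (+-assoc (a * b) z y)) (add p p′ (·-+ r q))

  ·-single : ∀ {I J : Pred K 0ℓ} {x y} → x ∈ I → y ∈ J → x * y ∈ I · J
  ·-single {I} {J} {x} {y} p q = resp (I · J) (+-identityʳ (x * y)) (add p q [])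

  ·-comm⊆ : ∀ {I J : Pred K 0ℓ} → I · J ⊆ J · I
  ·-comm⊆ [] = []
  ·-comm⊆ {I} {J} (add {x} {y} {z} p q r) = resp (J · I) (cong (_+ z) (*-comm y x)) (add q p (·-comm⊆ r))

  ·-comm : ∀ (I J : Pred K 0ℓ) → I · J ≐ J · I
  ·-comm I J = ·-comm⊆ {I} {J} , ·-comm⊆ {J} {I}

  ≐-setoid : Setoid _ _
  ≐-setoid = record
    { Carrier = Pred K 0ℓ ; _≈_ = _≐_
    ; isEquivalence = record
      { refl = λ {I} → ≐-refl {I} ; sym = λ {I} {J} → ≐-sym {I} {J} ; trans = λ {I} {J} {L} → ≐-trans {I} {J} {L} } }

  module ≐-Reasoning = Relation.Binary.Reasoning.Setoid ≐-setoid

  ·-congˡ : ∀ (I : Pred K 0ℓ) {J J′} → J ≐ J′ → I · J ≐ I · J′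
  ·-congˡ I {J} {J′} eq = ·-cong {I} {I} {J} {J′} (≐-refl {I}) eq

  ·-congʳ : ∀ (J : Pred K 0ℓ) {I I′} → I ≐ I′ → I · J ≐ I′ · J
  ·-congʳ J {I} {I′} eq = ·-cong {I} {I′} {J} {J} eq (≐-refl {J})

  ·-assoc⊆ : ∀ {I J L : Pred K 0ℓ} → (I · J) · L ⊆ I · (J · L)
  ·-assoc⊆ {I} {J} {L} = go
    where
    times : ∀ {p l} → p ∈ I · J → l ∈ L → p * l ∈ I · (J · L)
    times {l = l} [] _ = resp (I · (J · L)) (sym (zeroˡ l)) []
    times {l = l} (add {a} {b} {z} pa pb r) pl = resp (I · (J · L))
      (trans (cong (_+ z * l) (sym (*-assoc a b l))) (sym (distribʳ l (a * b) z)))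
      (add pa (·-single pb pl) (times r pl))
    go : (I · J) · L ⊆ I · (J · L)
    go []          = []
    go (add p q r) = ·-+ (times p q) (go r)

  ·-assoc : ∀ (I J L : Pred K 0ℓ) → (I · J) · L ≐ I · (J · L)
  ·-assoc I J L = ·-assoc⊆ {I} {J} {L} , λ p →
    proj₁ (·-comm L (I · J)) (proj₁ (·-congˡ L (·-comm J I))
      (·-assoc⊆ {L} {J} {I} (proj₁ (·-congʳ I (·-comm J L)) (proj₁ (·-comm I (J · L)) p))))

  ·-interchange : ∀ (I J L M : Pred K 0ℓ) → (I · J) · (L · M) ≐ (I · L) · (J · M)
  ·-interchange I J L M = begin
    (I · J) · (L · M)    ≈⟨ ·-assoc I J (L · M) ⟩
    I · (J · (L · M))    ≈⟨ ·-congˡ I (·-assoc J L M) ⟨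
    I · ((J · L) · M)    ≈⟨ ·-congˡ I (·-congʳ M (·-comm J L)) ⟩
    I · ((L · J) · M)    ≈⟨ ·-congˡ I (·-assoc L J M) ⟩
    I · (L · (J · M))    ≈⟨ ·-assoc I L (J · M) ⟨
    (I · L) · (J · M)    ∎
    where open ≐-Reasoning

  𝒪-1 : 1# ∈ 𝒪
  𝒪-1 = 𝒪-intK 1ℤ

  𝒪-0 : 0# ∈ 𝒪
  𝒪-0 = 𝒪-intK 0ℤ

  𝒪-submodule : IsSubmodule 𝒪
  𝒪-submodule = record { 0∈ = 𝒪-0 ; +-clos = λ {x} {y} → 𝒪-+ x y ; *-clos = λ a {x} → 𝒪-* a x }

  ·-⊆ : ∀ {I J M : Pred K 0ℓ} → IsSubmodule M → (∀ {x y} → x ∈ I → y ∈ J → x * y ∈ M) → I · J ⊆ M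
  ·-⊆ sm f []          = IsSubmodule.0∈ sm
  ·-⊆ sm f (add p q r) = IsSubmodule.+-clos sm (f p q) (·-⊆ sm f r)

  𝒪· : ∀ {I : Pred K 0ℓ} → IsSubmodule I → 𝒪 · I ≐ I
  𝒪· {I} sm = ·-⊆ sm (λ {x} p q → IsSubmodule.*-clos sm x p q)
            , λ {x} p → resp (𝒪 · I) (*-identityˡ x) (·-single 𝒪-1 p)

  ·-submodule : ∀ {I J : Pred K 0ℓ} → IsSubmodule I → IsSubmodule (I · J)
  ·-submodule {I} {J} sm = record { 0∈ = [] ; +-clos = ·-+ ; *-clos = scale }
    where
    scale : ∀ a {x} → a ∈ 𝒪 → x ∈ I · J → a * x ∈ I · J
    scale a a∈ [] = resp (I · J) (sym (zeroʳ a)) []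
    scale a a∈ (add {x} {y} {z} p q r) = resp (I · J)
      (trans (cong (_+ a * z) (*-assoc a x y)) (sym (distribˡ a (x * y) z)))
      (add (IsSubmodule.*-clos sm a a∈ p) q (scale a a∈ r))

  preimage-submodule : ∀ {M : Pred K 0ℓ} c → IsSubmodule M → IsSubmodule (λ y → c * y ∈ M)
  preimage-submodule {M} c sm = record
    { 0∈     = resp M (sym (zeroʳ c)) (IsSubmodule.0∈ sm)
    ; +-clos = λ {x} {y} p q → resp M (sym (distribˡ c x y)) (IsSubmodule.+-clos sm p q)
    ; *-clos = λ a {x} a∈ p → resp M
        (trans (sym (*-assoc a c x)) (trans (cong (_* x) (*-comm a c)) (*-assoc c a x)))
        (IsSubmodule.*-clos sm a a∈ p)
    }

  Span⊆ : ∀ {M : Pred K 0ℓ} {gs} → IsSubmodule M → All M gs → Span gs ⊆ M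
  Span⊆ sm [] []                    = IsSubmodule.0∈ sm
  Span⊆ sm (Mg ∷ Mgs) (comb a a∈ s) = IsSubmodule.+-clos sm (IsSubmodule.*-clos sm a a∈ Mg) (Span⊆ sm Mgs s)

  Span-0 : ∀ gs → 0# ∈ Span gs
  Span-0 []       = []
  Span-0 (g ∷ gs) = resp (Span (g ∷ gs)) (trans (cong (_+ 0#) (zeroˡ g)) (+-identityˡ 0#)) (comb 0# 𝒪-0 (Span-0 gs))

  Span-+ : ∀ {gs x y} → x ∈ Span gs → y ∈ Span gs → x + y ∈ Span gs
  Span-+ [] [] = resp (Span []) (sym (+-identityˡ 0#)) []
  Span-+ {g ∷ gs} (comb {y = y} a a∈ s) (comb {y = z} b b∈ t) = resp (Span (g ∷ gs))
    (KS.solve 5 (λ a b g y z → (a KS.:+ b) KS.:* g KS.:+ (y KS.:+ z) KS.:= (a KS.:* g KS.:+ y) KS.:+ (b KS.:* g KS.:+ z)) refl a b g y z)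
    (comb (a + b) (𝒪-+ a b a∈ b∈) (Span-+ s t))

  Span-* : ∀ {gs} c {x} → c ∈ 𝒪 → x ∈ Span gs → c * x ∈ Span gs
  Span-* c c∈ [] = resp (Span []) (sym (zeroʳ c)) []
  Span-* {g ∷ gs} c c∈ (comb {y = y} a a∈ s) = resp (Span (g ∷ gs))
    (trans (cong (_+ c * y) (*-assoc c a g)) (sym (distribˡ c (a * g) y)))
    (comb (c * a) (𝒪-* c a c∈ a∈) (Span-* c c∈ s))

  Span-submodule : ∀ gs → IsSubmodule (Span gs)
  Span-submodule gs = record { 0∈ = Span-0 gs ; +-clos = Span-+ ; *-clos = Span-* }

  Span-∈ : ∀ {g gs} → g ∈ˡ gs → g ∈ Span gs
  Span-∈ {g} {gs} (here {xs = hs} refl) = resp (Span gs) (trans (+-identityʳ (1# * g)) (*-identityˡ g)) (comb 1# 𝒪-1 (Span-0 hs))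
  Span-∈ {g} {h ∷ hs} (there g∈) = resp (Span (h ∷ hs)) (trans (cong (_+ g) (zeroˡ h)) (+-identityˡ g)) (comb 0# 𝒪-0 (Span-∈ g∈))

  Span-nonzero : ∀ {gs x} → x ∈ Span gs → x ≢ 0# → ∃[ g ] g ∈ˡ gs × g ≢ 0#
  Span-nonzero [] x≢0 = ⊥-elim (x≢0 refl)
  Span-nonzero {g ∷ gs} (comb {y = y} a a∈ s) x≢0 with g ≟ 0#
  ... | no g≢0   = g , here refl , g≢0
  ... | yes refl with Span-nonzero s (λ y≡0 → x≢0 (trans (cong₂ _+_ (zeroʳ a) y≡0) (+-identityˡ 0#)))
  ... | h , h∈ , h≢0 = h , there h∈ , h≢0

  ·-fractional : ∀ {I J : Pred K 0ℓ} → IsFractionalIdeal I → IsFractionalIdeal J → IsFractionalIdeal (I · J)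
  ·-fractional {I} {J} fI fJ = record
    { isSubmodule = ·-submodule I.isSubmodule
    ; generators  = gens
    ; generators∈ = All.tabulate λ g∈ → gen∈ g∈
    ; generated   = ·-⊆ (Span-submodule gens) λ {x} {y} p q → xy∈ x y (I.generated p) (J.generated q)
    ; nonzero     = nz
    }
    where
    module I = IsFractionalIdeal fI
    module J = IsFractionalIdeal fJ
    gens = cartesianProductWith _*_ I.generators J.generators
    gen∈ : ∀ {g} → g ∈ˡ gens → g ∈ I · J
    gen∈ g∈ with ∈ˡ.∈-cartesianProductWith⁻ _*_ I.generators J.generators g∈
    ... | a , b , a∈ , b∈ , refl = ·-single (All.lookup I.generators∈ a∈) (All.lookup J.generators∈ b∈)
    xh∈ : ∀ h → h ∈ˡ J.generators → ∀ x → x ∈ Span I.generators → h * x ∈ Span gens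
    xh∈ h h∈ x s = Span⊆ (preimage-submodule h (Span-submodule gens))
      (All.tabulate λ {g} g∈ → resp (Span gens) (*-comm g h) (Span-∈ (∈ˡ.∈-cartesianProductWith⁺ _*_ g∈ h∈))) s
    xy∈ : ∀ x y → x ∈ Span I.generators → y ∈ Span J.generators → x * y ∈ Span gens
    xy∈ x y s t = Span⊆ (preimage-submodule x (Span-submodule gens))
      (All.tabulate λ {h} h∈ → resp (Span gens) (*-comm h x) (xh∈ h h∈ x s)) t
    nz : ∃[ x ] x ∈ I · J × x ≢ 0#
    nz with I.nonzero | J.nonzero
    ... | x , x∈ , x≢0 | y , y∈ , y≢0 = x * y , ·-single x∈ y∈ , λ eq → y≢0 (*-cancel x y eq x≢0)

  𝒪-fractional : IsFractionalIdeal 𝒪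
  𝒪-fractional = record
    { isSubmodule = 𝒪-submodule
    ; generators  = 1# ∷ []
    ; generators∈ = 𝒪-1 ∷ []
    ; generated   = λ {x} x∈ → resp (Span (1# ∷ [])) (trans (+-identityʳ (x * 1#)) (*-identityʳ x)) (comb x x∈ [])
    ; nonzero     = 1# , 𝒪-1 , 1≢0
    }

  𝒪-integral : IsIntegralIdeal 𝒪
  𝒪-integral = record { isFractionalIdeal = 𝒪-fractional ; ⊆𝒪 = λ p → p }

  ·-integral : ∀ {I J : Pred K 0ℓ} → IsIntegralIdeal I → IsIntegralIdeal J → IsIntegralIdeal (I · J)
  ·-integral iI iJ = record
    { isFractionalIdeal = ·-fractional (IsIntegralIdeal.isFractionalIdeal iI) (IsIntegralIdeal.isFractionalIdeal iJ)
    ; ⊆𝒪 = ·-⊆ 𝒪-submodule λ {x} {y} p q → 𝒪-* x y (IsIntegralIdeal.⊆𝒪 iI p) (IsIntegralIdeal.⊆𝒪 iJ q)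
    }

  ·-nonzero : ∀ {I J : Pred K 0ℓ} {x} → x ∈ I · J → x ≢ 0# → ∃[ y ] y ∈ J × y ≢ 0#
  ·-nonzero [] x≢0 = ⊥-elim (x≢0 refl)
  ·-nonzero (add {x} {y} {z} p q r) x≢0 with y ≟ 0#
  ... | no y≢0   = y , q , y≢0
  ... | yes refl = ·-nonzero r (λ z≡0 → x≢0 (trans (cong₂ _+_ (zeroʳ x) z≡0) (+-identityˡ 0#)))

  ⁻¹ᴵ-submodule : ∀ (I : Pred K 0ℓ) → IsSubmodule (I ⁻¹ᴵ)
  ⁻¹ᴵ-submodule I = record
    { 0∈     = λ y _ → resp 𝒪 (sym (zeroˡ y)) 𝒪-0
    ; +-clos = λ {a} {b} p q y y∈ → resp 𝒪 (sym (distribʳ y a b)) (𝒪-+ (a * y) (b * y) (p y y∈) (q y y∈))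
    ; *-clos = λ c {a} c∈ p y y∈ → resp 𝒪 (sym (*-assoc c a y)) (𝒪-* c (a * y) c∈ (p y y∈))
    }

  cancelInverse : ∀ r z g → g ℚ.* r ≡ 1ℚ → r ℚ.* (z ℚ.* g) ≡ z
  cancelInverse r z g gr≡1 = begin
    r ℚ.* (z ℚ.* g)      ≡⟨ solve 3 (λ r z g → r :* (z :* g) := z :* (g :* r)) refl r z g ⟩
    z ℚ.* (g ℚ.* r)      ≡⟨ cong (z ℚ.*_) gr≡1 ⟩
    z ℚ.* 1ℚ             ≡⟨ ℚ.*-identityʳ z ⟩
    z                    ∎
    where open ≡-Reasoning

  -- Let r⁻¹ generate the subgroup of ℚ spanned by the norms N(x) and the traces Tr(x ȳ) of
  -- generators x, y of I. Then r x ȳ has integral trace and norm, so r Ī ⊆ I⁻¹, while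
  -- 1 is a ℤ-combination of the r N(x) and r Tr(x ȳ), which lie in I · r Ī. Hence I · I⁻¹ = 𝒪.
  module Inversion {I : Pred K 0ℓ} (fI : IsFractionalIdeal I) where
    open IsFractionalIdeal fI
    gs = generators

    traceOf : K → K → ℚ
    traceOf x y = trace (x * conj y)

    qs : List ℚ
    qs = map norm gs ++ cartesianProductWith traceOf gs gs

    norm∈ : ∀ {x} → x ∈ˡ gs → norm x ∈ˡ qs
    norm∈ x∈ = ∈ˡ.∈-++⁺ˡ (∈ˡ.∈-map⁺ norm x∈)

    trace∈ : ∀ {x y} → x ∈ˡ gs → y ∈ˡ gs → traceOf x y ∈ˡ qs
    trace∈ x∈ y∈ = ∈ˡ.∈-++⁺ʳ (map norm gs) (∈ˡ.∈-cartesianProductWith⁺ traceOf x∈ y∈)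

    module Dual (G : Generator qs) (r : ℚ) (gr≡1 : Generator.g G ℚ.* r ≡ 1ℚ) where
      open Generator G

      multiple⇒int : ∀ {q} → q ∈ˡ qs → IsInt (r ℚ.* q)
      multiple⇒int {q} q∈ with All.lookup multiple q∈
      ... | z , eq = z , trans (cong (r ℚ.*_) eq) (cancelInverse r (fromℤ z) g gr≡1)

      dual : K → K
      dual x = ratK r * conj x

      dual-integral : ∀ {x y} → x ∈ˡ gs → y ∈ˡ gs → dual x * y ∈ 𝒪
      dual-integral {x} {y} x∈ y∈ = subst 𝒪 eq (traceNorm⇒integral (ratK r * (y * conj x))
        (subst IsInt (sym (trace-ratK* r (y * conj x))) (multiple⇒int (trace∈ y∈ x∈)))
        (subst IsInt (sym normEq) (int-* (multiple⇒int (norm∈ x∈)) (multiple⇒int (norm∈ y∈)))))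
        where
        eq : ratK r * (y * conj x) ≡ dual x * y
        eq = trans (cong (ratK r *_) (*-comm y (conj x))) (sym (*-assoc (ratK r) (conj x) y))
        normEq : norm (ratK r * (y * conj x)) ≡ (r ℚ.* norm x) ℚ.* (r ℚ.* norm y)
        normEq = trans (norm-ratK* r (y * conj x))
          (trans (cong (r ℚ.* r ℚ.*_) (trans (norm-* y (conj x)) (cong (norm y ℚ.*_) (norm-conj x))))
          (solve 3 (λ r a b → r :* r :* (b :* a) := (r :* a) :* (r :* b)) refl r (norm x) (norm y)))

      dual∈ : ∀ {x} → x ∈ˡ gs → dual x ∈ I ⁻¹ᴵ
      dual∈ {x} x∈ y y∈ = Span⊆ (preimage-submodule (dual x) 𝒪-submodule)
        (All.tabulate λ z∈ → dual-integral x∈ z∈) (generated y∈)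

      P : Pred ℚ 0ℓ
      P q = ratK (q ℚ.* r) ∈ I · I ⁻¹ᴵ

      product : ∀ {x y} → x ∈ˡ gs → y ∈ˡ gs → ratK r * (x * conj y) ∈ I · I ⁻¹ᴵ
      product {x} {y} x∈ y∈ = resp (I · I ⁻¹ᴵ)
        (trans (sym (*-assoc x (ratK r) (conj y))) (trans (cong (_* conj y) (*-comm x (ratK r))) (*-assoc (ratK r) x (conj y))))
        (·-single (All.lookup generators∈ x∈) (dual∈ y∈))

      P-norm : ∀ {x} → x ∈ˡ gs → P (norm x)
      P-norm {x} x∈ = resp (I · I ⁻¹ᴵ) (trans (cong (ratK r *_) (x*conj x))
        (trans (sym (ratK-* r (norm x))) (cong ratK (ℚ.*-comm r (norm x))))) (product x∈ x∈)

      P-trace : ∀ {x y} → x ∈ˡ gs → y ∈ˡ gs → P (traceOf x y)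
      P-trace {x} {y} x∈ y∈ = resp (I · I ⁻¹ᴵ) eq (·-+ (product x∈ y∈) (product y∈ x∈))
        where
        open ≡-Reasoning
        t = x * conj y
        eq : ratK r * (x * conj y) + ratK r * (y * conj x) ≡ ratK (traceOf x y ℚ.* r)
        eq = begin
          ratK r * t + ratK r * (y * conj x)           ≡⟨ cong (λ w → ratK r * t + ratK r * w) (trans (*-comm y (conj x)) (cong (conj x *_) (sym (conj-involutive y)))) ⟩
          ratK r * t + ratK r * (conj x * conj (conj y)) ≡⟨ cong (λ w → ratK r * t + ratK r * w) (sym (conj-* x (conj y))) ⟩
          ratK r * t + ratK r * conj t                 ≡⟨ sym (distribˡ (ratK r) t (conj t)) ⟩
          ratK r * (t + conj t)                        ≡⟨ cong (ratK r *_) (x+conj t) ⟩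
          ratK r * ratK (trace t)                      ≡⟨ sym (ratK-* r (trace t)) ⟩
          ratK (r ℚ.* trace t)                         ≡⟨ cong ratK (ℚ.*-comm r (trace t)) ⟩
          ratK (trace t ℚ.* r)                         ∎

      P-all : All P qs
      P-all = All.++⁺ (All.map⁺ (All.tabulate P-norm))
        (All.tabulate λ q∈ → byPair (∈ˡ.∈-cartesianProductWith⁻ traceOf gs gs q∈))
        where
        byPair : ∀ {q} → ∃[ a ] ∃[ b ] (a ∈ˡ gs × b ∈ˡ gs × q ≡ traceOf a b) → P q
        byPair (a , b , a∈ , b∈ , refl) = P-trace a∈ b∈

      P-g : P g
      P-g = combo P (resp (I · I ⁻¹ᴵ) (cong ratK (sym (ℚ.*-zeroˡ r))) [])
        (λ {p} {q} Pp Pq → resp (I · I ⁻¹ᴵ) (trans (sym (ratK-+ (p ℚ.* r) (q ℚ.* r))) (cong ratK (sym (ℚ.*-distribʳ-+ r p q)))) (·-+ Pp Pq))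
        (λ z {p} Pp → resp (I · I ⁻¹ᴵ) (trans (sym (ratK-* (fromℤ z) (p ℚ.* r))) (cong ratK (sym (ℚ.*-assoc (fromℤ z) p r))))
          (IsSubmodule.*-clos (·-submodule isSubmodule) (intK z) (𝒪-intK z) Pp))
        P-all

      1∈ : 1# ∈ I · I ⁻¹ᴵ
      1∈ = resp (I · I ⁻¹ᴵ) (cong ratK gr≡1) P-g

    G : Generator qs
    G = generator qs

    open Generator G using (multiple)

    g≢0 : Generator.g G ≢ 0ℚ
    g≢0 g≡0 with nonzero
    ... | x , x∈ , x≢0 with Span-nonzero (generated x∈) x≢0
    ... | h , h∈ , h≢0 with All.lookup multiple (norm∈ h∈)
    ... | z , eq = h≢0 (norm≡0 h (trans eq (trans (cong (fromℤ z ℚ.*_) g≡0) (ℚ.*-zeroʳ (fromℤ z)))))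

    r∃ : ∃[ r ] Generator.g G ℚ.* r ≡ 1ℚ
    r∃ = invℚ (Generator.g G) g≢0

    1∈ : 1# ∈ I · I ⁻¹ᴵ
    1∈ = Dual.1∈ G (proj₁ r∃) (proj₂ r∃)

    invertible : I · I ⁻¹ᴵ ≐ 𝒪
    invertible = ·-⊆ 𝒪-submodule (λ {x} {y} p q → resp 𝒪 (*-comm y x) (q x p))
      , λ {x} x∈ → resp (I · I ⁻¹ᴵ) (*-identityʳ x) (IsSubmodule.*-clos (·-submodule isSubmodule) x x∈ 1∈)

    seconds : ∀ {x} → x ∈ I · I ⁻¹ᴵ → List K
    seconds []                  = []
    seconds (add {y = y} _ _ r) = y ∷ seconds r

    seconds∈ : ∀ {x} (p : x ∈ I · I ⁻¹ᴵ) → All (I ⁻¹ᴵ) (seconds p)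
    seconds∈ []          = []
    seconds∈ (add _ q r) = q ∷ seconds∈ r

    spanned : ∀ z → z ∈ I ⁻¹ᴵ → ∀ {x} (p : x ∈ I · I ⁻¹ᴵ) → z * x ∈ Span (seconds p)
    spanned z z∈ [] = resp (Span []) (sym (zeroʳ z)) []
    spanned z z∈ s@(add {x} {y} {w} p q r) = resp (Span (seconds s))
      (trans (cong (_+ z * w) (*-assoc z x y)) (sym (distribˡ z (x * y) w)))
      (comb (z * x) (z∈ x p) (spanned z z∈ r))

    inverse-fractional : IsFractionalIdeal (I ⁻¹ᴵ)
    inverse-fractional = record
      { isSubmodule = ⁻¹ᴵ-submodule I
      ; generators  = seconds 1∈
      ; generators∈ = seconds∈ 1∈
      ; generated   = λ {z} z∈ → 1-span z z∈
      ; nonzero     = nz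
      }
      where
      1-span : ∀ z → z ∈ I ⁻¹ᴵ → z ∈ Span (seconds 1∈)
      1-span z z∈ = resp (Span (seconds 1∈)) (*-identityʳ z) (spanned z z∈ 1∈)
      nz : ∃[ x ] x ∈ I ⁻¹ᴵ × x ≢ 0#
      nz = ·-nonzero 1∈ 1≢0

  principal-1 : ∀ {I : Pred K 0ℓ} → IsSubmodule I → I ≐ ⟨ 1# ⟩ · I
  principal-1 {I} sm = (λ {x} p → resp (⟨ 1# ⟩ · I) (*-identityˡ x) (·-single (1# , 𝒪-1 , sym (*-identityˡ 1#)) p))
    , ·-⊆ sm (λ { {x} {y} (a , a∈ , refl) q → resp I (cong (_* y) (sym (*-identityˡ a))) (IsSubmodule.*-clos sm a a∈ q) })

  principal-* : ∀ ν μ → ⟨ ν ⟩ · ⟨ μ ⟩ ≐ ⟨ ν * μ ⟩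
  principal-* ν μ = ·-⊆ sm (λ { (a , a∈ , refl) (b , b∈ , refl) → a * b , 𝒪-* a b a∈ b∈ ,
        KS.solve 4 (λ ν a μ b → (ν KS.:* a) KS.:* (μ KS.:* b) KS.:= (ν KS.:* μ) KS.:* (a KS.:* b)) refl ν a μ b })
    , λ { (a , a∈ , refl) → resp (⟨ ν ⟩ · ⟨ μ ⟩)
        (KS.solve 3 (λ ν μ a → (ν KS.:* a) KS.:* (μ KS.:* KS.con 1) KS.:= (ν KS.:* μ) KS.:* a) refl ν μ a)
        (·-single (a , a∈ , refl) (1# , 𝒪-1 , cong (μ *_) (+-identityʳ 1#))) }
    where
    sm : IsSubmodule ⟨ ν * μ ⟩
    sm = record
      { 0∈     = 0# , 𝒪-0 , sym (zeroʳ (ν * μ))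
      ; +-clos = λ { (a , a∈ , refl) (b , b∈ , refl) → a + b , 𝒪-+ a b a∈ b∈ , sym (distribˡ (ν * μ) a b) }
      ; *-clos = λ { c c∈ (a , a∈ , refl) → c * a , 𝒪-* c a c∈ a∈ ,
          KS.solve 3 (λ c n a → c KS.:* (n KS.:* a) KS.:= n KS.:* (c KS.:* a)) refl c (ν * μ) a }
      }

  module RayClasses (𝔫 : Pred K 0ℓ) (𝔫-ideal : IsIntegralIdeal 𝔫) where
    module 𝔫 = IsIntegralIdeal 𝔫-ideal

    comaximal-· : ∀ {I J : Pred K 0ℓ} → I ⊆ 𝒪 → Comaximal I 𝔫 → Comaximal J 𝔫 → Comaximal (I · J) 𝔫
    comaximal-· {I} {J} I⊆𝒪 (a , n , a∈ , n∈ , 1≡a+n) (b , n′ , b∈ , n′∈ , 1≡b+n′) =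
      a * b , a * n′ + n , ·-single a∈ b∈ , 𝔫.+-clos (𝔫.*-clos a (I⊆𝒪 a∈) n′∈) n∈ , (begin
        1#                        ≡⟨ 1≡a+n ⟩
        a + n                     ≡⟨ cong (_+ n) (sym (*-identityʳ a)) ⟩
        a * 1# + n                ≡⟨ cong (λ t → a * t + n) 1≡b+n′ ⟩
        a * (b + n′) + n          ≡⟨ cong (_+ n) (distribˡ a b n′) ⟩
        (a * b + a * n′) + n      ≡⟨ +-assoc (a * b) (a * n′) n ⟩
        a * b + (a * n′ + n)      ∎)
      where open ≡-Reasoning

    comaximal-1 : ∀ {I : Pred K 0ℓ} → 1# ∈ I → Comaximal I 𝔫
    comaximal-1 1∈ = 1# , 0# , 1∈ , 𝔫.0∈ , sym (+-identityʳ 1#)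

    comaximal-⊆ : ∀ {I J : Pred K 0ℓ} → I ⊆ J → Comaximal I 𝔫 → Comaximal J 𝔫
    comaximal-⊆ f (a , n , a∈ , rest) = a , n , f a∈ , rest

    primeTo-𝒪 : 𝒪 PrimeTo 𝔫
    primeTo-𝒪 = record
      { 𝔟 = 𝒪 ; 𝔠 = 𝒪 ; 𝔟-ideal = 𝒪-integral ; 𝔠-ideal = 𝒪-integral
      ; 𝔟-coprime = comaximal-1 𝒪-1 ; 𝔠-coprime = comaximal-1 𝒪-1 ; quotient = 𝒪· 𝒪-submodule }

    primeTo-· : ∀ {I J : Pred K 0ℓ} → I PrimeTo 𝔫 → J PrimeTo 𝔫 → (I · J) PrimeTo 𝔫
    primeTo-· {I} {J} pI pJ = record
      { 𝔟 = I.𝔟 · J.𝔟 ; 𝔠 = I.𝔠 · J.𝔠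
      ; 𝔟-ideal = ·-integral I.𝔟-ideal J.𝔟-ideal ; 𝔠-ideal = ·-integral I.𝔠-ideal J.𝔠-ideal
      ; 𝔟-coprime = comaximal-· (IsIntegralIdeal.⊆𝒪 I.𝔟-ideal) I.𝔟-coprime J.𝔟-coprime
      ; 𝔠-coprime = comaximal-· (IsIntegralIdeal.⊆𝒪 I.𝔠-ideal) I.𝔠-coprime J.𝔠-coprime
      ; quotient = begin
          (I · J) · (I.𝔠 · J.𝔠)    ≈⟨ ·-interchange I J I.𝔠 J.𝔠 ⟩
          (I · I.𝔠) · (J · J.𝔠)    ≈⟨ ·-cong I.quotient J.quotient ⟩
          I.𝔟 · J.𝔟                ∎ }
      where
      open ≐-Reasoning
      module I = _PrimeTo_ pI
      module J = _PrimeTo_ pJ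

    primeTo-⁻¹ : ∀ {I : Pred K 0ℓ} → IsFractionalIdeal I → I PrimeTo 𝔫 → (I ⁻¹ᴵ) PrimeTo 𝔫
    primeTo-⁻¹ {I} fI pI = record
      { 𝔟 = P.𝔠 ; 𝔠 = P.𝔟 ; 𝔟-ideal = P.𝔠-ideal ; 𝔠-ideal = P.𝔟-ideal
      ; 𝔟-coprime = P.𝔠-coprime ; 𝔠-coprime = P.𝔟-coprime
      ; quotient = begin
          I ⁻¹ᴵ · P.𝔟           ≈⟨ ·-congˡ (I ⁻¹ᴵ) P.quotient ⟨
          I ⁻¹ᴵ · (I · P.𝔠)     ≈⟨ ·-assoc (I ⁻¹ᴵ) I P.𝔠 ⟨
          (I ⁻¹ᴵ · I) · P.𝔠     ≈⟨ ·-congʳ P.𝔠 (·-comm (I ⁻¹ᴵ) I) ⟩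
          (I · I ⁻¹ᴵ) · P.𝔠     ≈⟨ ·-congʳ P.𝔠 (Inversion.invertible fI) ⟩
          𝒪 · P.𝔠               ≈⟨ 𝒪· (IsIntegralIdeal.isSubmodule P.𝔠-ideal) ⟩
          P.𝔠                   ∎ }
      where
      open ≐-Reasoning
      module P = _PrimeTo_ pI

    1≡*1 : 1# ≡*1mod 𝔫
    1≡*1 = record
      { ν≢0 = 1≢0 ; α = 1# ; β = 1# ; α∈𝒪 = 𝒪-1 ; β∈𝒪 = 𝒪-1 ; β≢0 = 1≢0
      ; α-coprime = comaximal-1 1∈⟨1⟩ ; β-coprime = comaximal-1 1∈⟨1⟩
      ; congruent = resp 𝔫 (sym (-‿inverseʳ 1#)) 𝔫.0∈ ; quotient = *-identityʳ 1# }
      where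
      1∈⟨1⟩ : 1# ∈ ⟨ 1# ⟩
      1∈⟨1⟩ = 1# , 𝒪-1 , sym (*-identityˡ 1#)

    ≡*1-* : ∀ {ν μ} → ν ≡*1mod 𝔫 → μ ≡*1mod 𝔫 → (ν * μ) ≡*1mod 𝔫
    ≡*1-* {ν} {μ} p q = record
      { ν≢0 = λ eq → q.ν≢0 (*-cancel ν μ eq p.ν≢0)
      ; α = p.α * q.α ; β = p.β * q.β
      ; α∈𝒪 = 𝒪-* p.α q.α p.α∈𝒪 q.α∈𝒪 ; β∈𝒪 = 𝒪-* p.β q.β p.β∈𝒪 q.β∈𝒪
      ; β≢0 = λ eq → q.β≢0 (*-cancel p.β q.β eq p.β≢0)
      ; α-coprime = both p.α∈𝒪 p.α-coprime q.α-coprime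
      ; β-coprime = both p.β∈𝒪 p.β-coprime q.β-coprime
      ; congruent = resp 𝔫 diff (𝔫.+-clos (𝔫.*-clos p.α p.α∈𝒪 q.congruent) (𝔫.*-clos q.β q.β∈𝒪 p.congruent))
      ; quotient = trans
          (KS.solve 4 (λ ν μ b d → (ν KS.:* μ) KS.:* (b KS.:* d) KS.:= (ν KS.:* b) KS.:* (μ KS.:* d)) refl ν μ p.β q.β)
          (cong₂ _*_ p.quotient q.quotient) }
      where
      module p = _≡*1mod_ p
      module q = _≡*1mod_ q
      both : ∀ {x y} → x ∈ 𝒪 → Comaximal ⟨ x ⟩ 𝔫 → Comaximal ⟨ y ⟩ 𝔫 → Comaximal ⟨ x * y ⟩ 𝔫
      both {x} {y} x∈ cx cy = comaximal-⊆ (proj₁ (principal-* x y))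
        (comaximal-· (λ { (a , a∈ , refl) → 𝒪-* x a x∈ a∈ }) cx cy)
      diffLemma : ∀ a b c d → a * (c - d) + d * (a - b) ≡ a * c - b * d
      diffLemma a b c d = begin
        a * (c - d) + d * (a - b)
          ≡⟨ cong₂ (λ s t → a * (c + s) + d * (a + t)) (sym (-1*x≡-x d)) (sym (-1*x≡-x b)) ⟩
        a * (c + n * d) + d * (a + n * b)
          ≡⟨ KS.solve 5 (λ a b c d n → a KS.:* (c KS.:+ n KS.:* d) KS.:+ d KS.:* (a KS.:+ n KS.:* b)
               KS.:= (a KS.:* c KS.:+ n KS.:* (b KS.:* d)) KS.:+ (a KS.:* d KS.:+ n KS.:* (a KS.:* d))) refl a b c d n ⟩
        (a * c + n * (b * d)) + (a * d + n * (a * d))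
          ≡⟨ cong₂ (λ s t → (a * c + s) + (a * d + t)) (-1*x≡-x (b * d)) (-1*x≡-x (a * d)) ⟩
        (a * c - b * d) + (a * d - a * d)
          ≡⟨ cong (λ t → (a * c - b * d) + t) (-‿inverseʳ (a * d)) ⟩
        (a * c - b * d) + 0#
          ≡⟨ +-identityʳ _ ⟩
        a * c - b * d ∎
        where
        open ≡-Reasoning
        n = intK ℤ.-1ℤ
      diff : p.α * (q.α - q.β) + q.β * (p.α - p.β) ≡ p.α * q.α - p.β * q.β
      diff = diffLemma p.α p.β q.α q.β

    ≡*1-inverse : ∀ {ν} → ν ≡*1mod 𝔫 → ∃[ μ ] (μ ≡*1mod 𝔫) × ν * μ ≡ 1#
    ≡*1-inverse {ν} p = μ , record
      { ν≢0 = λ μ≡0 → 1≢0 (trans (sym νμ≡1) (trans (cong (ν *_) μ≡0) (zeroʳ ν)))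
      ; α = p.β ; β = p.α ; α∈𝒪 = p.β∈𝒪 ; β∈𝒪 = p.α∈𝒪
      ; β≢0 = λ α≡0 → p.β≢0 (*-cancel ν p.β (trans p.quotient α≡0) p.ν≢0)
      ; α-coprime = p.β-coprime ; β-coprime = p.α-coprime
      ; congruent = resp 𝔫 flip (𝔫.*-clos (intK ℤ.-1ℤ) (𝒪-intK ℤ.-1ℤ) p.congruent)
      ; quotient = trans (cong (μ *_) (sym p.quotient))
          (trans (sym (*-assoc μ ν p.β)) (trans (cong (_* p.β) (trans (*-comm μ ν) νμ≡1)) (*-identityˡ p.β)))
      } , νμ≡1
      where
      module p = _≡*1mod_ p
      μ = proj₁ (inverse ν p.ν≢0)
      νμ≡1 : ν * μ ≡ 1#
      νμ≡1 = proj₂ (inverse ν p.ν≢0)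
      flipLemma : ∀ x y → - (x - y) ≡ y - x
      flipLemma (a +√ b) (c +√ d) = +√-cong
        (solve 2 (λ a c → :- (a :+ :- c) := c :+ :- a) refl a c)
        (solve 2 (λ a c → :- (a :+ :- c) := c :+ :- a) refl b d)
      flip : intK ℤ.-1ℤ * (p.α - p.β) ≡ p.β - p.α
      flip = trans (-1*x≡-x (p.α - p.β)) (flipLemma p.α p.β)

    -- I_K(𝔫), whose quotient by P_{K,1}(𝔫) is the setoid (𝓘, _∼_).
    record 𝓘 : Set₁ where
      field
        ideal      : Pred K 0ℓ
        fractional : IsFractionalIdeal ideal
        primeTo    : ideal PrimeTo 𝔫
      open IsFractionalIdeal fractional public using (isSubmodule)

    open 𝓘

    infix 4 _∼_
    _∼_ : 𝓘 → 𝓘 → Set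
    I ∼ J = SameRayClass 𝔫 (ideal I) (ideal J)

    _∙_ : 𝓘 → 𝓘 → 𝓘
    I ∙ J = record { ideal = ideal I · ideal J ; fractional = ·-fractional (fractional I) (fractional J)
                   ; primeTo = primeTo-· (primeTo I) (primeTo J) }

    ε : 𝓘
    ε = record { ideal = 𝒪 ; fractional = 𝒪-fractional ; primeTo = primeTo-𝒪 }

    _⁻¹ : 𝓘 → 𝓘
    I ⁻¹ = record { ideal = ideal I ⁻¹ᴵ ; fractional = Inversion.inverse-fractional (fractional I)
                  ; primeTo = primeTo-⁻¹ (fractional I) (primeTo I) }

    ≐⇒∼ : ∀ I J → ideal I ≐ ideal J → I ∼ J
    ≐⇒∼ I J eq = 1# , 1≡*1 , (begin
      ideal I             ≈⟨ eq ⟩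
      ideal J             ≈⟨ principal-1 (isSubmodule J) ⟩
      ⟨ 1# ⟩ · ideal J    ∎)
      where open ≐-Reasoning

    ∼-refl : ∀ I → I ∼ I
    ∼-refl I = ≐⇒∼ I I (≐-refl {ideal I})

    ⟨1⟩-product : ∀ ν μ → ν * μ ≡ 1# → ⟨ 1# ⟩ ≐ ⟨ μ ⟩ · ⟨ ν ⟩
    ⟨1⟩-product ν μ eq = begin
      ⟨ 1# ⟩            ≡⟨ cong ⟨_⟩ (trans (sym eq) (*-comm ν μ)) ⟩
      ⟨ μ * ν ⟩         ≈⟨ principal-* μ ν ⟨
      ⟨ μ ⟩ · ⟨ ν ⟩     ∎
      where open ≐-Reasoning

    ∼-sym : ∀ I J → I ∼ J → J ∼ I
    ∼-sym I J (ν , ν∈ , eq) = symBy (≡*1-inverse ν∈)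
      where
      open ≐-Reasoning
      symBy : ∃[ μ ] (μ ≡*1mod 𝔫) × ν * μ ≡ 1# → J ∼ I
      symBy (μ , μ∈ , νμ≡1) = μ , μ∈ , (begin
        ideal J                        ≈⟨ principal-1 (isSubmodule J) ⟩
        ⟨ 1# ⟩ · ideal J               ≈⟨ ·-congʳ (ideal J) (⟨1⟩-product ν μ νμ≡1) ⟩
        ⟨ μ ⟩ · ⟨ ν ⟩ · ideal J        ≈⟨ ·-assoc ⟨ μ ⟩ ⟨ ν ⟩ (ideal J) ⟩
        ⟨ μ ⟩ · (⟨ ν ⟩ · ideal J)      ≈⟨ ·-congˡ ⟨ μ ⟩ eq ⟨
        ⟨ μ ⟩ · ideal I                ∎)

    ∼-trans : ∀ I J L → I ∼ J → J ∼ L → I ∼ L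
    ∼-trans I J L (ν , ν∈ , eq) (μ , μ∈ , eq′) = ν * μ , ≡*1-* ν∈ μ∈ , (begin
      ideal I                        ≈⟨ eq ⟩
      ⟨ ν ⟩ · ideal J                ≈⟨ ·-congˡ ⟨ ν ⟩ eq′ ⟩
      ⟨ ν ⟩ · (⟨ μ ⟩ · ideal L)      ≈⟨ ·-assoc ⟨ ν ⟩ ⟨ μ ⟩ (ideal L) ⟨
      ⟨ ν ⟩ · ⟨ μ ⟩ · ideal L        ≈⟨ ·-congʳ (ideal L) (principal-* ν μ) ⟩
      ⟨ ν * μ ⟩ · ideal L            ∎)
      where open ≐-Reasoning

    ∙-cong : ∀ I I′ J J′ → I ∼ I′ → J ∼ J′ → (I ∙ J) ∼ (I′ ∙ J′)
    ∙-cong I I′ J J′ (ν , ν∈ , eq) (μ , μ∈ , eq′) = ν * μ , ≡*1-* ν∈ μ∈ , (begin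
      ideal I · ideal J                            ≈⟨ ·-cong eq eq′ ⟩
      (⟨ ν ⟩ · ideal I′) · (⟨ μ ⟩ · ideal J′)      ≈⟨ ·-interchange ⟨ ν ⟩ (ideal I′) ⟨ μ ⟩ (ideal J′) ⟩
      (⟨ ν ⟩ · ⟨ μ ⟩) · (ideal I′ · ideal J′)      ≈⟨ ·-congʳ (ideal I′ · ideal J′) (principal-* ν μ) ⟩
      ⟨ ν * μ ⟩ · (ideal I′ · ideal J′)            ∎)
      where open ≐-Reasoning

    inverseʳ : ∀ I → (I ∙ (I ⁻¹)) ∼ ε
    inverseʳ I = ≐⇒∼ (I ∙ (I ⁻¹)) ε (Inversion.invertible (fractional I))

    comm : ∀ I J → (I ∙ J) ∼ (J ∙ I)
    comm I J = ≐⇒∼ (I ∙ J) (J ∙ I) (·-comm (ideal I) (ideal J))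

    inverseˡ : ∀ I → ((I ⁻¹) ∙ I) ∼ ε
    inverseˡ I = ∼-trans ((I ⁻¹) ∙ I) (I ∙ (I ⁻¹)) ε (comm (I ⁻¹) I) (inverseʳ I)

    identityˡ : ∀ I → (ε ∙ I) ∼ I
    identityˡ I = ≐⇒∼ (ε ∙ I) I (𝒪· (isSubmodule I))

    identityʳ : ∀ I → (I ∙ ε) ∼ I
    identityʳ I = ∼-trans (I ∙ ε) (ε ∙ I) I (comm I ε) (identityˡ I)

    assoc : ∀ I J L → ((I ∙ J) ∙ L) ∼ (I ∙ (J ∙ L))
    assoc I J L = ≐⇒∼ ((I ∙ J) ∙ L) (I ∙ (J ∙ L)) (·-assoc (ideal I) (ideal J) (ideal L))

    ⁻¹-cong : ∀ I J → I ∼ J → (I ⁻¹) ∼ (J ⁻¹)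
    ⁻¹-cong I J I∼J = begin
      I ⁻¹                   ≈⟨ identityʳ (I ⁻¹) ⟨
      (I ⁻¹) ∙ ε             ≈⟨ ∙-cong (I ⁻¹) (I ⁻¹) ε (J ∙ (J ⁻¹)) (∼-refl (I ⁻¹)) (∼-sym (J ∙ (J ⁻¹)) ε (inverseʳ J)) ⟩
      (I ⁻¹) ∙ (J ∙ (J ⁻¹))  ≈⟨ assoc (I ⁻¹) J (J ⁻¹) ⟨
      ((I ⁻¹) ∙ J) ∙ (J ⁻¹)  ≈⟨ ∙-cong ((I ⁻¹) ∙ J) ((I ⁻¹) ∙ I) (J ⁻¹) (J ⁻¹)
                                  (∙-cong (I ⁻¹) (I ⁻¹) J I (∼-refl (I ⁻¹)) (∼-sym I J I∼J)) (∼-refl (J ⁻¹)) ⟩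
      ((I ⁻¹) ∙ I) ∙ (J ⁻¹)  ≈⟨ ∙-cong ((I ⁻¹) ∙ I) ε (J ⁻¹) (J ⁻¹) (inverseˡ I) (∼-refl (J ⁻¹)) ⟩
      ε ∙ (J ⁻¹)             ≈⟨ identityˡ (J ⁻¹) ⟩
      J ⁻¹                   ∎
      where
      ∼-setoid : Setoid _ _
      ∼-setoid = record { Carrier = 𝓘 ; _≈_ = _∼_ ; isEquivalence = record
        { refl = λ {I} → ∼-refl I ; sym = λ {I} {J} → ∼-sym I J ; trans = λ {I} {J} {L} → ∼-trans I J L } }
      open import Relation.Binary.Reasoning.Setoid ∼-setoid

    rayClassGroup : AbelianGroup _ _
    rayClassGroup = record
      { Carrier = 𝓘 ; _≈_ = _∼_ ; _∙_ = _∙_ ; ε = ε ; _⁻¹ = _⁻¹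
      ; isAbelianGroup = record
        { isGroup = record
          { isMonoid = record
            { isSemigroup = record
              { isMagma = record
                { isEquivalence = record
                  { refl = λ {I} → ∼-refl I ; sym = λ {I} {J} → ∼-sym I J ; trans = λ {I} {J} {L} → ∼-trans I J L }
                ; ∙-cong = λ {I} {I′} {J} {J′} → ∙-cong I I′ J J′
                }
              ; assoc = assoc
              }
            ; identity = identityˡ , identityʳ
            }
          ; inverse = inverseˡ , inverseʳ
          ; ⁻¹-cong = λ {I} {J} → ⁻¹-cong I J
          }
        ; comm = comm
        }
      }

  -- The conductor of ℤ[√m]. It gives d_K = m if m ≡ 1 (mod 4), d_K = 4m otherwise, and
  -- √d_K = conductor · √m, which lies in the upper half-plane when √m does.
  conductor : ℤ
  conductor with m ℤ.%ℕ 4 ℕ.≟ 1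
  ... | yes _ = 1ℤ
  ... | no  _ = + 2

  dK : ℤ
  dK = conductor ℤ.* conductor ℤ.* m

  √dK : K
  √dK = 0ℚ +√ fromℤ conductor

  [_,_] : K → K → Pred K 0ℓ
  [ α , β ] x = ∃[ r ] ∃[ s ] x ≡ intK r * α + intK s * β

  -- a x² + b x y + c y²
  record Form : Set where
    field
      a b c : ℤ

    value : ℤ → ℤ → ℤ
    value x y = a ℤ.* (x ℤ.* x) ℤ.+ b ℤ.* (x ℤ.* y) ℤ.+ c ℤ.* (y ℤ.* y)

    discriminant : ℤ
    discriminant = b ℤ.* b ℤ.- + 4 ℤ.* a ℤ.* c

    Primitive : Set
    Primitive = ℤ.gcd (ℤ.gcd a b) c ≡ 1ℤ

    PositiveDefinite : Set
    PositiveDefinite = ∀ x y → ¬ (x ≡ 0ℤ × y ≡ 0ℤ) → 0ℤ ℤ.< value x y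

  -- 𝒬_N(d), the forms in 𝒬(d) with gcd(N, a) = 1.
  record 𝒬 (N : ℕ) (d : ℤ) : Set where
    field
      form             : Form
    open Form form public
    field
      isPrimitive      : Primitive
      positiveDefinite : PositiveDefinite
      discriminant≡    : discriminant ≡ d
      coprime          : ℤ.gcd (+ N) a ≡ 1ℤ

    2a≢0 : fromℤ (+ 2 ℤ.* a) ≢ 0ℚ
    2a≢0 eq = ℤ.<-irrefl refl (subst (0ℤ ℤ.<_) (trans value≡a a≡0) (positiveDefinite 1ℤ 0ℤ λ { (() , _) }))
      where
      a≡0 : a ≡ 0ℤ
      a≡0 = ℤ.*-cancelˡ-≡ (+ 2) a 0ℤ (fromℤ-injective eq)
      value≡a : value 1ℤ 0ℤ ≡ a
      value≡a = ℤS.solve 3 (λ a b c → a ℤS.:* (ℤS.con 1ℤ ℤS.:* ℤS.con 1ℤ) ℤS.:+ b ℤS.:* (ℤS.con 1ℤ ℤS.:* ℤS.con 0ℤ)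
        ℤS.:+ c ℤS.:* (ℤS.con 0ℤ ℤS.:* ℤS.con 0ℤ) ℤS.:= a) refl a b c

  ω : ∀ {N} → 𝒬 N dK → K
  ω Q = (intK (ℤ.- b) + √dK) * ratK ((ℚ.1/ fromℤ (+ 2 ℤ.* a)) ⦃ ℚ.≢-nonZero 2a≢0 ⦄)
    where open 𝒬 Q

  record IsLeastPositiveInteger (N : ℕ) (𝔫 : Pred K 0ℓ) : Set where
    field
      positive : 0 ℕ.< N
      member   : intK (+ N) ∈ 𝔫
      least    : ∀ M → 0 ℕ.< M → intK (+ M) ∈ 𝔫 → N ℕ.≤ M

  module FormClasses (𝔫 : Pred K 0ℓ) (𝔫-ideal : IsIntegralIdeal 𝔫) (N : ℕ) where
    open RayClasses 𝔫 𝔫-ideal using (𝓘)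

    -- Q ∼_𝔫 Q′, meaningful before the lattices are known to lie in I_K(𝔫).
    _~_ : 𝒬 N dK → 𝒬 N dK → Set
    Q ~ Q′ = SameRayClass 𝔫 [ ω Q , 1# ] [ ω Q′ , 1# ]

    -- Every lattice [ω_Q, 1] belongs to I_K(𝔫), so that φ takes values there.
    LatticesIn𝓘 : Set₁
    LatticesIn𝓘 = (Q : 𝒬 N dK) → IsFractionalIdeal [ ω Q , 1# ] × [ ω Q , 1# ] PrimeTo 𝔫

    φ : LatticesIn𝓘 → 𝒬 N dK → 𝓘
    φ in𝓘 Q = record { ideal = [ ω Q , 1# ] ; fractional = proj₁ (in𝓘 Q) ; primeTo = proj₂ (in𝓘 Q) }

    rawGroup : Op₂ (𝒬 N dK) → 𝒬 N dK → Op₁ (𝒬 N dK) → RawGroup 0ℓ 0ℓ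
    rawGroup _∙_ ε _⁻¹ = record { _≈_ = _~_ ; _∙_ = _∙_ ; ε = ε ; _⁻¹ = _⁻¹ }

{-# OPTIONS --safe #-}

-- Injectivity holds because ∼_𝔫 is equality of ray classes, so everything rests on finding a
-- form in a given class. Replace the ideal by an integral representative J containing some
-- e ≡ 1 (mod 𝔫). As 𝒪/N is finite, every u ∈ 𝒪 has a power that is idempotent modulo N, and
-- gluing along such idempotents yields ν ∈ J with ν ≡ 1 (mod 𝔫) and J = ν𝒪 + NJ. Moving ν by an
-- element of NJ makes it part of a ℤ-basis ν, μ of J. With 𝒪 = ℤ + ℤτ, write τν = uν + aμ, a > 0:
-- then J = ν[ω, 1], where aω = τ − u, the form with root ω has leading coefficient a, and
-- J = ν𝒪 + NJ forces a to be prime to N.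

module Submission where

open import Defs
open import Algebra.Bundles using (AbelianGroup; CommutativeRing)
open import Algebra.Core using (Op₁; Op₂)
import Algebra.Morphism.GroupMonomorphism as GroupMonomorphism
open import Algebra.Morphism.Structures using (module GroupMorphisms)
import Algebra.Solver.Ring as RingSolver
open import Algebra.Solver.Ring.AlmostCommutativeRing using (fromCommutativeRing; _-Raw-AlmostCommutative⟶_)
open import Algebra.Structures using (IsGroup)
open import Data.Empty using (⊥-elim)
open import Data.Fin.Base as Fin using (Fin)
import Data.Fin.Properties as Fin
open import Data.Integer.Base as ℤ using (ℤ; 0ℤ; 1ℤ; +_; -[1+_])
import Data.Integer.Divisibility.Signed as ℤ∣
import Data.Integer.DivMod as ℤ
import Data.Integer.GCD as ℤ
import Data.Integer.Properties as ℤ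
open import Data.List.Base using (List; []; _∷_; map; _++_)
open import Data.List.Membership.Propositional using () renaming (_∈_ to _∈ˡ_)
open import Data.List.Relation.Unary.All as All using (All; []; _∷_)
import Data.List.Relation.Unary.All.Properties as All
open import Data.List.Relation.Unary.Any using (here; there)
open import Data.Maybe.Base using (Maybe; just; nothing)
open import Data.Nat.Base as ℕ using (ℕ; zero; suc)
open import Data.Nat.Coprimality as Coprimality using (Coprime; coprime-divisor; recompute)
import Data.Nat.Divisibility as ℕ
import Data.Nat.Properties as ℕ
open import Data.Product.Base using (Σ-syntax; ∃-syntax; _×_; _,_; proj₁; proj₂)
open import Data.Rational.Base as ℚ using (ℚ; mkℚ; 0ℚ; 1ℚ; ½)
open import Data.Rational.Literals using (fromℤ)
import Data.Rational.Properties as ℚ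
open import Data.Sum.Base using (_⊎_; inj₁; inj₂; [_,_]′)
open import Function.Definitions using (Congruent; Bijective; Surjective)
open import Level using (0ℓ)
open import Relation.Binary.PropositionalEquality
  using (_≡_; _≢_; refl; sym; trans; cong; cong₂; subst; subst₂; module ≡-Reasoning)
open import Relation.Nullary using (¬_; Dec; yes; no)
open import Relation.Unary using (Pred; _∈_; _⊆_; _≐_)

-- Classically ν comes from the Chinese remainder theorem over the primes dividing N. Here ideals
-- are predicates, with neither decidable membership nor a prime factorization given, so the
-- splitting is read off the finite ring 𝒪/N: if xy + gh equals 1 up to an error, a power f of xy
-- that is idempotent modulo N is a multiple of xy, and 1 - f is a multiple of 1 - xy; then x serves
-- as local generator on the part f and g on the part 1 - f. Longer sums of products reduce to this
-- by moving one product at a time into the modulus. The condition J = ν𝒪 + NJ is carried as an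
-- equation 1 - νh = wN with h in J⁻¹. Its form survives changing ν by NJ, and coprimality is read
-- off from it by comparing coordinates in a ℤ-basis of J. Such a ν may be a proper multiple of a
-- vector of J, hence the move by NJ, which is harmless modulo 𝔫 because N lies in 𝔫. The number a
-- is the index of ν𝒪 = [ν, aμ] in J, which is why J = ν𝒪 + NJ makes it prime to N.

-- Integer arithmetic: parity, Bézout relations, discriminants and definiteness

parity : ∀ z → ∃[ k ] (z ≡ + 2 ℤ.* k ⊎ z ≡ + 2 ℤ.* k ℤ.+ 1ℤ)
parity z with z ℤ.%ℕ 2 | ℤ.n%ℕd<d z 2 | ℤ.a≡a%ℕn+[a/ℕn]*n z 2
... | 0 | _ | eq = z ℤ./ℕ 2 , inj₁ (trans eq
  (ℤS.solve 1 (λ k → ℤS.con 0ℤ ℤS.:+ k ℤS.:* ℤS.con (+ 2) ℤS.:= ℤS.con (+ 2) ℤS.:* k) refl (z ℤ./ℕ 2)))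
... | 1 | _ | eq = z ℤ./ℕ 2 , inj₂ (trans eq
  (ℤS.solve 1 (λ k → ℤS.con 1ℤ ℤS.:+ k ℤS.:* ℤS.con (+ 2) ℤS.:= ℤS.con (+ 2) ℤS.:* k ℤS.:+ ℤS.con 1ℤ) refl (z ℤ./ℕ 2)))
... | suc (suc _) | ℕ.s≤s (ℕ.s≤s ()) | _

multiple-small : ∀ d {w} z → w ≡ + d ℤ.* z → ℤ.∣ w ∣ ℕ.< d → w ≡ 0ℤ
multiple-small d {w} z eq w<d with ℤ.∣ w ∣ in abs
... | zero  = ℤ.∣i∣≡0⇒i≡0 abs
... | suc n = ⊥-elim (ℕ.<-irrefl refl (ℕ.<-≤-trans w<d (ℕ.∣⇒≤
  (ℕ.divides ℤ.∣ z ∣ (trans (sym abs) (trans (cong ℤ.∣_∣ eq) (trans (ℤ.abs-* (+ d) z) (ℕ.*-comm d ℤ.∣ z ∣))))))))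

odd≢even : ∀ j k → ¬ (+ 2 ℤ.* j ℤ.+ 1ℤ ≡ + 2 ℤ.* k)
odd≢even j k eq with multiple-small 2 {1ℤ} (k ℤ.- j)
  (trans (ℤS.solve 1 (λ j → ℤS.con 1ℤ ℤS.:= (ℤS.con (+ 2) ℤS.:* j ℤS.:+ ℤS.con 1ℤ) ℤS.:- ℤS.con (+ 2) ℤS.:* j) refl j)
  (trans (cong (ℤ._- + 2 ℤ.* j) eq)
    (ℤS.solve 2 (λ j k → ℤS.con (+ 2) ℤS.:* k ℤS.:- ℤS.con (+ 2) ℤS.:* j ℤS.:= ℤS.con (+ 2) ℤS.:* (k ℤS.:- j)) refl j k)))
  (ℕ.s≤s (ℕ.s≤s ℕ.z≤n))
... | ()

-- The factors x and x + 2y have the same parity, so an odd x would make the product odd.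
even-factor : ∀ x y z → x ℤ.* (x ℤ.+ + 2 ℤ.* y) ≡ + 2 ℤ.* z → ∃[ k ] x ≡ + 2 ℤ.* k
even-factor x y z eq with parity x
... | k , inj₁ x≡2k = k , x≡2k
... | k , inj₂ refl = ⊥-elim (odd≢even (+ 2 ℤ.* k ℤ.* k ℤ.+ + 2 ℤ.* k ℤ.+ (+ 2 ℤ.* k ℤ.+ 1ℤ) ℤ.* y) z (trans
  (ℤS.solve 2 (λ k y → ℤS.con (+ 2) ℤS.:* (ℤS.con (+ 2) ℤS.:* k ℤS.:* k ℤS.:+ ℤS.con (+ 2) ℤS.:* k
      ℤS.:+ (ℤS.con (+ 2) ℤS.:* k ℤS.:+ ℤS.con 1ℤ) ℤS.:* y) ℤS.:+ ℤS.con 1ℤ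
    ℤS.:= (ℤS.con (+ 2) ℤS.:* k ℤS.:+ ℤS.con 1ℤ) ℤS.:* (ℤS.con (+ 2) ℤS.:* k ℤS.:+ ℤS.con 1ℤ ℤS.:+ ℤS.con (+ 2) ℤS.:* y)) refl k y)
  eq))

-- Here T/2 + (S/2)√m has integral trace T and norm n, and r, s are its coordinates in the basis 1,
-- (d + f√m)/2 with d = f²m. If m = 4k + 1, then T - Sm is even because (T - Sm)(T + Sm) = 4n -
-- 4kmS². Otherwise S and T must both be even: T odd with S even makes T² - mS² odd, S odd with T
-- even gives 4 | m, and both odd give m ≡ 1 (mod 4).
coordinates : ∀ f m → (f ≡ 1ℤ × ∃[ k ] m ≡ + 4 ℤ.* k ℤ.+ 1ℤ) ⊎ (f ≡ + 2 × ∀ k → m ≢ + 4 ℤ.* k ℤ.+ 1ℤ) →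
              (∀ z → m ≢ + 4 ℤ.* z) → ∀ T S n → T ℤ.* T ℤ.- m ℤ.* (S ℤ.* S) ≡ + 4 ℤ.* n →
              ∃[ r ] ∃[ s ] + 2 ℤ.* r ℤ.+ s ℤ.* (f ℤ.* f ℤ.* m) ≡ T × s ℤ.* f ≡ S
coordinates f m (inj₁ (f≡1 , k , m≡4k+1)) m≢4z T S n eq = proj₁ even , S
    , trans (cong (λ d → + 2 ℤ.* proj₁ even ℤ.+ S ℤ.* d) dK≡) (trans (cong (ℤ._+ S ℤ.* (+ 4 ℤ.* k ℤ.+ 1ℤ)) (sym (proj₂ even)))
        (ℤS.solve 2 (λ a b → (a ℤS.:- b) ℤS.:+ b ℤS.:= a) refl T (S ℤ.* (+ 4 ℤ.* k ℤ.+ 1ℤ))))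
    , trans (cong (S ℤ.*_) f≡1) (ℤ.*-identityʳ S)
  where
  dK≡ : f ℤ.* f ℤ.* m ≡ + 4 ℤ.* k ℤ.+ 1ℤ
  dK≡ = trans (cong₂ (λ f m → f ℤ.* f ℤ.* m) f≡1 m≡4k+1) (ℤ.*-identityˡ _)
  even : ∃[ r ] T ℤ.- S ℤ.* (+ 4 ℤ.* k ℤ.+ 1ℤ) ≡ + 2 ℤ.* r
  even = even-factor (T ℤ.- S ℤ.* (+ 4 ℤ.* k ℤ.+ 1ℤ)) (S ℤ.* (+ 4 ℤ.* k ℤ.+ 1ℤ))
    (+ 2 ℤ.* n ℤ.- + 2 ℤ.* k ℤ.* (+ 4 ℤ.* k ℤ.+ 1ℤ) ℤ.* (S ℤ.* S))
    (trans (ℤS.solve 3 (λ T S k → let m = ℤS.con (+ 4) ℤS.:* k ℤS.:+ ℤS.con 1ℤ in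
        (T ℤS.:- S ℤS.:* m) ℤS.:* ((T ℤS.:- S ℤS.:* m) ℤS.:+ ℤS.con (+ 2) ℤS.:* (S ℤS.:* m))
        ℤS.:= (T ℤS.:* T ℤS.:- m ℤS.:* (S ℤS.:* S)) ℤS.:- ℤS.con (+ 2) ℤS.:* (ℤS.con (+ 2) ℤS.:* k ℤS.:* m ℤS.:* (S ℤS.:* S))) refl T S k)
    (trans (cong (ℤ._- + 2 ℤ.* (+ 2 ℤ.* k ℤ.* (+ 4 ℤ.* k ℤ.+ 1ℤ) ℤ.* (S ℤ.* S)))
        (trans (cong (λ m → T ℤ.* T ℤ.- m ℤ.* (S ℤ.* S)) (sym m≡4k+1)) eq))
      (ℤS.solve 2 (λ n e → ℤS.con (+ 4) ℤS.:* n ℤS.:- ℤS.con (+ 2) ℤS.:* e ℤS.:= ℤS.con (+ 2) ℤS.:* (ℤS.con (+ 2) ℤS.:* n ℤS.:- e)) refl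
        n (+ 2 ℤ.* k ℤ.* (+ 4 ℤ.* k ℤ.+ 1ℤ) ℤ.* (S ℤ.* S)))))
coordinates f m (inj₂ (f≡2 , m≢4k+1)) m≢4z T S n eq with parity S | parity T
... | s , inj₁ refl | t , inj₁ refl = t ℤ.- + 2 ℤ.* s ℤ.* m , s
      , trans (cong (λ f → + 2 ℤ.* (t ℤ.- + 2 ℤ.* s ℤ.* m) ℤ.+ s ℤ.* (f ℤ.* f ℤ.* m)) f≡2)
          (ℤS.solve 3 (λ t s m → ℤS.con (+ 2) ℤS.:* (t ℤS.:- ℤS.con (+ 2) ℤS.:* s ℤS.:* m) ℤS.:+ s ℤS.:* (ℤS.con (+ 2) ℤS.:* ℤS.con (+ 2) ℤS.:* m) ℤS.:= ℤS.con (+ 2) ℤS.:* t) refl t s m)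
      , trans (cong (s ℤ.*_) f≡2) (ℤ.*-comm s (+ 2))
... | s , inj₁ refl | t , inj₂ refl = ⊥-elim (odd≢even (+ 2 ℤ.* (t ℤ.* t) ℤ.+ + 2 ℤ.* t ℤ.- + 2 ℤ.* (m ℤ.* (s ℤ.* s))) (+ 2 ℤ.* n)
        (trans (ℤS.solve 3 (λ t s m → let T = ℤS.con (+ 2) ℤS.:* t ℤS.:+ ℤS.con 1ℤ ; S = ℤS.con (+ 2) ℤS.:* s in
            ℤS.con (+ 2) ℤS.:* (ℤS.con (+ 2) ℤS.:* (t ℤS.:* t) ℤS.:+ ℤS.con (+ 2) ℤS.:* t ℤS.:- ℤS.con (+ 2) ℤS.:* (m ℤS.:* (s ℤS.:* s))) ℤS.:+ ℤS.con 1ℤ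
            ℤS.:= T ℤS.:* T ℤS.:- m ℤS.:* (S ℤS.:* S)) refl t s m)
        (trans eq (ℤS.solve 1 (λ n → ℤS.con (+ 4) ℤS.:* n ℤS.:= ℤS.con (+ 2) ℤS.:* (ℤS.con (+ 2) ℤS.:* n)) refl n))))
... | s , inj₂ refl | t , inj₁ refl = ⊥-elim (m≢4z z m≡4z)
  where
  z = t ℤ.* t ℤ.- n ℤ.- m ℤ.* (s ℤ.* s ℤ.+ s)
  m≡4z : m ≡ + 4 ℤ.* z
  m≡4z = trans (ℤS.solve 3 (λ t s m → let T = ℤS.con (+ 2) ℤS.:* t ; S = ℤS.con (+ 2) ℤS.:* s ℤS.:+ ℤS.con 1ℤ in
      m ℤS.:= ℤS.con (+ 4) ℤS.:* (t ℤS.:* t ℤS.:- m ℤS.:* (s ℤS.:* s ℤS.:+ s)) ℤS.:- (T ℤS.:* T ℤS.:- m ℤS.:* (S ℤS.:* S))) refl t s m)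
    (trans (cong (λ e → + 4 ℤ.* (t ℤ.* t ℤ.- m ℤ.* (s ℤ.* s ℤ.+ s)) ℤ.- e) eq)
      (ℤS.solve 3 (λ a b n → ℤS.con (+ 4) ℤS.:* (a ℤS.:- b) ℤS.:- ℤS.con (+ 4) ℤS.:* n ℤS.:= ℤS.con (+ 4) ℤS.:* (a ℤS.:- n ℤS.:- b)) refl (t ℤ.* t) (m ℤ.* (s ℤ.* s ℤ.+ s)) n))
... | s , inj₂ refl | t , inj₂ refl = ⊥-elim (m≢4k+1 z m≡4z+1)
  where
  z = t ℤ.* t ℤ.+ t ℤ.- n ℤ.- m ℤ.* (s ℤ.* s ℤ.+ s)
  m≡4z+1 : m ≡ + 4 ℤ.* z ℤ.+ 1ℤ
  m≡4z+1 = trans (ℤS.solve 3 (λ t s m → let T = ℤS.con (+ 2) ℤS.:* t ℤS.:+ ℤS.con 1ℤ ; S = ℤS.con (+ 2) ℤS.:* s ℤS.:+ ℤS.con 1ℤ in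
      m ℤS.:= ℤS.con (+ 4) ℤS.:* (t ℤS.:* t ℤS.:+ t ℤS.:- m ℤS.:* (s ℤS.:* s ℤS.:+ s)) ℤS.:+ ℤS.con 1ℤ ℤS.:- (T ℤS.:* T ℤS.:- m ℤS.:* (S ℤS.:* S))) refl t s m)
    (trans (cong (λ e → + 4 ℤ.* (t ℤ.* t ℤ.+ t ℤ.- m ℤ.* (s ℤ.* s ℤ.+ s)) ℤ.+ 1ℤ ℤ.- e) eq)
      (ℤS.solve 3 (λ a b n → ℤS.con (+ 4) ℤS.:* (a ℤS.:- b) ℤS.:+ ℤS.con 1ℤ ℤS.:- ℤS.con (+ 4) ℤS.:* n ℤS.:= ℤS.con (+ 4) ℤS.:* (a ℤS.:- n ℤS.:- b) ℤS.:+ ℤS.con 1ℤ) refl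
        (t ℤ.* t ℤ.+ t) (m ℤ.* (s ℤ.* s ℤ.+ s)) n))

bezout : ∀ x y → ∃[ k ] ∃[ u ] ∃[ v ] ∃[ X ] ∃[ Y ] x ≡ u ℤ.* k × y ≡ v ℤ.* k × u ℤ.* X ℤ.+ v ℤ.* Y ≡ 1ℤ
bezout x y = build (C.g ℤ.≟ 0ℤ)
  where
  module C = CommonDivisor (commonDivisor x y)
  build : Dec (C.g ≡ 0ℤ) → ∃[ k ] ∃[ u ] ∃[ v ] ∃[ X ] ∃[ Y ] x ≡ u ℤ.* k × y ≡ v ℤ.* k × u ℤ.* X ℤ.+ v ℤ.* Y ≡ 1ℤ
  -- Here x = y = 0 and the cofactors of the gcd say nothing; (1, 0) is chosen to keep the pair (u,
  -- v) primitive.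
  build (yes g≡0) = 0ℤ , 1ℤ , 0ℤ , 1ℤ , 0ℤ
    , trans C.a≡ (trans (cong (C.u ℤ.*_) g≡0) (ℤ.*-zeroʳ C.u)) , trans C.b≡ (trans (cong (C.v ℤ.*_) g≡0) (ℤ.*-zeroʳ C.v)) , refl
  build (no g≢0) = C.g , C.u , C.v , C.x , C.y , C.a≡ , C.b≡ ,
    ℤ.*-cancelʳ-≡ (C.u ℤ.* C.x ℤ.+ C.v ℤ.* C.y) 1ℤ C.g ⦃ ℤ.≢-nonZero g≢0 ⦄ (begin
      (C.u ℤ.* C.x ℤ.+ C.v ℤ.* C.y) ℤ.* C.g
        ≡⟨ ℤS.solve 5 (λ u v x y g → (u ℤS.:* x ℤS.:+ v ℤS.:* y) ℤS.:* g ℤS.:= x ℤS.:* (u ℤS.:* g) ℤS.:+ y ℤS.:* (v ℤS.:* g)) refl C.u C.v C.x C.y C.g ⟩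
      C.x ℤ.* (C.u ℤ.* C.g) ℤ.+ C.y ℤ.* (C.v ℤ.* C.g)
        ≡⟨ cong₂ (λ a b → C.x ℤ.* a ℤ.+ C.y ℤ.* b) (sym C.a≡) (sym C.b≡) ⟩
      C.x ℤ.* x ℤ.+ C.y ℤ.* y
        ≡⟨ sym C.g≡ ⟩
      C.g
        ≡⟨ sym (ℤ.*-identityˡ C.g) ⟩
      1ℤ ℤ.* C.g ∎)
    where open ≡-Reasoning

gcd≡1⇒bezout : ∀ a b → ℤ.gcd a b ≡ 1ℤ → ∃[ x ] ∃[ y ] x ℤ.* a ℤ.+ y ℤ.* b ≡ 1ℤ
gcd≡1⇒bezout a b gcd≡1 = s ℤ.* C.x , s ℤ.* C.y , (begin
  s ℤ.* C.x ℤ.* a ℤ.+ s ℤ.* C.y ℤ.* b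
    ≡⟨ ℤS.solve 5 (λ s x y a b → s ℤS.:* x ℤS.:* a ℤS.:+ s ℤS.:* y ℤS.:* b ℤS.:= s ℤS.:* (x ℤS.:* a ℤS.:+ y ℤS.:* b)) refl s C.x C.y a b ⟩
  s ℤ.* (C.x ℤ.* a ℤ.+ C.y ℤ.* b)      ≡⟨ cong (s ℤ.*_) (sym C.g≡) ⟩
  s ℤ.* C.g                            ≡⟨ sym (proj₁ (proj₂ (sign C.g))) ⟩
  + ℤ.∣ C.g ∣                          ≡⟨ cong +_ ∣g∣≡1 ⟩
  1ℤ                                   ∎)
  where
  open ≡-Reasoning
  module C = CommonDivisor (commonDivisor a b)
  -- The common divisor is determined only up to sign; s turns it into its absolute value.
  s = proj₁ (sign C.g)
  ∣g∣≡1 : ℤ.∣ C.g ∣ ≡ 1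
  ∣g∣≡1 = ℕ.∣1⇒≡1 (subst (ℤ.∣ C.g ∣ ℕ.∣_) (cong ℤ.∣_∣ gcd≡1)
    (ℤ.gcd-greatest {a} {b} {C.g} (ℤ∣.∣⇒∣ᵤ (ℤ∣.divides C.u C.a≡)) (ℤ∣.∣⇒∣ᵤ (ℤ∣.divides C.v C.b≡))))

bezout⇒gcd≡1 : ∀ a b x y → x ℤ.* a ℤ.+ y ℤ.* b ≡ 1ℤ → ℤ.gcd a b ≡ 1ℤ
bezout⇒gcd≡1 a b x y eq = cong +_ (ℕ.∣1⇒≡1 (ℤ∣.∣⇒∣ᵤ (subst (ℤ.gcd a b ℤ∣.∣_) eq
  (ℤ∣.∣m∣n⇒∣m+n (ℤ∣.∣n⇒∣m*n x (ℤ∣.∣ᵤ⇒∣ (ℤ.gcd[i,j]∣i a b))) (ℤ∣.∣n⇒∣m*n y (ℤ∣.∣ᵤ⇒∣ (ℤ.gcd[i,j]∣j a b)))))))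

-- With τ = (D + √D)/2, of trace D and norm n, the number aω = (-b + √D)/2 is τ - u, and ac is its
-- norm u² - uD + n. The parity of b + D comes from (b + D)(b - D) = 4ac - 4n.
half-trace : ∀ {D n} a b c → b ℤ.* b ℤ.- + 4 ℤ.* a ℤ.* c ≡ D → + 4 ℤ.* n ≡ D ℤ.* D ℤ.- D →
  ∃[ u ] b ℤ.+ D ≡ + 2 ℤ.* u × a ℤ.* c ≡ u ℤ.* u ℤ.- u ℤ.* D ℤ.+ n
half-trace {D} {n} a b c disc≡ 4n≡ = u , b+D≡2u , ℤ.*-cancelˡ-≡ (+ 4) (a ℤ.* c) (u ℤ.* u ℤ.- u ℤ.* D ℤ.+ n) (begin
  + 4 ℤ.* (a ℤ.* c)
    ≡⟨ ℤS.solve 4 (λ a b c D → ℤS.con (+ 4) ℤS.:* (a ℤS.:* c) ℤS.:= (b ℤS.:+ D) ℤS.:* (b ℤS.:+ D) ℤS.:- ℤS.con (+ 2) ℤS.:* (b ℤS.:+ D) ℤS.:* D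
         ℤS.:+ D ℤS.:* D ℤS.:- (b ℤS.:* b ℤS.:- ℤS.con (+ 4) ℤS.:* a ℤS.:* c)) refl a b c D ⟩
  (b ℤ.+ D) ℤ.* (b ℤ.+ D) ℤ.- + 2 ℤ.* (b ℤ.+ D) ℤ.* D ℤ.+ D ℤ.* D ℤ.- (b ℤ.* b ℤ.- + 4 ℤ.* a ℤ.* c)
    ≡⟨ cong₂ (λ s t → s ℤ.* s ℤ.- + 2 ℤ.* s ℤ.* D ℤ.+ D ℤ.* D ℤ.- t) b+D≡2u disc≡ ⟩
  (+ 2 ℤ.* u) ℤ.* (+ 2 ℤ.* u) ℤ.- + 2 ℤ.* (+ 2 ℤ.* u) ℤ.* D ℤ.+ D ℤ.* D ℤ.- D
    ≡⟨ ℤS.solve 2 (λ u D → (ℤS.con (+ 2) ℤS.:* u) ℤS.:* (ℤS.con (+ 2) ℤS.:* u) ℤS.:- ℤS.con (+ 2) ℤS.:* (ℤS.con (+ 2) ℤS.:* u) ℤS.:* D ℤS.:+ D ℤS.:* D ℤS.:- D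
         ℤS.:= ℤS.con (+ 4) ℤS.:* (u ℤS.:* u ℤS.:- u ℤS.:* D) ℤS.:+ (D ℤS.:* D ℤS.:- D)) refl u D ⟩
  + 4 ℤ.* (u ℤ.* u ℤ.- u ℤ.* D) ℤ.+ (D ℤ.* D ℤ.- D)
    ≡⟨ cong (λ t → + 4 ℤ.* (u ℤ.* u ℤ.- u ℤ.* D) ℤ.+ t) (sym 4n≡) ⟩
  + 4 ℤ.* (u ℤ.* u ℤ.- u ℤ.* D) ℤ.+ + 4 ℤ.* n
    ≡⟨ sym (ℤ.*-distribˡ-+ (+ 4) (u ℤ.* u ℤ.- u ℤ.* D) n) ⟩
  + 4 ℤ.* (u ℤ.* u ℤ.- u ℤ.* D ℤ.+ n) ∎)
  where
  open ≡-Reasoning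
  even : ∃[ u ] b ℤ.+ D ≡ + 2 ℤ.* u
  even = even-factor (b ℤ.+ D) (ℤ.- D) (+ 2 ℤ.* (a ℤ.* c) ℤ.- + 2 ℤ.* n) (begin
    (b ℤ.+ D) ℤ.* (b ℤ.+ D ℤ.+ + 2 ℤ.* (ℤ.- D))
      ≡⟨ ℤS.solve 4 (λ a b c D → (b ℤS.:+ D) ℤS.:* (b ℤS.:+ D ℤS.:+ ℤS.con (+ 2) ℤS.:* (ℤS.:- D))
           ℤS.:= (b ℤS.:* b ℤS.:- ℤS.con (+ 4) ℤS.:* a ℤS.:* c) ℤS.:+ ℤS.con (+ 4) ℤS.:* (a ℤS.:* c) ℤS.:- D ℤS.:* D) refl a b c D ⟩
    (b ℤ.* b ℤ.- + 4 ℤ.* a ℤ.* c) ℤ.+ + 4 ℤ.* (a ℤ.* c) ℤ.- D ℤ.* D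
      ≡⟨ cong (λ t → t ℤ.+ + 4 ℤ.* (a ℤ.* c) ℤ.- D ℤ.* D) disc≡ ⟩
    D ℤ.+ + 4 ℤ.* (a ℤ.* c) ℤ.- D ℤ.* D
      ≡⟨ ℤS.solve 2 (λ e D → D ℤS.:+ e ℤS.:- D ℤS.:* D ℤS.:= e ℤS.:- (D ℤS.:* D ℤS.:- D)) refl (+ 4 ℤ.* (a ℤ.* c)) D ⟩
    + 4 ℤ.* (a ℤ.* c) ℤ.- (D ℤ.* D ℤ.- D)
      ≡⟨ cong (λ t → + 4 ℤ.* (a ℤ.* c) ℤ.- t) (sym 4n≡) ⟩
    + 4 ℤ.* (a ℤ.* c) ℤ.- + 4 ℤ.* n
      ≡⟨ ℤS.solve 2 (λ e n → ℤS.con (+ 4) ℤS.:* e ℤS.:- ℤS.con (+ 4) ℤS.:* n ℤS.:= ℤS.con (+ 2) ℤS.:* (ℤS.con (+ 2) ℤS.:* e ℤS.:- ℤS.con (+ 2) ℤS.:* n)) refl (a ℤ.* c) n ⟩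
    + 2 ℤ.* (+ 2 ℤ.* (a ℤ.* c) ℤ.- + 2 ℤ.* n) ∎)
  u = proj₁ even
  b+D≡2u = proj₂ even

square-positive : ∀ i → i ≢ 0ℤ → ∃[ k ] i ℤ.* i ≡ + suc k
square-positive (+ zero)  i≢0 = ⊥-elim (i≢0 refl)
square-positive (+ suc n) _   = _ , refl
square-positive -[1+ n ]  _   = _ , refl

square-nonnegative : ∀ i → ∃[ k ] i ℤ.* i ≡ + k
square-nonnegative (+ n)    = n ℕ.* n , sym (ℤ.pos-* n n)
square-nonnegative -[1+ n ] = _ , refl

-- Completing the square gives 4a·value = (2ax + by)² - Dy² with a > 0 and D < 0, so the last term
-- is already positive when y ≠ 0; when y = 0 the value is ax².
form-positive : ∀ n e b c x y → b ℤ.* b ℤ.- + 4 ℤ.* + suc n ℤ.* c ≡ -[1+ e ] → ¬ (x ≡ 0ℤ × y ≡ 0ℤ) →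
  0ℤ ℤ.< + suc n ℤ.* (x ℤ.* x) ℤ.+ b ℤ.* (x ℤ.* y) ℤ.+ c ℤ.* (y ℤ.* y)
form-positive n e b c x y disc≡ nonzero = decide (y ℤ.≟ 0ℤ)
  where
  open ≡-Reasoning
  a = + suc n
  v = a ℤ.* (x ℤ.* x) ℤ.+ b ℤ.* (x ℤ.* y) ℤ.+ c ℤ.* (y ℤ.* y)
  decide : Dec (y ≡ 0ℤ) → 0ℤ ℤ.< v
  decide (yes y≡0) = subst (0ℤ ℤ.<_) (sym v≡) (ℤ.+<+ (ℕ.s≤s ℕ.z≤n))
    where
    pos = square-positive x (λ x≡0 → nonzero (x≡0 , y≡0))
    v≡ : v ≡ + suc n ℤ.* + suc (proj₁ pos)
    v≡ = trans (cong (λ y → a ℤ.* (x ℤ.* x) ℤ.+ b ℤ.* (x ℤ.* y) ℤ.+ c ℤ.* (y ℤ.* y)) y≡0)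
      (trans (ℤS.solve 4 (λ a b c x → a ℤS.:* (x ℤS.:* x) ℤS.:+ b ℤS.:* (x ℤS.:* ℤS.con 0ℤ) ℤS.:+ c ℤS.:* (ℤS.con 0ℤ ℤS.:* ℤS.con 0ℤ) ℤS.:= a ℤS.:* (x ℤS.:* x)) refl a b c x)
        (cong (a ℤ.*_) (proj₂ pos)))
  decide (no y≢0) = ℤ.*-cancelˡ-<-nonNeg (+ 4 ℤ.* a) (subst₂ ℤ._<_ (sym (ℤ.*-zeroʳ (+ 4 ℤ.* a))) (sym 4av≡)
      (ℤ.+<+ (ℕ.≤-trans (ℕ.s≤s ℕ.z≤n) (ℕ.m≤n+m (suc (proj₁ pos) ℕ.+ e ℕ.* suc (proj₁ pos)) (proj₁ nonneg)))))
    where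
    P = + 2 ℤ.* a ℤ.* x ℤ.+ b ℤ.* y
    pos = square-positive y y≢0
    nonneg = square-nonnegative P
    4av≡ : + 4 ℤ.* a ℤ.* v ≡ + (proj₁ nonneg ℕ.+ suc e ℕ.* suc (proj₁ pos))
    4av≡ = begin
      + 4 ℤ.* a ℤ.* v
        ≡⟨ ℤS.solve 5 (λ a b c x y → ℤS.con (+ 4) ℤS.:* a ℤS.:* (a ℤS.:* (x ℤS.:* x) ℤS.:+ b ℤS.:* (x ℤS.:* y) ℤS.:+ c ℤS.:* (y ℤS.:* y))
             ℤS.:= (ℤS.con (+ 2) ℤS.:* a ℤS.:* x ℤS.:+ b ℤS.:* y) ℤS.:* (ℤS.con (+ 2) ℤS.:* a ℤS.:* x ℤS.:+ b ℤS.:* y)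
             ℤS.:- (b ℤS.:* b ℤS.:- ℤS.con (+ 4) ℤS.:* a ℤS.:* c) ℤS.:* (y ℤS.:* y)) refl a b c x y ⟩
      P ℤ.* P ℤ.- (b ℤ.* b ℤ.- + 4 ℤ.* a ℤ.* c) ℤ.* (y ℤ.* y)
        ≡⟨ cong₂ (λ s t → P ℤ.* P ℤ.- s ℤ.* t) disc≡ (proj₂ pos) ⟩
      P ℤ.* P ℤ.- -[1+ e ] ℤ.* + suc (proj₁ pos)
        ≡⟨ ℤS.solve 3 (λ p e k → p ℤS.:- (ℤS.:- e) ℤS.:* k ℤS.:= p ℤS.:+ e ℤS.:* k) refl (P ℤ.* P) (+ suc e) (+ suc (proj₁ pos)) ⟩
      P ℤ.* P ℤ.+ + suc e ℤ.* + suc (proj₁ pos)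
        ≡⟨ cong₂ ℤ._+_ (proj₂ nonneg) (sym (ℤ.pos-* (suc e) (suc (proj₁ pos)))) ⟩
      + (proj₁ nonneg ℕ.+ suc e ℕ.* suc (proj₁ pos)) ∎

gcd₃-divides : ∀ a b c → let g = ℤ.gcd (ℤ.gcd a b) c in
  (∃[ z ] a ≡ z ℤ.* g) × (∃[ z ] b ≡ z ℤ.* g) × (∃[ z ] c ≡ z ℤ.* g)
gcd₃-divides a b c = quotient a (ℤ∣.∣-trans d∣gcd (ℤ∣.∣ᵤ⇒∣ {ℤ.gcd a b} {a} (ℤ.gcd[i,j]∣i a b)))
                   , quotient b (ℤ∣.∣-trans d∣gcd (ℤ∣.∣ᵤ⇒∣ {ℤ.gcd a b} {b} (ℤ.gcd[i,j]∣j a b)))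
                   , quotient c (ℤ∣.∣ᵤ⇒∣ {g} {c} (ℤ.gcd[i,j]∣j (ℤ.gcd a b) c))
  where
  g = ℤ.gcd (ℤ.gcd a b) c
  d∣gcd : ℤ∣._∣_ g (ℤ.gcd a b)
  d∣gcd = ℤ∣.∣ᵤ⇒∣ {g} {ℤ.gcd a b} (ℤ.gcd[i,j]∣i (ℤ.gcd a b) c)
  quotient : ∀ z → ℤ∣._∣_ g z → ∃[ q ] z ≡ q ℤ.* g
  quotient z (ℤ∣.divides q eq) = q , eq

gcd₃-unit : ∀ a b c → let g = ℤ.gcd (ℤ.gcd a b) c in ∃[ s ] s ℤ.* g ≡ 1ℤ → g ≡ 1ℤ
gcd₃-unit a b c (s , sg≡1) = cong +_ (ℕ.∣1⇒≡1 (ℤ∣.∣⇒∣ᵤ {ℤ.gcd (ℤ.gcd a b) c} {1ℤ} (ℤ∣.divides s (sym sg≡1))))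

-- The ring of integers as ℤ + ℤτ

module QuadraticOrder (F : ImaginaryQuadraticField) where
  open ImaginaryQuadraticField F
  open QuadraticField F
  open CommutativeRing commutativeRing using
    ( *-comm; *-assoc; +-comm; zeroˡ; zeroʳ; distribˡ
    ; +-identityˡ; +-identityʳ; *-identityˡ; *-identityʳ; -‿inverseʳ)

  intK-neg : ∀ a → intK (ℤ.- a) ≡ - intK a
  intK-neg a = +√-cong (fromℤ-neg a) refl

  intK-≟ : ∀ a b → Maybe (intK a ≡ intK b)
  intK-≟ a b with a ℤ.≟ b
  ... | yes refl = just refl
  ... | no  _    = nothing

  -- Integers become the coefficients of the ring solver on K, so that identities with subtraction
  -- and with constants such as 2 and 4 are settled by arithmetic in ℤ.
  intK-homomorphism : ℤ.+-*-rawRing -Raw-AlmostCommutative⟶ fromCommutativeRing commutativeRing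
  intK-homomorphism = record
    { ⟦_⟧ = intK ; +-homo = intK-+ ; *-homo = intK-* ; -‿homo = intK-neg ; 0-homo = refl ; 1-homo = refl }

  module RS = RingSolver ℤ.+-*-rawRing (fromCommutativeRing commutativeRing) intK-homomorphism intK-≟
  open RS using (solve; _:=_; _:+_; _:*_; :-_; _:-_; con)

  x-y≡0⇒x≡y : ∀ {x y} → x - y ≡ 0# → x ≡ y
  x-y≡0⇒x≡y {x} {y} eq = trans (solve 2 (λ x y → x := (x :- y) :+ y) refl x y)
    (trans (cong (_+ y) eq) (+-identityˡ y))

  x≡y⇒x-y≡0 : ∀ {x y} → x ≡ y → x - y ≡ 0#
  x≡y⇒x-y≡0 {x} refl = -‿inverseʳ x

  intK-injective : ∀ {a b} → intK a ≡ intK b → a ≡ b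
  intK-injective eq = fromℤ-injective (cong K.re eq)

  intK≢0 : ∀ {a} → a ≢ 0ℤ → intK a ≢ 0#
  intK≢0 a≢0 eq = a≢0 (intK-injective eq)

  *-cancelˡ : ∀ c {x y} → c ≢ 0# → c * x ≡ c * y → x ≡ y
  *-cancelˡ c {x} {y} c≢0 eq = x-y≡0⇒x≡y (*-cancel c (x - y)
    (trans (solve 3 (λ c x y → c :* (x :- y) := c :* x :- c :* y) refl c x y) (x≡y⇒x-y≡0 eq)) c≢0)

  -- For q = n/d in lowest terms, d² divides mn² and is prime to n², hence divides the squarefree m,
  -- which forces d = 1.
  squarefree-denominator : ∀ q → IsInt (√m² ℚ.* (q ℚ.* q)) → IsInt q
  squarefree-denominator q@(mkℚ n d c) (z , eq) = integral d refl
    where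
    den = ℚ.denominator q
    numerators : m ℤ.* (n ℤ.* n) ≡ z ℤ.* (den ℤ.* den)
    numerators = fromℤ-injective (begin
      fromℤ (m ℤ.* (n ℤ.* n))                               ≡⟨ trans (fromℤ-* m (n ℤ.* n)) (cong (√m² ℚ.*_) (fromℤ-* n n)) ⟩
      √m² ℚ.* (fromℤ n ℚ.* fromℤ n)                         ≡⟨ cong (λ t → √m² ℚ.* (t ℚ.* t)) (sym (q*denominator q)) ⟩
      √m² ℚ.* (q ℚ.* fromℤ den ℚ.* (q ℚ.* fromℤ den))
        ≡⟨ ℚS.solve 3 (λ m q d → m ℚS.:* (q ℚS.:* d ℚS.:* (q ℚS.:* d)) ℚS.:= m ℚS.:* (q ℚS.:* q) ℚS.:* (d ℚS.:* d)) refl √m² q (fromℤ den) ⟩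
      √m² ℚ.* (q ℚ.* q) ℚ.* (fromℤ den ℚ.* fromℤ den)       ≡⟨ cong₂ ℚ._*_ eq (sym (fromℤ-* den den)) ⟩
      fromℤ z ℚ.* fromℤ (den ℤ.* den)                       ≡⟨ sym (fromℤ-* z (den ℤ.* den)) ⟩
      fromℤ (z ℤ.* (den ℤ.* den))                           ∎)
      where open ≡-Reasoning
    numeratorsℕ : ℤ.∣ n ∣ ℕ.* ℤ.∣ n ∣ ℕ.* ℤ.∣ m ∣ ≡ ℤ.∣ z ∣ ℕ.* (suc d ℕ.* suc d)
    numeratorsℕ = trans (ℕ.*-comm (ℤ.∣ n ∣ ℕ.* ℤ.∣ n ∣) ℤ.∣ m ∣)
      (trans (cong (ℤ.∣ m ∣ ℕ.*_) (sym (ℤ.abs-* n n)))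
      (trans (sym (ℤ.abs-* m (n ℤ.* n)))
      (trans (cong ℤ.∣_∣ numerators)
      (trans (ℤ.abs-* z (den ℤ.* den)) (cong (ℤ.∣ z ∣ ℕ.*_) (ℤ.abs-* den den))))))
    coprime : Coprime (suc d) ℤ.∣ n ∣
    coprime = Coprimality.sym (recompute c)
    coprime² : Coprime (suc d ℕ.* suc d) (ℤ.∣ n ∣ ℕ.* ℤ.∣ n ∣)
    coprime² = coprime-* {suc d} {suc d} cop cop
      where
      cop : Coprime (suc d) (ℤ.∣ n ∣ ℕ.* ℤ.∣ n ∣)
      cop = Coprimality.sym (coprime-* {ℤ.∣ n ∣} {ℤ.∣ n ∣} (Coprimality.sym coprime) (Coprimality.sym coprime))
    d≡0 : suc d ≡ 1
    d≡0 = squarefree (suc d) (coprime-divisor {o = ℤ.∣ m ∣} coprime² (ℕ.divides ℤ.∣ z ∣ numeratorsℕ))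
    integral : ∀ e → d ≡ e → IsInt q
    integral zero    refl = n , refl
    integral (suc e) refl = ⊥-elim (ℕ.1+n≢0 (ℕ.suc-injective d≡0))

  -- Turns the test on m modulo 4 that defines `conductor` into statements about m. In the second
  -- case, m = 4k + 1 would make r - 1 a multiple of 4 of absolute value below 4, where r is the
  -- remainder of m.
  conductor-cases : (conductor ≡ 1ℤ × ∃[ k ] m ≡ + 4 ℤ.* k ℤ.+ 1ℤ) ⊎ (conductor ≡ + 2 × ∀ k → m ≢ + 4 ℤ.* k ℤ.+ 1ℤ)
  conductor-cases with m ℤ.%ℕ 4 ℕ.≟ 1
  ... | yes r≡1 = inj₁ (refl , m ℤ./ℕ 4 , trans (ℤ.a≡a%ℕn+[a/ℕn]*n m 4) (trans (cong (λ r → + r ℤ.+ m ℤ./ℕ 4 ℤ.* + 4) r≡1)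
    (ℤS.solve 1 (λ k → ℤS.con 1ℤ ℤS.:+ k ℤS.:* ℤS.con (+ 4) ℤS.:= ℤS.con (+ 4) ℤS.:* k ℤS.:+ ℤS.con 1ℤ) refl (m ℤ./ℕ 4))))
  ... | no r≢1 = inj₂ (refl , λ k m≡4k+1 → r≢1 (ℤ.+-injective (ℤ.i-j≡0⇒i≡j (+ r) 1ℤ
      (multiple-small 4 (k ℤ.- m ℤ./ℕ 4)
        (trans (ℤS.solve 2 (λ r q → r ℤS.:- ℤS.con 1ℤ ℤS.:= (r ℤS.:+ q ℤS.:* ℤS.con (+ 4)) ℤS.:- (ℤS.con (+ 4) ℤS.:* q ℤS.:+ ℤS.con 1ℤ)) refl (+ r) (m ℤ./ℕ 4))
          (trans (cong (ℤ._- (+ 4 ℤ.* (m ℤ./ℕ 4) ℤ.+ 1ℤ)) (trans (sym (ℤ.a≡a%ℕn+[a/ℕn]*n m 4)) m≡4k+1))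
          (ℤS.solve 2 (λ k q → (ℤS.con (+ 4) ℤS.:* k ℤS.:+ ℤS.con 1ℤ) ℤS.:- (ℤS.con (+ 4) ℤS.:* q ℤS.:+ ℤS.con 1ℤ) ℤS.:= ℤS.con (+ 4) ℤS.:* (k ℤS.:- q)) refl k (m ℤ./ℕ 4))))
        (small r (ℤ.n%ℕd<d m 4))))))
    where
    r = m ℤ.%ℕ 4
    small : ∀ r → r ℕ.< 4 → ℤ.∣ + r ℤ.- 1ℤ ∣ ℕ.< 4
    small zero    _   = ℕ.s≤s (ℕ.s≤s ℕ.z≤n)
    small (suc r) r<4 = ℕ.≤-trans (ℕ.s≤s (ℕ.≤-reflexive (cong ℤ.∣_∣ (ℤ.m-n≡m⊖n (suc r) 1)))) (ℕ.≤-trans (ℕ.n≤1+n (suc r)) r<4)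

  intK-minus : ∀ a b → intK (a ℤ.- b) ≡ intK a - intK b
  intK-minus a b = trans (intK-+ a (ℤ.- b)) (cong (λ t → intK a + t) (intK-neg b))

  conductor≢0 : conductor ≢ 0ℤ
  conductor≢0 f≡0 with conductor-cases
  ... | inj₁ (f≡1 , _) with trans (sym f≡1) f≡0
  ...   | ()
  conductor≢0 f≡0 | inj₂ (f≡2 , _) with trans (sym f≡2) f≡0
  ...   | ()

  -- As dK is either 4k + 1 or 4m, the product dK(dK - 1) is divisible by 4. The quotient is the
  -- norm of τ.
  dK-norm : ∃[ n ] + 4 ℤ.* n ≡ dK ℤ.* dK ℤ.- dK
  dK-norm with conductor-cases
  ... | inj₁ (f≡1 , k , m≡4k+1) = k ℤ.* (+ 4 ℤ.* k ℤ.+ 1ℤ) , sym (trans (cong (λ d → d ℤ.* d ℤ.- d) (cong₂ (λ f m → f ℤ.* f ℤ.* m) f≡1 m≡4k+1))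
    (ℤS.solve 1 (λ k → let d = ℤS.con 1ℤ ℤS.:* ℤS.con 1ℤ ℤS.:* (ℤS.con (+ 4) ℤS.:* k ℤS.:+ ℤS.con 1ℤ) in
      d ℤS.:* d ℤS.:- d ℤS.:= ℤS.con (+ 4) ℤS.:* (k ℤS.:* (ℤS.con (+ 4) ℤS.:* k ℤS.:+ ℤS.con 1ℤ))) refl k))
  ... | inj₂ (f≡2 , _) = m ℤ.* (+ 4 ℤ.* m ℤ.- 1ℤ) , sym (trans (cong (λ f → f ℤ.* f ℤ.* m ℤ.* (f ℤ.* f ℤ.* m) ℤ.- f ℤ.* f ℤ.* m) f≡2)
    (ℤS.solve 1 (λ m → let d = ℤS.con (+ 2) ℤS.:* ℤS.con (+ 2) ℤS.:* m in
      d ℤS.:* d ℤS.:- d ℤS.:= ℤS.con (+ 4) ℤS.:* (m ℤS.:* (ℤS.con (+ 4) ℤS.:* m ℤS.:- ℤS.con 1ℤ))) refl m))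

  n₀ : ℤ
  n₀ = proj₁ dK-norm

  4n₀≡ : + 4 ℤ.* n₀ ≡ dK ℤ.* dK ℤ.- dK
  4n₀≡ = proj₂ dK-norm

  abstract
    -- The element (dK + √dK)/2 completes 1 to a ℤ-basis of 𝒪 for either value of `conductor`. It is
    -- kept abstract, so that all later reasoning goes through `2τ≡`.
    τ : K
    τ = (intK dK + √dK) * ratK ½

    2τ≡ : intK (+ 2) * τ ≡ intK dK + √dK
    2τ≡ = begin
      intK (+ 2) * ((intK dK + √dK) * ratK ½)   ≡⟨ solve 3 (λ t x h → t :* (x :* h) := x :* (t :* h)) refl (intK (+ 2)) (intK dK + √dK) (ratK ½) ⟩
      (intK dK + √dK) * (intK (+ 2) * ratK ½)   ≡⟨ cong ((intK dK + √dK) *_) (sym (ratK-* (fromℤ (+ 2)) ½)) ⟩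
      (intK dK + √dK) * 1#                      ≡⟨ *-identityʳ _ ⟩
      intK dK + √dK                             ∎
      where open ≡-Reasoning

  √dK*√dK : √dK * √dK ≡ intK dK
  √dK*√dK = +√-cong
    (trans (ℚS.solve 2 (λ f m → ℚS.con 0ℚ ℚS.:* ℚS.con 0ℚ ℚS.:+ m ℚS.:* (f ℚS.:* f) ℚS.:= f ℚS.:* f ℚS.:* m) refl (fromℤ conductor) √m²)
      (sym (trans (fromℤ-* (conductor ℤ.* conductor) m) (cong (ℚ._* √m²) (fromℤ-* conductor conductor)))))
    (ℚS.solve 1 (λ f → ℚS.con 0ℚ ℚS.:* f ℚS.:+ f ℚS.:* ℚS.con 0ℚ ℚS.:= ℚS.con 0ℚ) refl (fromℤ conductor))

  τ*τ : τ * τ ≡ intK dK * τ - intK n₀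
  τ*τ = *-cancelˡ (intK (+ 4)) (intK≢0 λ ()) (begin
    intK (+ 4) * (τ * τ)
      ≡⟨ solve 1 (λ t → con (+ 4) :* (t :* t) := (con (+ 2) :* t) :* (con (+ 2) :* t)) refl τ ⟩
    (intK (+ 2) * τ) * (intK (+ 2) * τ)
      ≡⟨ cong (λ t → t * t) 2τ≡ ⟩
    (intK dK + √dK) * (intK dK + √dK)
      ≡⟨ solve 2 (λ d s → (d :+ s) :* (d :+ s) := d :* (con (+ 2) :* (d :+ s)) :- (d :* d :- s :* s)) refl (intK dK) √dK ⟩
    intK dK * (intK (+ 2) * (intK dK + √dK)) - (intK dK * intK dK - √dK * √dK)
      ≡⟨ cong₂ (λ s t → intK dK * (intK (+ 2) * s) - (intK dK * intK dK - t)) (sym 2τ≡) √dK*√dK ⟩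
    intK dK * (intK (+ 2) * (intK (+ 2) * τ)) - (intK dK * intK dK - intK dK)
      ≡⟨ cong (λ t → intK dK * (intK (+ 2) * (intK (+ 2) * τ)) - t) (trans (cong (_- intK dK) (sym (intK-* dK dK)))
           (trans (sym (intK-minus (dK ℤ.* dK) dK)) (trans (cong intK (sym 4n₀≡)) (intK-* (+ 4) n₀)))) ⟩
    intK dK * (intK (+ 2) * (intK (+ 2) * τ)) - intK (+ 4) * intK n₀
      ≡⟨ solve 3 (λ d t n → d :* (con (+ 2) :* (con (+ 2) :* t)) :- con (+ 4) :* n := con (+ 4) :* (d :* t :- n)) refl (intK dK) τ (intK n₀) ⟩
    intK (+ 4) * (intK dK * τ - intK n₀) ∎)
    where open ≡-Reasoning

  τ∈𝒪 : τ ∈ 𝒪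
  τ∈𝒪 = n₀ ∷ ℤ.- dK ∷ [] , trans (cong (λ d → intK n₀ + τ * (d + τ * 1#)) (intK-neg dK))
    (trans (solve 3 (λ n t d → n :+ t :* (:- d :+ t :* con 1ℤ) := t :* t :- (d :* t :- n)) refl (intK n₀) τ (intK dK))
      (x≡y⇒x-y≡0 τ*τ))

  ratK+√ : ∀ p q → ratK p + (0ℚ +√ q) ≡ (p +√ q)
  ratK+√ p q = +√-cong (ℚ.+-identityʳ p) (ℚ.+-identityˡ q)

  ratK*√ : ∀ p q → ratK p * (0ℚ +√ q) ≡ (0ℚ +√ p ℚ.* q)
  ratK*√ p q = +√-cong
    (ℚS.solve 3 (λ p q m → p ℚS.:* ℚS.con 0ℚ ℚS.:+ m ℚS.:* (ℚS.con 0ℚ ℚS.:* q) ℚS.:= ℚS.con 0ℚ) refl p q √m²)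
    (ℚS.solve 2 (λ p q → p ℚS.:* q ℚS.:+ ℚS.con 0ℚ ℚS.:* ℚS.con 0ℚ ℚS.:= p ℚS.:* q) refl p q)

  double-coords : ∀ r s → intK (+ 2) * (intK r + intK s * τ) ≡ (fromℤ (+ 2 ℤ.* r ℤ.+ s ℤ.* dK) +√ fromℤ (s ℤ.* conductor))
  double-coords r s = begin
    intK (+ 2) * (intK r + intK s * τ)
      ≡⟨ solve 3 (λ r s t → con (+ 2) :* (r :+ s :* t) := con (+ 2) :* r :+ s :* (con (+ 2) :* t)) refl (intK r) (intK s) τ ⟩
    intK (+ 2) * intK r + intK s * (intK (+ 2) * τ)
      ≡⟨ cong (λ t → intK (+ 2) * intK r + intK s * t) 2τ≡ ⟩
    intK (+ 2) * intK r + intK s * (intK dK + √dK)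
      ≡⟨ solve 4 (λ r s d e → con (+ 2) :* r :+ s :* (d :+ e) := (con (+ 2) :* r :+ s :* d) :+ s :* e) refl (intK r) (intK s) (intK dK) √dK ⟩
    intK (+ 2) * intK r + intK s * intK dK + intK s * √dK
      ≡⟨ cong₂ _+_ (trans (cong₂ _+_ (sym (intK-* (+ 2) r)) (sym (intK-* s dK))) (sym (intK-+ (+ 2 ℤ.* r) (s ℤ.* dK)))) s√dK ⟩
    intK (+ 2 ℤ.* r ℤ.+ s ℤ.* dK) + (0ℚ +√ fromℤ (s ℤ.* conductor))
      ≡⟨ ratK+√ (fromℤ (+ 2 ℤ.* r ℤ.+ s ℤ.* dK)) (fromℤ (s ℤ.* conductor)) ⟩
    (fromℤ (+ 2 ℤ.* r ℤ.+ s ℤ.* dK) +√ fromℤ (s ℤ.* conductor)) ∎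
    where
    open ≡-Reasoning
    s√dK : intK s * √dK ≡ (0ℚ +√ fromℤ (s ℤ.* conductor))
    s√dK = trans (ratK*√ (fromℤ s) (fromℤ conductor)) (cong (0ℚ +√_) (sym (fromℤ-* s conductor)))

  1,τ-independent : ∀ r s → intK r + intK s * τ ≡ 0# → r ≡ 0ℤ × s ≡ 0ℤ
  1,τ-independent r s eq = r≡0 s≡0 , s≡0
    where
    doubled : (fromℤ (+ 2 ℤ.* r ℤ.+ s ℤ.* dK) +√ fromℤ (s ℤ.* conductor)) ≡ 0#
    doubled = trans (sym (double-coords r s)) (trans (cong (λ x → intK (+ 2) * x) eq) (zeroʳ (intK (+ 2))))
    sf≡0 : s ℤ.* conductor ≡ 0ℤ
    sf≡0 = fromℤ-injective {s ℤ.* conductor} {0ℤ} (cong K.im doubled)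
    s≡0 : s ≡ 0ℤ
    s≡0 = [ (λ s≡0 → s≡0) , (λ f≡0 → ⊥-elim (conductor≢0 f≡0)) ]′ (ℤ.i*j≡0⇒i≡0∨j≡0 s {conductor} sf≡0)
    r≡0 : s ≡ 0ℤ → r ≡ 0ℤ
    r≡0 s≡0 = intK-injective {r} {0ℤ} (begin
      intK r                    ≡⟨ solve 2 (λ r t → r := r :+ con 0ℤ :* t) refl (intK r) τ ⟩
      intK r + intK 0ℤ * τ      ≡⟨ cong (λ s → intK r + intK s * τ) (sym s≡0) ⟩
      intK r + intK s * τ       ≡⟨ eq ⟩
      0#                        ∎)
      where open ≡-Reasoning

  4∤m : ∀ z → m ≢ + 4 ℤ.* z
  4∤m z m≡4z = 2≢1 (squarefree 2 (ℕ.divides ℤ.∣ z ∣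
    (trans (cong ℤ.∣_∣ m≡4z) (trans (ℤ.abs-* (+ 4) z) (ℕ.*-comm 4 ℤ.∣ z ∣)))))
    where
    2≢1 : 2 ≢ 1
    2≢1 ()

  -- If p + q√m has integral trace T = 2p and integral norm n, then m(2q)² = T² - 4n is an integer,
  -- so 2q is one because m is squarefree. What remains is the parity analysis of `coordinates`.
  𝒪-coords : ∀ {x} → x ∈ 𝒪 → ∃[ r ] ∃[ s ] x ≡ intK r + intK s * τ
  𝒪-coords {p +√ q} x∈ = build (bounded⇒trace _ bounded) (bounded⇒norm _ bounded)
    where
    bounded : Bounded (p +√ q)
    bounded = integral⇒bounded (p +√ q) x∈
    build : IsInt (p ℚ.+ p) → IsInt (p ℚ.* p ℚ.+ ℚ.- (√m² ℚ.* (q ℚ.* q))) → ∃[ r ] ∃[ s ] (p +√ q) ≡ intK r + intK s * τ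
    build (T , T≡) (n , n≡) = finish (squarefree-denominator (q ℚ.+ q) (T ℤ.* T ℤ.- + 4 ℤ.* n , m[2q]²))
      where
      open ≡-Reasoning
      T²-4n : ∀ T n → fromℤ (T ℤ.* T ℤ.- + 4 ℤ.* n) ≡ fromℤ T ℚ.* fromℤ T ℚ.+ ℚ.- (fromℤ (+ 4) ℚ.* fromℤ n)
      T²-4n T n = trans (fromℤ-+ (T ℤ.* T) (ℤ.- (+ 4 ℤ.* n))) (cong₂ ℚ._+_ (fromℤ-* T T)
        (trans (fromℤ-neg (+ 4 ℤ.* n)) (cong ℚ.-_ (fromℤ-* (+ 4) n))))
      m[2q]² : √m² ℚ.* ((q ℚ.+ q) ℚ.* (q ℚ.+ q)) ≡ fromℤ (T ℤ.* T ℤ.- + 4 ℤ.* n)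
      m[2q]² = begin
        √m² ℚ.* ((q ℚ.+ q) ℚ.* (q ℚ.+ q))
          ≡⟨ ℚS.solve 3 (λ p q m → m ℚS.:* ((q ℚS.:+ q) ℚS.:* (q ℚS.:+ q)) ℚS.:= (p ℚS.:+ p) ℚS.:* (p ℚS.:+ p)
               ℚS.:+ ℚS.:- (ℚS.con (fromℤ (+ 4)) ℚS.:* (p ℚS.:* p ℚS.:+ ℚS.:- (m ℚS.:* (q ℚS.:* q))))) refl p q √m² ⟩
        (p ℚ.+ p) ℚ.* (p ℚ.+ p) ℚ.+ ℚ.- (fromℤ (+ 4) ℚ.* (p ℚ.* p ℚ.+ ℚ.- (√m² ℚ.* (q ℚ.* q))))
          ≡⟨ cong₂ (λ t n → t ℚ.* t ℚ.+ ℚ.- (fromℤ (+ 4) ℚ.* n)) T≡ n≡ ⟩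
        fromℤ T ℚ.* fromℤ T ℚ.+ ℚ.- (fromℤ (+ 4) ℚ.* fromℤ n)
          ≡⟨ sym (T²-4n T n) ⟩
        fromℤ (T ℤ.* T ℤ.- + 4 ℤ.* n) ∎
      finish : IsInt (q ℚ.+ q) → ∃[ r ] ∃[ s ] (p +√ q) ≡ intK r + intK s * τ
      finish (S , S≡) = coords (coordinates conductor m conductor-cases 4∤m T S n (begin
          T ℤ.* T ℤ.- m ℤ.* (S ℤ.* S)                   ≡⟨ cong (λ e → T ℤ.* T ℤ.- e) mS² ⟩
          T ℤ.* T ℤ.- (T ℤ.* T ℤ.- + 4 ℤ.* n)           ≡⟨ ℤS.solve 2 (λ t n → t ℤS.:- (t ℤS.:- n) ℤS.:= n) refl (T ℤ.* T) (+ 4 ℤ.* n) ⟩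
          + 4 ℤ.* n                                     ∎))
        where
        mS² : m ℤ.* (S ℤ.* S) ≡ T ℤ.* T ℤ.- + 4 ℤ.* n
        mS² = fromℤ-injective (trans (fromℤ-* m (S ℤ.* S)) (trans (cong (√m² ℚ.*_) (trans (fromℤ-* S S) (cong (λ t → t ℚ.* t) (sym S≡)))) m[2q]²))
        double : intK (+ 2) * (p +√ q) ≡ (fromℤ T +√ fromℤ S)
        double = trans (solve 1 (λ x → con (+ 2) :* x := x :+ x) refl (p +√ q)) (+√-cong T≡ S≡)
        coords : ∃[ r ] ∃[ s ] (+ 2 ℤ.* r ℤ.+ s ℤ.* dK ≡ T × s ℤ.* conductor ≡ S) → ∃[ r ] ∃[ s ] (p +√ q) ≡ intK r + intK s * τ
        coords (r , s , eqT , eqS) = r , s , *-cancelˡ (intK (+ 2)) (intK≢0 λ ())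
          (trans double (sym (trans (double-coords r s) (+√-cong (cong fromℤ eqT) (cong fromℤ eqS)))))

  -- Idempotents modulo N and the gluing of local generators

  𝒪-minus : ∀ x y → x ∈ 𝒪 → y ∈ 𝒪 → x - y ∈ 𝒪
  𝒪-minus x y x∈ y∈ = 𝒪-+ x (- y) x∈ (𝒪-neg y y∈)

  𝒪-^ : ∀ {x} n → x ∈ 𝒪 → x ^ n ∈ 𝒪
  𝒪-^ zero            x∈ = 𝒪-1
  𝒪-^ {x = x} (suc n) x∈ = 𝒪-* x (x ^ n) x∈ (𝒪-^ n x∈)

  ^-+ : ∀ x i j → x ^ (i ℕ.+ j) ≡ x ^ i * x ^ j
  ^-+ x zero    j = sym (*-identityˡ _)
  ^-+ x (suc i) j = trans (cong (x *_) (^-+ x i j)) (sym (*-assoc x (x ^ i) (x ^ j)))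

  -- Used to see that replacing u by one of its powers f keeps 1 - f inside every ideal that
  -- contains 1 - u.
  geometric : ∀ {u} n → u ∈ 𝒪 → ∃[ S ] S ∈ 𝒪 × 1# - u ^ n ≡ (1# - u) * S
  geometric {u} zero    u∈ = 0# , 𝒪-0 , solve 1 (λ u → con 1ℤ :- con 1ℤ := (con 1ℤ :- u) :* con 0ℤ) refl u
  geometric {u} (suc n) u∈ with geometric n u∈
  ... | S , S∈ , eq = 1# + u * S , 𝒪-+ 1# (u * S) 𝒪-1 (𝒪-* u S u∈ S∈) , (begin
    1# - u * u ^ n                          ≡⟨ solve 2 (λ u p → con 1ℤ :- u :* p := (con 1ℤ :- u) :+ u :* (con 1ℤ :- p)) refl u (u ^ n) ⟩
    (1# - u) + u * (1# - u ^ n)             ≡⟨ cong (λ t → (1# - u) + u * t) eq ⟩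
    (1# - u) + u * ((1# - u) * S)           ≡⟨ solve 2 (λ u s → (con 1ℤ :- u) :+ u :* ((con 1ℤ :- u) :* s) := (con 1ℤ :- u) :* (con 1ℤ :+ u :* s)) refl u S ⟩
    (1# - u) * (1# + u * S)                 ∎)
    where open ≡-Reasoning

  module Modulo (N : ℕ) (0<N : 0 ℕ.< N) where
    instance
      N-nonZero : ℕ.NonZero N
      N-nonZero = ℕ.>-nonZero 0<N

    infix 4 _≈_
    _≈_ : K → K → Set
    x ≈ y = ∃[ w ] w ∈ 𝒪 × x - y ≡ intK (+ N) * w

    ≈-refl : ∀ {x} → x ≈ x
    ≈-refl {x} = 0# , 𝒪-0 , trans (-‿inverseʳ x) (sym (zeroʳ (intK (+ N))))

    ≈-trans : ∀ {x y z} → x ≈ y → y ≈ z → x ≈ z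
    ≈-trans {x} {y} {z} (v , v∈ , eq) (w , w∈ , eq′) = v + w , 𝒪-+ v w v∈ w∈ ,
      trans (solve 3 (λ x y z → x :- z := (x :- y) :+ (y :- z)) refl x y z)
        (trans (cong₂ _+_ eq eq′) (sym (distribˡ (intK (+ N)) v w)))

    ≈-*ˡ : ∀ a {x y} → a ∈ 𝒪 → x ≈ y → a * x ≈ a * y
    ≈-*ˡ a {x} {y} a∈ (w , w∈ , eq) = a * w , 𝒪-* a w a∈ w∈ ,
      trans (solve 3 (λ a x y → a :* x :- a :* y := a :* (x :- y)) refl a x y)
        (trans (cong (a *_) eq) (solve 3 (λ a n w → a :* (n :* w) := n :* (a :* w)) refl a (intK (+ N)) w))

    residue : ℤ → Fin N
    residue z = Fin.fromℕ< (ℤ.n%ℕd<d z N)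

    residue-≡ : ∀ r s → residue r ≡ residue s → ∃[ k ] r ℤ.- s ≡ + N ℤ.* k
    residue-≡ r s eq = r ℤ./ℕ N ℤ.- s ℤ./ℕ N , (begin
      r ℤ.- s
        ≡⟨ cong₂ ℤ._-_ (ℤ.a≡a%ℕn+[a/ℕn]*n r N) (ℤ.a≡a%ℕn+[a/ℕn]*n s N) ⟩
      (+ (r ℤ.%ℕ N) ℤ.+ r ℤ./ℕ N ℤ.* + N) ℤ.- (+ (s ℤ.%ℕ N) ℤ.+ s ℤ./ℕ N ℤ.* + N)
        ≡⟨ cong (λ t → (+ t ℤ.+ r ℤ./ℕ N ℤ.* + N) ℤ.- (+ (s ℤ.%ℕ N) ℤ.+ s ℤ./ℕ N ℤ.* + N)) (Fin.fromℕ<-injective _ _ (ℤ.n%ℕd<d r N) (ℤ.n%ℕd<d s N) eq) ⟩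
      (+ (s ℤ.%ℕ N) ℤ.+ r ℤ./ℕ N ℤ.* + N) ℤ.- (+ (s ℤ.%ℕ N) ℤ.+ s ℤ./ℕ N ℤ.* + N)
        ≡⟨ ℤS.solve 4 (λ t p q n → (t ℤS.:+ p ℤS.:* n) ℤS.:- (t ℤS.:+ q ℤS.:* n) ℤS.:= n ℤS.:* (p ℤS.:- q)) refl
             (+ (s ℤ.%ℕ N)) (r ℤ./ℕ N) (s ℤ./ℕ N) (+ N) ⟩
      + N ℤ.* (r ℤ./ℕ N ℤ.- s ℤ./ℕ N) ∎)
      where open ≡-Reasoning

    -- The coordinates are extracted from the proof of integrality, so the value belongs to that
    -- proof; equal values nevertheless force congruence modulo N.
    residues : ∀ {x} → x ∈ 𝒪 → Fin (N ℕ.* N)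
    residues x∈ = Fin.combine (residue (proj₁ (𝒪-coords x∈))) (residue (proj₁ (proj₂ (𝒪-coords x∈))))

    residues-≡ : ∀ {x y} (x∈ : x ∈ 𝒪) (y∈ : y ∈ 𝒪) → residues x∈ ≡ residues y∈ → x ≈ y
    residues-≡ {x} {y} x∈ y∈ eq = compare (𝒪-coords x∈) (𝒪-coords y∈) (proj₁ components) (proj₂ components)
      where
      components = Fin.combine-injective
        (residue (proj₁ (𝒪-coords x∈))) (residue (proj₁ (proj₂ (𝒪-coords x∈))))
        (residue (proj₁ (𝒪-coords y∈))) (residue (proj₁ (proj₂ (𝒪-coords y∈)))) eq
      compare : (X : ∃[ r ] ∃[ s ] x ≡ intK r + intK s * τ) (Y : ∃[ r ] ∃[ s ] y ≡ intK r + intK s * τ) →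
                residue (proj₁ X) ≡ residue (proj₁ Y) → residue (proj₁ (proj₂ X)) ≡ residue (proj₁ (proj₂ Y)) → x ≈ y
      compare (r , s , x≡) (r′ , s′ , y≡) r≡ s≡ =
        intK k + intK l * τ , 𝒪-+ (intK k) (intK l * τ) (𝒪-intK k) (𝒪-* (intK l) τ (𝒪-intK l) τ∈𝒪) , (begin
          x - y
            ≡⟨ cong₂ _-_ x≡ y≡ ⟩
          (intK r + intK s * τ) - (intK r′ + intK s′ * τ)
            ≡⟨ solve 5 (λ r s r′ s′ t → (r :+ s :* t) :- (r′ :+ s′ :* t) := (r :- r′) :+ (s :- s′) :* t) refl (intK r) (intK s) (intK r′) (intK s′) τ ⟩
          (intK r - intK r′) + (intK s - intK s′) * τ
            ≡⟨ cong₂ (λ a b → a + b * τ) (push r r′ k r-r′) (push s s′ l s-s′) ⟩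
          intK (+ N) * intK k + intK (+ N) * intK l * τ
            ≡⟨ solve 4 (λ n k l t → n :* k :+ n :* l :* t := n :* (k :+ l :* t)) refl (intK (+ N)) (intK k) (intK l) τ ⟩
          intK (+ N) * (intK k + intK l * τ) ∎)
        where
        open ≡-Reasoning
        k = proj₁ (residue-≡ r r′ r≡)
        l = proj₁ (residue-≡ s s′ s≡)
        r-r′ = proj₂ (residue-≡ r r′ r≡)
        s-s′ = proj₂ (residue-≡ s s′ s≡)
        push : ∀ a b c → a ℤ.- b ≡ + N ℤ.* c → intK a - intK b ≡ intK (+ N) * intK c
        push a b c eq = trans (sym (intK-minus a b)) (trans (cong intK eq) (intK-* (+ N) c))

    -- Among the N² + 1 powers of u with exponents 0, ..., N² two share one of the N² pairs of
    -- residues. Writing the gap between their exponents as `suc d` records that it is positive.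
    repetition : ∀ {u} → u ∈ 𝒪 → ∃[ i ] ∃[ d ] u ^ i ≈ u ^ i * u ^ suc d
    repetition {u} u∈ = found (Fin.pigeonhole (ℕ.n<1+n (N ℕ.* N)) (λ i → residues (𝒪-^ (Fin.toℕ i) u∈)))
      where
      found : (∃[ i ] ∃[ j ] i Fin.< j × residues (𝒪-^ (Fin.toℕ i) u∈) ≡ residues (𝒪-^ (Fin.toℕ j) u∈)) →
              ∃[ i ] ∃[ d ] u ^ i ≈ u ^ i * u ^ suc d
      found (i , j , i<j , eq) = Fin.toℕ i , d , subst (λ t → u ^ Fin.toℕ i ≈ t)
        (trans (cong (u ^_) (trans (sym (ℕ.m+[n∸m]≡n i<j)) (sym (ℕ.+-suc (Fin.toℕ i) d)))) (^-+ u (Fin.toℕ i) (suc d)))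
        (residues-≡ (𝒪-^ (Fin.toℕ i) u∈) (𝒪-^ (Fin.toℕ j) u∈) eq)
        where
        d = Fin.toℕ j ℕ.∸ suc (Fin.toℕ i)

    ≈-power : ∀ {p v} t → p ∈ 𝒪 → v ∈ 𝒪 → p ≈ p * v → p ≈ p * v ^ t
    ≈-power {p} {v} zero    p∈ v∈ eq = subst (p ≈_) (sym (*-identityʳ p)) ≈-refl
    ≈-power {p} {v} (suc t) p∈ v∈ eq = ≈-trans eq (subst₂ _≈_ (*-comm v p)
      (solve 3 (λ v p q → v :* (p :* q) := p :* (v :* q)) refl v p (v ^ t))
      (≈-*ˡ v v∈ (≈-power t p∈ v∈ eq)))

    -- A suitable power f = u T of u is idempotent modulo N, because 𝒪/N is finite.
    idempotent-power : ∀ {u} → u ∈ 𝒪 → ∃[ T ] ∃[ S ] ∃[ w ] T ∈ 𝒪 × S ∈ 𝒪 × w ∈ 𝒪 ×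
      1# - u * T ≡ (1# - u) * S × (u * T) * (1# - u * T) ≡ intK (+ N) * w
    idempotent-power {u} u∈ = build (repetition u∈)
      where
      build : (∃[ i ] ∃[ d ] u ^ i ≈ u ^ i * u ^ suc d) → ∃[ T ] ∃[ S ] ∃[ w ] T ∈ 𝒪 × S ∈ 𝒪 × w ∈ 𝒪 ×
        1# - u * T ≡ (1# - u) * S × (u * T) * (1# - u * T) ≡ intK (+ N) * w
      build (i , d , rep) = T , S₁ * S₂ , proj₁ idem , T∈ , 𝒪-* S₁ S₂ (proj₁ (proj₂ G₁)) (proj₁ (proj₂ G₂)) , proj₁ (proj₂ idem)
        , (begin
            1# - u * T                    ≡⟨ cong (λ t → 1# - t) (sym f≡) ⟩
            1# - f                        ≡⟨ proj₂ (proj₂ G₂) ⟩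
            (1# - u ^ suc d) * S₂         ≡⟨ cong (_* S₂) (proj₂ (proj₂ G₁)) ⟩
            (1# - u) * S₁ * S₂            ≡⟨ *-assoc (1# - u) S₁ S₂ ⟩
            (1# - u) * (S₁ * S₂)          ∎)
        , (begin
            (u * T) * (1# - u * T)        ≡⟨ cong (λ t → t * (1# - t)) (sym f≡) ⟩
            f * (1# - f)                  ≡⟨ solve 1 (λ f → f :* (con 1ℤ :- f) := f :- f :* f) refl f ⟩
            f - f * f                     ≡⟨ proj₂ (proj₂ idem) ⟩
            intK (+ N) * proj₁ idem       ∎)
        where
        open ≡-Reasoning
        f y T : K
        -- The exponent (d + 1)(i + 1) is a multiple of the period, so u^i ≈ u^i f, and it exceeds i
        -- enough for f = (u y) u^i; multiplying the congruence by u y gives f ≈ f f.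
        f = (u ^ suc d) ^ suc i
        y = (u ^ d) ^ suc i
        T = u ^ i * y
        y∈ : y ∈ 𝒪
        y∈ = 𝒪-^ (suc i) (𝒪-^ d u∈)
        T∈ : T ∈ 𝒪
        T∈ = 𝒪-* (u ^ i) y (𝒪-^ i u∈) y∈
        f≡ : f ≡ u * T
        f≡ = trans (^-distrib-* u (u ^ d) (suc i)) (*-assoc u (u ^ i) y)
        G₁ = geometric (suc d) u∈
        G₂ = geometric (suc i) (𝒪-^ (suc d) u∈)
        S₁ = proj₁ G₁
        S₂ = proj₁ G₂
        idem : f ≈ f * f
        idem = subst₂ _≈_
          (trans (solve 3 (λ u p y → (u :* y) :* p := u :* (p :* y)) refl u (u ^ i) y) (sym f≡))
          (trans (solve 4 (λ u p y f → (u :* y) :* (p :* f) := (u :* (p :* y)) :* f) refl u (u ^ i) y f) (cong (_* f) (sym f≡)))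
          (≈-*ˡ (u * y) (𝒪-* u y u∈ y∈) (≈-power (suc i) (𝒪-^ i u∈) (𝒪-^ (suc d) u∈) rep))

    -- Gluing p on the part f with q on the part 1 - f, and likewise their partial inverses, yields
    -- an inverse up to multiples of f(1 - f) and of e. The constant 3 comes from f³ + (1 - f)³ = 1
    -- - 3f(1 - f).
    splice : ∀ f p p′ q q′ e → p * p′ ≡ f → q * q′ ≡ (1# - f) - e →
      1# - (f * p + (1# - f) * q) * (f * p′ + (1# - f) * q′) ≡
        ((1# + 1# + 1#) - (p * q′ + q * p′)) * (f * (1# - f)) + (1# - f) * (1# - f) * e
    splice f p p′ q q′ e pp′≡f qq′≡ = begin
      1# - (f * p + (1# - f) * q) * (f * p′ + (1# - f) * q′)
        ≡⟨ solve 5 (λ f p p′ q q′ → let g = con 1ℤ :- f in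
             con 1ℤ :- (f :* p :+ g :* q) :* (f :* p′ :+ g :* q′)
             := con 1ℤ :- f :* f :* (p :* p′) :- g :* g :* (q :* q′) :- (p :* q′ :+ q :* p′) :* (f :* g)) refl f p p′ q q′ ⟩
      1# - f * f * (p * p′) - (1# - f) * (1# - f) * (q * q′) - (p * q′ + q * p′) * (f * (1# - f))
        ≡⟨ cong₂ (λ s t → 1# - f * f * s - (1# - f) * (1# - f) * t - (p * q′ + q * p′) * (f * (1# - f))) pp′≡f qq′≡ ⟩
      1# - f * f * f - (1# - f) * (1# - f) * ((1# - f) - e) - (p * q′ + q * p′) * (f * (1# - f))
        ≡⟨ solve 3 (λ f e c → let g = con 1ℤ :- f in
             con 1ℤ :- f :* f :* f :- g :* g :* (g :- e) :- c :* (f :* g)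
             := ((con 1ℤ :+ con 1ℤ :+ con 1ℤ) :- c) :* (f :* g) :+ g :* g :* e) refl f e (p * q′ + q * p′) ⟩
      ((1# + 1# + 1#) - (p * q′ + q * p′)) * (f * (1# - f)) + (1# - f) * (1# - f) * e ∎
      where open ≡-Reasoning

    module LocalGenerator {A B : Pred K 0ℓ} (A-sub : IsSubmodule A) (B-sub : IsSubmodule B)
                          (AB⊆𝒪 : ∀ {x y} → x ∈ A → y ∈ B → x * y ∈ 𝒪) where
      private
        module A = IsSubmodule A-sub
        module B = IsSubmodule B-sub

      -- Two products xy and gh that together give 1 modulo M are merged into a single one. Let f be
      -- a power of xy that is idempotent modulo N: as a multiple of xy it lets x be inverted on the
      -- part f, while 1 - f is a multiple of 1 - xy = gh + e, so g can be inverted on the part 1 -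
      -- f up to e.
      two-generators : ∀ {M x y g h e} → IsSubmodule M → intK (+ N) ∈ M →
        x ∈ A → y ∈ B → g ∈ A → h ∈ B → e ∈ 𝒪 → e ∈ M → 1# - x * y ≡ g * h + e →
        ∃[ f ] ∃[ S ] ∃[ k ] f ∈ 𝒪 × S ∈ 𝒪 × 1# - f ≡ (g * h + e) * S × k ∈ B × 1# - (f * x + (1# - f) * g) * k ∈ M
      two-generators {M} {x} {y} {g} {h} {e} M-sub N∈ x∈ y∈ g∈ h∈ e∈𝒪 e∈ eq = build (idempotent-power (AB⊆𝒪 x∈ y∈))
        where
        module M = IsSubmodule M-sub
        u = x * y
        build : (∃[ T ] ∃[ S ] ∃[ w ] T ∈ 𝒪 × S ∈ 𝒪 × w ∈ 𝒪 ×
          1# - u * T ≡ (1# - u) * S × (u * T) * (1# - u * T) ≡ intK (+ N) * w) →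
          ∃[ f ] ∃[ S ] ∃[ k ] f ∈ 𝒪 × S ∈ 𝒪 × 1# - f ≡ (g * h + e) * S × k ∈ B × 1# - (f * x + (1# - f) * g) * k ∈ M
        build (T , S , w , T∈ , S∈ , w∈ , 1-f≡ , idem) =
          f , S , k , f∈ , S∈ , 1-f , k∈ , resp M (sym (splice f x (T * y) g (S * h) (S * e) pp′≡f qq′≡))
            (M.+-clos (M.*-clos c c∈ (resp M (sym (trans idem (*-comm (intK (+ N)) w))) (M.*-clos w w∈ N∈)))
              (M.*-clos ((1# - f) * (1# - f)) (𝒪-* (1# - f) (1# - f) 1-f∈ 1-f∈) (M.*-clos S S∈ e∈)))
          where
          f k c : K
          f = u * T
          k = f * (T * y) + (1# - f) * (S * h)
          c = (1# + 1# + 1#) - (x * (S * h) + g * (T * y))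
          f∈ : f ∈ 𝒪
          f∈ = 𝒪-* u T (AB⊆𝒪 x∈ y∈) T∈
          1-f∈ : 1# - f ∈ 𝒪
          1-f∈ = 𝒪-minus 1# f 𝒪-1 f∈
          1-f : 1# - f ≡ (g * h + e) * S
          1-f = trans 1-f≡ (cong (_* S) eq)
          Ty∈ : T * y ∈ B
          Ty∈ = B.*-clos T T∈ y∈
          Sh∈ : S * h ∈ B
          Sh∈ = B.*-clos S S∈ h∈
          k∈ : k ∈ B
          k∈ = B.+-clos (B.*-clos f f∈ Ty∈) (B.*-clos (1# - f) 1-f∈ Sh∈)
          c∈ : c ∈ 𝒪
          c∈ = 𝒪-minus (1# + 1# + 1#) (x * (S * h) + g * (T * y)) (𝒪-+ (1# + 1#) 1# (𝒪-+ 1# 1# 𝒪-1 𝒪-1) 𝒪-1)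
            (𝒪-+ (x * (S * h)) (g * (T * y)) (AB⊆𝒪 x∈ Sh∈) (AB⊆𝒪 g∈ Ty∈))
          pp′≡f : x * (T * y) ≡ f
          pp′≡f = solve 3 (λ x y t → x :* (t :* y) := x :* y :* t) refl x y T
          qq′≡ : g * (S * h) ≡ (1# - f) - S * e
          qq′≡ = trans (solve 4 (λ g h e s → g :* (s :* h) := (g :* h :+ e) :* s :- s :* e) refl g h e S) (cong (_- S * e) (sym 1-f))

      Span⊆𝒪 : ∀ {gs} → All 𝒪 gs → Span gs ⊆ 𝒪
      Span⊆𝒪 = Span⊆ 𝒪-submodule

      -- Induction on the number of products in z. The product xy is moved into the modulus, the
      -- remaining sum yields gh ≡ 1 modulo xy and gs, and `two-generators` then merges g with x.
      -- The modulus is given by generators so that the coefficient of xy can be read off.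
      local-generator : ∀ {z} → z ∈ A · B → ∀ {gs} → All 𝒪 gs → intK (+ N) ∈ Span gs → 1# - z ∈ Span gs →
        ∃[ g ] ∃[ h ] g ∈ A × h ∈ B × 1# - g * h ∈ Span gs
      -- For the empty sum the modulus contains 1, and the product 0 · 0 is already congruent to 1.
      local-generator [] {gs} gs∈ N∈ 1∈ = 0# , 0# , A.0∈ , B.0∈ , resp (Span gs) (cong (λ t → 1# - t) (sym (zeroʳ 0#))) 1∈
      local-generator (add {x} {y} {z} x∈ y∈ z∈) {gs} gs∈ N∈ 1-z∈ =
        build (local-generator z∈ {x * y ∷ gs} (AB⊆𝒪 x∈ y∈ ∷ gs∈) (weaken N∈) (resp (Span (x * y ∷ gs))
          (solve 2 (λ xy z → con 1ℤ :* xy :+ (con 1ℤ :- (xy :+ z)) := con 1ℤ :- z) refl (x * y) z) (comb 1# 𝒪-1 1-z∈)))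
        where
        weaken : ∀ {t} → t ∈ Span gs → t ∈ Span (x * y ∷ gs)
        weaken {t} t∈ = resp (Span (x * y ∷ gs)) (solve 2 (λ xy t → con 0ℤ :* xy :+ t := t) refl (x * y) t) (comb 0# 𝒪-0 t∈)
        Goal : Set
        Goal = ∃[ g ] ∃[ h ] g ∈ A × h ∈ B × 1# - g * h ∈ Span gs
        combine : ∀ {g h} c {e} → g ∈ A → h ∈ B → c ∈ 𝒪 → e ∈ Span gs → 1# - g * h ≡ c * (x * y) + e → Goal
        -- Absorbing the coefficient c into y turns 1 - gh = cxy + e into x(cy) + gh + e = 1, the
        -- shape that `two-generators` expects.
        combine {g} {h} c {e} g∈ h∈ c∈ e∈ eq = finish
          (two-generators (Span-submodule gs) N∈ x∈ (B.*-clos c c∈ y∈) g∈ h∈ (Span⊆𝒪 gs∈ e∈) e∈ (begin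
            1# - x * (c * y)                    ≡⟨ solve 5 (λ x y c g h → con 1ℤ :- x :* (c :* y) := (con 1ℤ :- g :* h) :- c :* (x :* y) :+ g :* h) refl x y c g h ⟩
            (1# - g * h) - c * (x * y) + g * h  ≡⟨ cong (λ t → t - c * (x * y) + g * h) eq ⟩
            (c * (x * y) + e) - c * (x * y) + g * h ≡⟨ solve 3 (λ p e q → (p :+ e) :- p :+ q := q :+ e) refl (c * (x * y)) e (g * h) ⟩
            g * h + e                           ∎))
          where
          open ≡-Reasoning
          finish : (∃[ f ] ∃[ S ] ∃[ k ] f ∈ 𝒪 × S ∈ 𝒪 × 1# - f ≡ (g * h + e) * S × k ∈ B × 1# - (f * x + (1# - f) * g) * k ∈ Span gs) → Goal
          finish (f , S , k , f∈ , S∈ , _ , k∈ , result) =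
            f * x + (1# - f) * g , k , A.+-clos (A.*-clos f f∈ x∈) (A.*-clos (1# - f) (𝒪-minus 1# f 𝒪-1 f∈) g∈) , k∈ , result
        build : (∃[ g ] ∃[ h ] g ∈ A × h ∈ B × 1# - g * h ∈ Span (x * y ∷ gs)) → Goal
        build (g , h , g∈ , h∈ , span) = split span refl
          where
          split : ∀ {t} → t ∈ Span (x * y ∷ gs) → 1# - g * h ≡ t → Goal
          split (comb c c∈ e∈) eq = combine c g∈ h∈ c∈ e∈ eq

  -- Principal ideals, integral representatives and units modulo 𝔫

  principal-submodule : ∀ ν → IsSubmodule ⟨ ν ⟩
  principal-submodule ν = record
    { 0∈     = 0# , 𝒪-0 , sym (zeroʳ ν)
    ; +-clos = λ { (a , a∈ , refl) (b , b∈ , refl) → a + b , 𝒪-+ a b a∈ b∈ , sym (distribˡ ν a b) }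
    ; *-clos = λ { c c∈ (a , a∈ , refl) → c * a , 𝒪-* c a c∈ a∈ , solve 3 (λ c n a → c :* (n :* a) := n :* (c :* a)) refl c ν a }
    }

  ν∈⟨ν⟩ : ∀ ν → ν ∈ ⟨ ν ⟩
  ν∈⟨ν⟩ ν = 1# , 𝒪-1 , sym (*-identityʳ ν)

  principal-fractional : ∀ {ν} → ν ≢ 0# → IsFractionalIdeal ⟨ ν ⟩
  principal-fractional {ν} ν≢0 = record
    { isSubmodule = principal-submodule ν
    ; generators  = ν ∷ []
    ; generators∈ = ν∈⟨ν⟩ ν ∷ []
    ; generated   = λ { (a , a∈ , refl) → resp (Span (ν ∷ [])) (trans (+-identityʳ (a * ν)) (*-comm a ν)) (comb a a∈ []) }
    ; nonzero     = ν , ν∈⟨ν⟩ ν , ν≢0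
    }

  principal-integral : ∀ {ν} → ν ∈ 𝒪 → ν ≢ 0# → IsIntegralIdeal ⟨ ν ⟩
  principal-integral {ν} ν∈ ν≢0 = record
    { isFractionalIdeal = principal-fractional ν≢0
    ; ⊆𝒪                = λ { (a , a∈ , refl) → 𝒪-* ν a ν∈ a∈ }
    }

  module Modulus (𝔫 : Pred K 0ℓ) (𝔫-ideal : IsIntegralIdeal 𝔫) where
    open RayClasses 𝔫 𝔫-ideal

    comaximal-principal : ∀ ν → 1# - ν ∈ 𝔫 → Comaximal ⟨ ν ⟩ 𝔫
    comaximal-principal ν ν≡1 = ν , 1# - ν , ν∈⟨ν⟩ ν , ν≡1 , solve 1 (λ ν → con 1ℤ := ν :+ (con 1ℤ :- ν)) refl ν

    ≡1⇒≡*1 : ∀ {ν} → ν ∈ 𝒪 → ν ≢ 0# → 1# - ν ∈ 𝔫 → ν ≡*1mod 𝔫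
    ≡1⇒≡*1 {ν} ν∈ ν≢0 ν≡1 = record
      { ν≢0 = ν≢0 ; α = ν ; β = 1# ; α∈𝒪 = ν∈ ; β∈𝒪 = 𝒪-1 ; β≢0 = 1≢0
      ; α-coprime = comaximal-principal ν ν≡1
      ; β-coprime = comaximal-1 (ν∈⟨ν⟩ 1#)
      ; congruent = resp 𝔫 (solve 1 (λ ν → con ℤ.-1ℤ :* (con 1ℤ :- ν) := ν :- con 1ℤ) refl ν) (𝔫.*-clos (intK ℤ.-1ℤ) (𝒪-intK ℤ.-1ℤ) ν≡1)
      ; quotient = *-identityʳ ν }

    module _ {J : Pred K 0ℓ} (J-fractional : IsFractionalIdeal J) (J⊆𝒪 : J ⊆ 𝒪) (N : ℕ) (0<N : 0 ℕ.< N) (N∈𝔫 : intK (+ N) ∈ 𝔫) where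
      private
        module J = IsFractionalIdeal J-fractional
        module Mod = Modulo N 0<N

      -- The last equation encodes J = ν𝒪 + NJ, since it gives x = ν(hx) + N(wx) for x in J. Gluing
      -- an arbitrary generator to e could destroy the congruence modulo 𝔫. So the first stage looks
      -- for g inside 𝔫J, working modulo e and N, and the second glues e and g modulo N alone; then
      -- 1 - f lies in 𝔫 and ν ≡ e ≡ 1.
      unit-generator : ∀ {e} → e ∈ J → 1# - e ∈ 𝔫 →
        ∃[ ν ] ∃[ h ] ∃[ w ] ν ∈ J × h ∈ J ⁻¹ᴵ × w ∈ 𝒪 × 1# - ν ∈ 𝔫 × 1# - ν * h ≡ w * intK (+ N)
      unit-generator {e} e∈ e≡1 = build (G.local-generator z∈ (J⊆𝒪 e∈ ∷ 𝒪-intK (+ N) ∷ [])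
          (Span-∈ (there (here refl)))
          (resp (Span gs) (solve 1 (λ e → e := con 1ℤ :- (con 1ℤ :- e)) refl e) (Span-∈ (here refl))))
        where
        gs : List K
        gs = e ∷ intK (+ N) ∷ []
        𝔫J⊆J : 𝔫 · J ⊆ J
        𝔫J⊆J = ·-⊆ J.isSubmodule (λ {x} x∈ y∈ → J.*-clos x (𝔫.⊆𝒪 x∈) y∈)
        pair : ∀ {x y} → x ∈ J → y ∈ J ⁻¹ᴵ → x * y ∈ 𝒪
        pair {x} {y} x∈ y∈ = resp 𝒪 (*-comm y x) (y∈ x x∈)
        𝔫JJ⁻¹⊆𝔫 : ∀ {x h} → x ∈ 𝔫 · J → h ∈ J ⁻¹ᴵ → h * x ∈ 𝔫
        𝔫JJ⁻¹⊆𝔫 {h = h} x∈ h∈ = ·-⊆ (preimage-submodule h 𝔫.isSubmodule) (λ {a} {b} a∈ b∈ →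
          resp 𝔫 (solve 3 (λ h a b → (h :* b) :* a := h :* (a :* b)) refl h a b) (𝔫.*-clos (h * b) (h∈ b b∈) a∈)) x∈
        module G = Mod.LocalGenerator (·-submodule {𝔫} {J} 𝔫.isSubmodule) (⁻¹ᴵ-submodule J) (λ x∈ y∈ → pair (𝔫J⊆J x∈) y∈)
        module H = Mod.LocalGenerator J.isSubmodule (⁻¹ᴵ-submodule J) pair
        -- Invertibility of J gives 𝔫 = 𝔫(JJ⁻¹), so 1 - e is itself a sum of products to which
        -- `local-generator` applies.
        z∈ : 1# - e ∈ (𝔫 · J) · (J ⁻¹ᴵ)
        z∈ = resp ((𝔫 · J) · (J ⁻¹ᴵ)) (*-identityʳ (1# - e))
          (proj₂ (·-assoc 𝔫 J (J ⁻¹ᴵ)) (·-single e≡1 (Inversion.1∈ J-fractional)))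
        Goal : Set
        Goal = ∃[ ν ] ∃[ h ] ∃[ w ] ν ∈ J × h ∈ J ⁻¹ᴵ × w ∈ 𝒪 × 1# - ν ∈ 𝔫 × 1# - ν * h ≡ w * intK (+ N)
        combine : ∀ {g h} c b → g ∈ 𝔫 · J → h ∈ J ⁻¹ᴵ → c ∈ 𝒪 → b ∈ 𝒪 → 1# - g * h ≡ c * e + (b * intK (+ N) + 0#) → Goal
        combine {g} {h} c b g∈ h∈ c∈ b∈ eq = finish (H.two-generators {Span (intK (+ N) ∷ [])} (Span-submodule (intK (+ N) ∷ []))
            (Span-∈ (here refl)) e∈ c∈J⁻¹ (𝔫J⊆J g∈) h∈ (𝒪-* b (intK (+ N)) b∈ (𝒪-intK (+ N))) (resp (Span (intK (+ N) ∷ [])) (+-identityʳ (b * intK (+ N))) (comb b b∈ [])) (begin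
              1# - e * c                               ≡⟨ solve 4 (λ e c g h → con 1ℤ :- e :* c := (con 1ℤ :- g :* h) :- c :* e :+ g :* h) refl e c g h ⟩
              (1# - g * h) - c * e + g * h             ≡⟨ cong (λ t → t - c * e + g * h) eq ⟩
              c * e + (b * intK (+ N) + 0#) - c * e + g * h ≡⟨ solve 3 (λ p n q → p :+ (n :+ con 0ℤ) :- p :+ q := q :+ n) refl (c * e) (b * intK (+ N)) (g * h) ⟩
              g * h + b * intK (+ N)                   ∎))
          where
          open ≡-Reasoning
          c∈J⁻¹ : c ∈ J ⁻¹ᴵ
          c∈J⁻¹ y y∈ = 𝒪-* c y c∈ (J⊆𝒪 y∈)
          finish : (∃[ f ] ∃[ S ] ∃[ k ] f ∈ 𝒪 × S ∈ 𝒪 × 1# - f ≡ (g * h + b * intK (+ N)) * S × k ∈ J ⁻¹ᴵ ×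
            1# - (f * e + (1# - f) * g) * k ∈ Span (intK (+ N) ∷ [])) → Goal
          finish (f , S , k , f∈ , S∈ , 1-f≡ , k∈ , result) = split result refl
            where
            ν = f * e + (1# - f) * g
            -- A multiple of gh + bN, where gh lies in 𝔫 because g was taken from 𝔫J and h from J⁻¹.
            1-f∈𝔫 : 1# - f ∈ 𝔫
            1-f∈𝔫 = resp 𝔫 (trans (*-comm S (g * h + b * intK (+ N))) (sym 1-f≡)) (𝔫.*-clos S S∈
              (𝔫.+-clos (resp 𝔫 (*-comm h g) (𝔫JJ⁻¹⊆𝔫 g∈ h∈)) (𝔫.*-clos b b∈ N∈𝔫)))
            ν≡1 : 1# - ν ∈ 𝔫
            ν≡1 = resp 𝔫 (solve 3 (λ f e g → f :* (con 1ℤ :- e) :+ (con 1ℤ :- g) :* (con 1ℤ :- f) := con 1ℤ :- (f :* e :+ (con 1ℤ :- f) :* g)) refl f e g)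
              (𝔫.+-clos (𝔫.*-clos f f∈ e≡1) (𝔫.*-clos (1# - g) (𝒪-minus 1# g 𝒪-1 (J⊆𝒪 (𝔫J⊆J g∈))) 1-f∈𝔫))
            ν∈ : ν ∈ J
            ν∈ = J.+-clos (J.*-clos f f∈ e∈) (J.*-clos (1# - f) (𝒪-minus 1# f 𝒪-1 f∈) (𝔫J⊆J g∈))
            split : ∀ {t} → t ∈ Span (intK (+ N) ∷ []) → 1# - ν * k ≡ t → Goal
            split (comb w w∈ []) eq = ν , k , w , ν∈ , k∈ , w∈ , ν≡1 , trans eq (+-identityʳ (w * intK (+ N)))
        build : (∃[ g ] ∃[ h ] g ∈ 𝔫 · J × h ∈ J ⁻¹ᴵ × 1# - g * h ∈ Span gs) → Goal
        build (g , h , g∈ , h∈ , span) = split span refl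
          where
          split : ∀ {t} → t ∈ Span gs → 1# - g * h ≡ t → Goal
          split (comb c c∈ (comb b b∈ [])) eq = combine c b g∈ h∈ c∈ b∈ eq

    -- Comaximality provides some c ≡ 1, which may be 0. In that case 1 lies in 𝔫, every congruence
    -- modulo 𝔫 holds, and any nonzero element of I serves.
    comaximal-representative : ∀ {I} → IsIntegralIdeal I → Comaximal I 𝔫 → ∃[ c ] c ∈ I × c ≢ 0# × 1# - c ∈ 𝔫
    comaximal-representative {I} I-ideal (c , n , c∈ , n∈ , 1≡c+n) = choose (c ≟ 0#)
      where
      module I = IsIntegralIdeal I-ideal
      choose : Dec (c ≡ 0#) → ∃[ c ] c ∈ I × c ≢ 0# × 1# - c ∈ 𝔫
      choose (no c≢0)  = c , c∈ , c≢0 , resp 𝔫 (trans (solve 2 (λ c n → n := (c :+ n) :- c) refl c n) (cong (_- c) (sym 1≡c+n))) n∈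
      choose (yes c≡0) = x , x∈ , x≢0 , resp 𝔫 (*-identityʳ (1# - x)) (𝔫.*-clos (1# - x) (𝒪-minus 1# x 𝒪-1 (I.⊆𝒪 x∈)) 1∈𝔫)
        where
        x = proj₁ I.nonzero
        x∈ = proj₁ (proj₂ I.nonzero)
        x≢0 = proj₂ (proj₂ I.nonzero)
        1∈𝔫 : 1# ∈ 𝔫
        1∈𝔫 = resp 𝔫 (sym (trans 1≡c+n (trans (cong (_+ n) c≡0) (+-identityˡ n)))) n∈

    open 𝓘

    -- Write I = 𝔟𝔠⁻¹ and take c in 𝔠, b in 𝔟 with c ≡ b ≡ 1 (mod 𝔫). Then J = cI lies in 𝔠I = 𝔟,
    -- hence in 𝒪, and as 𝔟 = I𝔠 lies in I, the product cb is an element of J congruent to 1.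
    integral-representative : (I : 𝓘) → Σ[ J ∈ 𝓘 ] J ∼ I × ideal J ⊆ 𝒪 × ∃[ e ] e ∈ ideal J × 1# - e ∈ 𝔫
    integral-representative I = build (comaximal-representative P.𝔠-ideal P.𝔠-coprime)
      where
      module P = _PrimeTo_ (primeTo I)
      module 𝔠 = IsIntegralIdeal P.𝔠-ideal
      Goal = Σ[ J ∈ 𝓘 ] J ∼ I × ideal J ⊆ 𝒪 × ∃[ e ] e ∈ ideal J × 1# - e ∈ 𝔫
      build : ∃[ c ] c ∈ P.𝔠 × c ≢ 0# × 1# - c ∈ 𝔫 → Goal
      build (c , c∈ , c≢0 , c≡1) = J , (c , ≡1⇒≡*1 (𝔠.⊆𝒪 c∈) c≢0 c≡1 , ≐-refl {ideal J}) , J⊆𝒪 , element P.𝔟-coprime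
        where
        J : 𝓘
        J = record { ideal = ⟨ c ⟩ ; fractional = principal-fractional c≢0 ; primeTo = record
          { 𝔟 = ⟨ c ⟩ ; 𝔠 = 𝒪 ; 𝔟-ideal = principal-integral (𝔠.⊆𝒪 c∈) c≢0 ; 𝔠-ideal = 𝒪-integral
          ; 𝔟-coprime = comaximal-principal c c≡1 ; 𝔠-coprime = comaximal-1 𝒪-1
          ; quotient = ≐-trans {⟨ c ⟩ · 𝒪} {𝒪 · ⟨ c ⟩} {⟨ c ⟩} (·-comm ⟨ c ⟩ 𝒪) (𝒪· (principal-submodule c)) } } ∙ I
        J⊆𝒪 : ideal J ⊆ 𝒪
        J⊆𝒪 = ·-⊆ 𝒪-submodule λ { {y = y} (a , a∈ , refl) y∈ → resp 𝒪 (solve 3 (λ a y c → a :* (y :* c) := c :* a :* y) refl a y c)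
          (𝒪-* a (y * c) a∈ (IsIntegralIdeal.⊆𝒪 P.𝔟-ideal (proj₁ P.quotient (·-single y∈ c∈)))) }
        element : Comaximal P.𝔟 𝔫 → ∃[ e ] e ∈ ideal J × 1# - e ∈ 𝔫
        element (b , n , b∈ , n∈ , 1≡b+n) = c * b , ·-single (ν∈⟨ν⟩ c) b∈I , resp 𝔫
            (trans (solve 3 (λ b c n → b :* (con 1ℤ :- c) :+ n := (b :+ n) :- c :* b) refl b c n) (cong (_- c * b) (sym 1≡b+n)))
            (𝔫.+-clos (𝔫.*-clos b (IsIntegralIdeal.⊆𝒪 P.𝔟-ideal b∈) c≡1) n∈)
          where
          b∈I : b ∈ ideal I
          b∈I = ·-⊆ (isSubmodule I) (λ {x} {y} x∈ y∈ → resp (ideal I) (*-comm y x) (IsSubmodule.*-clos (isSubmodule I) y (𝔠.⊆𝒪 y∈) x∈)) (proj₂ P.quotient b∈)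

  -- Lattices in K and ℤ-bases of fractional ideals

  module Lattice (α β : K) where
    0∈ : 0# ∈ [ α , β ]
    0∈ = 0ℤ , 0ℤ , solve 2 (λ α β → con 0ℤ := con 0ℤ :* α :+ con 0ℤ :* β) refl α β

    +-clos : ∀ {x y} → x ∈ [ α , β ] → y ∈ [ α , β ] → x + y ∈ [ α , β ]
    +-clos {x} {y} (r , s , x≡) (r′ , s′ , y≡) = r ℤ.+ r′ , s ℤ.+ s′ , (begin
      x + y                                                             ≡⟨ cong₂ _+_ x≡ y≡ ⟩
      (intK r * α + intK s * β) + (intK r′ * α + intK s′ * β)           ≡⟨ solve 6 (λ r s r′ s′ α β → (r :* α :+ s :* β) :+ (r′ :* α :+ s′ :* β) := (r :+ r′) :* α :+ (s :+ s′) :* β) refl (intK r) (intK s) (intK r′) (intK s′) α β ⟩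
      (intK r + intK r′) * α + (intK s + intK s′) * β                   ≡⟨ cong₂ (λ a b → a * α + b * β) (sym (intK-+ r r′)) (sym (intK-+ s s′)) ⟩
      intK (r ℤ.+ r′) * α + intK (s ℤ.+ s′) * β                         ∎)
      where open ≡-Reasoning

    *-clos : ∀ {x} z → x ∈ [ α , β ] → intK z * x ∈ [ α , β ]
    *-clos {x} z (r , s , x≡) = z ℤ.* r , z ℤ.* s , (begin
      intK z * x                                        ≡⟨ cong (intK z *_) x≡ ⟩
      intK z * (intK r * α + intK s * β)                ≡⟨ solve 5 (λ z r s α β → z :* (r :* α :+ s :* β) := (z :* r) :* α :+ (z :* s) :* β) refl (intK z) (intK r) (intK s) α β ⟩
      (intK z * intK r) * α + (intK z * intK s) * β     ≡⟨ cong₂ (λ a b → a * α + b * β) (sym (intK-* z r)) (sym (intK-* z s)) ⟩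
      intK (z ℤ.* r) * α + intK (z ℤ.* s) * β           ∎)
      where open ≡-Reasoning

    combination : ∀ {x y} r s → x ∈ [ α , β ] → y ∈ [ α , β ] → intK r * x + intK s * y ∈ [ α , β ]
    combination r s x∈ y∈ = +-clos (*-clos r x∈) (*-clos s y∈)

    left : α ∈ [ α , β ]
    left = 1ℤ , 0ℤ , solve 2 (λ α β → α := con 1ℤ :* α :+ con 0ℤ :* β) refl α β

    right : β ∈ [ α , β ]
    right = 0ℤ , 1ℤ , solve 2 (λ α β → β := con 0ℤ :* α :+ con 1ℤ :* β) refl α β

    span-⊆ : ∀ {γ δ} → γ ∈ [ α , β ] → δ ∈ [ α , β ] → [ γ , δ ] ⊆ [ α , β ]
    span-⊆ γ∈ δ∈ (r , s , x≡) = resp [ α , β ] (sym x≡) (combination r s γ∈ δ∈)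

  -- The inverse of a matrix of determinant 1 again has integer entries; they are the coordinates of
  -- α and β in the new pair.
  unimodular-⊆ : ∀ {α β} p q r s → p ℤ.* s ℤ.- q ℤ.* r ≡ 1ℤ →
    [ α , β ] ⊆ [ intK p * α + intK q * β , intK r * α + intK s * β ]
  unimodular-⊆ {α} {β} p q r s det = Lattice.span-⊆ (intK p * α + intK q * β) (intK r * α + intK s * β)
    (s , ℤ.- q , trans (scale α) (trans
      (solve 6 (λ p q r s α β → (p :* s :- q :* r) :* α := s :* (p :* α :+ q :* β) :+ (:- q) :* (r :* α :+ s :* β)) refl (intK p) (intK q) (intK r) (intK s) α β)
      (cong (λ t → intK s * (intK p * α + intK q * β) + t * (intK r * α + intK s * β)) (sym (intK-neg q)))))
    (ℤ.- r , p , trans (scale β) (trans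
      (solve 6 (λ p q r s α β → (p :* s :- q :* r) :* β := (:- r) :* (p :* α :+ q :* β) :+ p :* (r :* α :+ s :* β)) refl (intK p) (intK q) (intK r) (intK s) α β)
      (cong (λ t → t * (intK p * α + intK q * β) + intK p * (intK r * α + intK s * β)) (sym (intK-neg r)))))
    where
    detK : intK p * intK s - intK q * intK r ≡ 1#
    detK = trans (cong₂ _-_ (sym (intK-* p s)) (sym (intK-* q r))) (trans (sym (intK-minus (p ℤ.* s) (q ℤ.* r))) (cong intK det))
    scale : ∀ x → x ≡ (intK p * intK s - intK q * intK r) * x
    scale x = trans (sym (*-identityˡ x)) (cong (_* x) (sym detK))

  record Subgroup (P : Pred K 0ℓ) : Set where
    field
      0∈     : P 0#
      +-clos : ∀ {x y} → P x → P y → P (x + y)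
      *-clos : ∀ z {x} → P x → P (intK z * x)

  submodule⇒subgroup : ∀ {I} → IsSubmodule I → Subgroup I
  submodule⇒subgroup sub = record { 0∈ = I.0∈ ; +-clos = I.+-clos ; *-clos = λ z → I.*-clos (intK z) (𝒪-intK z) }
    where module I = IsSubmodule sub

  -- That `ratK a` and β are ℤ-combinations of xs is expressed by their lying in every subgroup that
  -- contains xs. Independence is a separate matter, proved later for lattices containing a
  -- fractional ideal.
  record Basis (xs : List K) : Set₁ where
    field
      a     : ℚ
      β     : K
      spans : All [ ratK a , β ] xs
      combo : ∀ {P} → Subgroup P → All P xs → P (ratK a) × P β

  im-+ : ∀ x y → K.im (x + y) ≡ K.im x ℚ.+ K.im y
  im-+ (_ +√ _) (_ +√ _) = refl

  im-intK* : ∀ z x → K.im (intK z * x) ≡ fromℤ z ℚ.* K.im x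
  im-intK* z (p +√ q) = im-ratK* (fromℤ z) p q
    where
    im-ratK* : ∀ r p q → r ℚ.* q ℚ.+ 0ℚ ℚ.* p ≡ r ℚ.* q
    im-ratK* = ℚS.solve 3 (λ r p q → r ℚS.:* q ℚS.:+ ℚS.con 0ℚ ℚS.:* p ℚS.:= r ℚS.:* q) refl

  real : ∀ {x} → K.im x ≡ 0ℚ → ratK (K.re x) ≡ x
  real {p +√ q} q≡0 = +√-cong refl (sym q≡0)

  reduce-im : ∀ u {x y g} → K.im x ≡ fromℤ u ℚ.* g → K.im y ≡ g → K.im (x + intK (ℤ.- u) * y) ≡ 0ℚ
  reduce-im u {x} {y} {g} x≡ y≡ = begin
    K.im (x + intK (ℤ.- u) * y)                       ≡⟨ im-+ x (intK (ℤ.- u) * y) ⟩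
    K.im x ℚ.+ K.im (intK (ℤ.- u) * y)                ≡⟨ cong (λ t → K.im x ℚ.+ t) (im-intK* (ℤ.- u) y) ⟩
    K.im x ℚ.+ fromℤ (ℤ.- u) ℚ.* K.im y               ≡⟨ cong₂ (λ s t → s ℚ.+ t ℚ.* K.im y) x≡ (fromℤ-neg u) ⟩
    fromℤ u ℚ.* g ℚ.+ (ℚ.- fromℤ u) ℚ.* K.im y        ≡⟨ cong (λ t → fromℤ u ℚ.* g ℚ.+ (ℚ.- fromℤ u) ℚ.* t) y≡ ⟩
    fromℤ u ℚ.* g ℚ.+ (ℚ.- fromℤ u) ℚ.* g             ≡⟨ cancel (fromℤ u) g ⟩
    0ℚ                                                ∎
    where
    open ≡-Reasoning
    cancel : ∀ u g → u ℚ.* g ℚ.+ (ℚ.- u) ℚ.* g ≡ 0ℚ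
    cancel = ℚS.solve 2 (λ u g → u ℚS.:* g ℚS.:+ (ℚS.:- u) ℚS.:* g ℚS.:= ℚS.con 0ℚ) refl

  -- Hermite normal form: one basis vector is rational, the other generates the imaginary parts.
  basis : ∀ xs → Basis xs
  basis [] = record { a = 0ℚ ; β = 0# ; spans = [] ; combo = λ P-sub _ → Subgroup.0∈ P-sub , Subgroup.0∈ P-sub }
  basis (x ∷ xs) = record { a = G.g ; β = β ; spans = x∈ ∷ All.map old⊆ B.spans ; combo = λ P-sub P-all → combo P-sub P-all }
    where
    module B = Basis (basis xs)
    module C = CommonDivisorℚ (commonDivisorℚ (K.im x) (K.im B.β))
    β ρ σ : K
    β = intK C.x * x + intK C.y * B.β
    ρ = x + intK (ℤ.- C.u) * β
    σ = B.β + intK (ℤ.- C.v) * β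
    imβ : K.im β ≡ C.g
    imβ = trans (im-+ (intK C.x * x) (intK C.y * B.β)) (trans (cong₂ ℚ._+_ (im-intK* C.x x) (im-intK* C.y B.β)) (sym C.g≡))
    imρ : K.im ρ ≡ 0ℚ
    imρ = reduce-im C.u {x} {β} C.p≡ imβ
    imσ : K.im σ ≡ 0ℚ
    imσ = reduce-im C.v {B.β} {β} C.q≡ imβ
    -- After subtraction of multiples of the new β, what is left of x and of the old β is rational,
    -- so together with the old rational vector it generates a cyclic group.
    module G = Generator (generator (K.re ρ ∷ K.re σ ∷ B.a ∷ []))
    module Λ = Lattice (ratK G.g) β
    rational : ∀ {q} → q ∈ˡ K.re ρ ∷ K.re σ ∷ B.a ∷ [] → ratK q ∈ [ ratK G.g , β ]
    rational {q} q∈ = build (All.lookup G.multiple q∈)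
      where
      build : (∃[ z ] q ≡ fromℤ z ℚ.* G.g) → ratK q ∈ [ ratK G.g , β ]
      build (z , q≡) = resp [ ratK G.g , β ] (sym (trans (cong ratK q≡) (ratK-* (fromℤ z) G.g))) (Λ.*-clos z Λ.left)
    restore : ∀ u {y} → y + intK (ℤ.- u) * β ∈ [ ratK G.g , β ] → y ∈ [ ratK G.g , β ]
    restore u {y} y∈ = resp [ ratK G.g , β ] (trans
        (cong (λ t → (y + t * β) + intK u * β) (intK-neg u))
        (solve 3 (λ y u β → (y :+ (:- u) :* β) :+ u :* β := y) refl y (intK u) β))
      (Λ.+-clos y∈ (Λ.*-clos u Λ.right))
    x∈ : x ∈ [ ratK G.g , β ]
    x∈ = restore C.u (resp [ ratK G.g , β ] (real imρ) (rational (here refl)))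
    old⊆ : [ ratK B.a , B.β ] ⊆ [ ratK G.g , β ]
    old⊆ = Λ.span-⊆ (rational (there (there (here refl))))
      (restore C.v (resp [ ratK G.g , β ] (real imσ) (rational (there (here refl)))))
    combo : ∀ {P} → Subgroup P → All P (x ∷ xs) → P (ratK G.g) × P β
    combo {P} P-sub (Px ∷ Pxs) = G.combo (λ q → P (ratK q)) P.0∈
        (λ {p} {q} Pp Pq → subst P (sym (ratK-+ p q)) (P.+-clos Pp Pq))
        (λ z {q} Pq → subst P (sym (ratK-* (fromℤ z) q)) (P.*-clos z Pq))
        ( subst P (sym (real imρ)) (P.+-clos Px (P.*-clos (ℤ.- C.u) Pβ))
        ∷ subst P (sym (real imσ)) (P.+-clos (proj₂ old) (P.*-clos (ℤ.- C.v) Pβ))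
        ∷ proj₁ old ∷ []) , Pβ
      where
      module P = Subgroup P-sub
      old = B.combo P-sub Pxs
      Pβ : P β
      Pβ = P.+-clos (P.*-clos C.x Px) (P.*-clos C.y (proj₂ old))

  -- Because 𝒪 = ℤ + ℤτ, the ideal is generated as a group by its generators g together with the
  -- products τg.
  lattice-basis : ∀ {I} → IsFractionalIdeal I → ∃[ α ] ∃[ β ] α ∈ I × β ∈ I × I ⊆ [ α , β ]
  lattice-basis {I} fI = ratK B.a , B.β , proj₁ members , proj₂ members , λ x∈ → span⊆ I.generators (λ g∈ → g∈) (I.generated x∈)
    where
    module I = IsFractionalIdeal fI
    xs : List K
    xs = I.generators ++ map (τ *_) I.generators
    module B = Basis (basis xs)
    members = B.combo (submodule⇒subgroup I.isSubmodule)
      (All.++⁺ I.generators∈ (All.map⁺ (All.map (λ g∈ → I.*-clos τ τ∈𝒪 g∈) I.generators∈)))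
    module Λ = Lattice (ratK B.a) B.β
    both : ∀ {g} → g ∈ˡ I.generators → g ∈ [ ratK B.a , B.β ] × τ * g ∈ [ ratK B.a , B.β ]
    both g∈ = All.lookup (All.++⁻ˡ I.generators B.spans) g∈ , All.lookup (All.map⁻ (All.++⁻ʳ I.generators B.spans)) g∈
    span⊆ : ∀ gs → (∀ {g} → g ∈ˡ gs → g ∈ˡ I.generators) → Span gs ⊆ [ ratK B.a , B.β ]
    span⊆ [] _ [] = Λ.0∈
    span⊆ (g ∷ gs) sub (comb a a∈ s) = Λ.+-clos (scaled (𝒪-coords a∈) (both (sub (here refl)))) (span⊆ gs (λ g∈ → sub (there g∈)) s)
      where
      scaled : (∃[ r ] ∃[ t ] a ≡ intK r + intK t * τ) → g ∈ [ ratK B.a , B.β ] × τ * g ∈ [ ratK B.a , B.β ] → a * g ∈ [ ratK B.a , B.β ]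
      scaled (r , t , a≡) (g∈ , τg∈) = resp [ ratK B.a , B.β ]
        (trans (solve 4 (λ r t τ g → r :* g :+ t :* (τ :* g) := (r :+ t :* τ) :* g) refl (intK r) (intK t) τ g) (cong (_* g) (sym a≡)))
        (Λ.combination r t g∈ τg∈)

  [,]-swap : ∀ {α β} → [ α , β ] ⊆ [ β , α ]
  [,]-swap {α} {β} (r , s , x≡) = s , r , trans x≡ (+-comm (intK r * α) (intK s * β))

  -- A relation r α + s β = 0 with s ≠ 0 puts s I into ℤα, and multiplication by τ would make τ rational.
  independentʳ : ∀ {I α β} → IsFractionalIdeal I → I ⊆ [ α , β ] → ∀ r s → intK r * α + intK s * β ≡ 0# → s ≡ 0ℤ
  independentʳ {I} {α} {β} fI I⊆ r s rel = decide (s ℤ.≟ 0ℤ)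
    where
    module I = IsFractionalIdeal fI
    open ≡-Reasoning
    multiple : ∀ {x} → x ∈ [ α , β ] → ∃[ k ] intK s * x ≡ intK k * α
    multiple {x} (a , b , x≡) = s ℤ.* a ℤ.- r ℤ.* b , (begin
      intK s * x
        ≡⟨ cong (intK s *_) x≡ ⟩
      intK s * (intK a * α + intK b * β)
        ≡⟨ solve 6 (λ r s a b α β → s :* (a :* α :+ b :* β) := (s :* a :- r :* b) :* α :+ b :* (r :* α :+ s :* β)) refl (intK r) (intK s) (intK a) (intK b) α β ⟩
      (intK s * intK a - intK r * intK b) * α + intK b * (intK r * α + intK s * β)
        ≡⟨ cong (λ t → (intK s * intK a - intK r * intK b) * α + intK b * t) rel ⟩
      (intK s * intK a - intK r * intK b) * α + intK b * 0#
        ≡⟨ solve 3 (λ c α b → c :* α :+ b :* con 0ℤ := c :* α) refl (intK s * intK a - intK r * intK b) α (intK b) ⟩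
      (intK s * intK a - intK r * intK b) * α
        ≡⟨ cong (_* α) (trans (cong₂ _-_ (sym (intK-* s a)) (sym (intK-* r b))) (sym (intK-minus (s ℤ.* a) (r ℤ.* b)))) ⟩
      intK (s ℤ.* a ℤ.- r ℤ.* b) * α ∎)
    decide : Dec (s ≡ 0ℤ) → s ≡ 0ℤ
    decide (yes s≡0) = s≡0
    decide (no s≢0)  = ⊥-elim (contradict I.nonzero)
      where
      contradict : ¬ (∃[ x ] x ∈ I × x ≢ 0#)
      contradict (x , x∈ , x≢0) = sx≢0 (begin
        intK s * x     ≡⟨ proj₂ kα ⟩
        intK k * α     ≡⟨ cong (λ k → intK k * α) k≡0 ⟩
        0# * α         ≡⟨ zeroˡ α ⟩
        0#             ∎)
        where
        kα = multiple (I⊆ x∈)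
        lα = multiple (I⊆ (I.*-clos τ τ∈𝒪 x∈))
        k = proj₁ kα
        l = proj₁ lα
        sx≢0 : intK s * x ≢ 0#
        sx≢0 eq = x≢0 (*-cancel (intK s) x eq (intK≢0 s≢0))
        -- From sx = kα and s(τx) = lα follows (kτ - l)·sx = 0 with sx ≠ 0, and 1, τ are
        -- independent.
        k≡0 : k ≡ 0ℤ
        k≡0 = proj₂ (1,τ-independent (ℤ.- l) k (*-cancel (intK s * x) (intK (ℤ.- l) + intK k * τ) (begin
          intK s * x * (intK (ℤ.- l) + intK k * τ)
            ≡⟨ cong (λ t → intK s * x * (t + intK k * τ)) (intK-neg l) ⟩
          intK s * x * (- intK l + intK k * τ)
            ≡⟨ solve 5 (λ s x l k t → s :* x :* (:- l :+ k :* t) := k :* (s :* (t :* x)) :- l :* (s :* x)) refl (intK s) x (intK l) (intK k) τ ⟩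
          intK k * (intK s * (τ * x)) - intK l * (intK s * x)
            ≡⟨ cong₂ (λ p q → intK k * p - intK l * q) (proj₂ lα) (proj₂ kα) ⟩
          intK k * (intK l * α) - intK l * (intK k * α)
            ≡⟨ solve 3 (λ k l α → k :* (l :* α) :- l :* (k :* α) := con 0ℤ) refl (intK k) (intK l) α ⟩
          0# ∎) sx≢0))

  independent : ∀ {I α β} → IsFractionalIdeal I → I ⊆ [ α , β ] → ∀ r s → intK r * α + intK s * β ≡ 0# → r ≡ 0ℤ × s ≡ 0ℤ
  independent {α = α} {β} fI I⊆ r s rel =
      independentʳ fI (λ x∈ → [,]-swap {α} {β} (I⊆ x∈)) s r (trans (+-comm (intK s * β) (intK r * α)) rel)
    , independentʳ fI I⊆ r s rel

  unique-coords : ∀ {I α β} → IsFractionalIdeal I → I ⊆ [ α , β ] → ∀ r s r′ s′ →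
    intK r * α + intK s * β ≡ intK r′ * α + intK s′ * β → r ≡ r′ × s ≡ s′
  unique-coords {α = α} {β} fI I⊆ r s r′ s′ eq = ℤ.i-j≡0⇒i≡j r r′ (proj₁ both) , ℤ.i-j≡0⇒i≡j s s′ (proj₂ both)
    where
    both = independent fI I⊆ (r ℤ.- r′) (s ℤ.- s′) (trans
      (cong₂ (λ a b → a * α + b * β) (intK-minus r r′) (intK-minus s s′))
      (trans (solve 6 (λ r s r′ s′ α β → (r :- r′) :* α :+ (s :- s′) :* β := (r :* α :+ s :* β) :- (r′ :* α :+ s′ :* β)) refl
          (intK r) (intK s) (intK r′) (intK s′) α β)
        (x≡y⇒x-y≡0 eq)))

  -- A basis ν, μ adapted to N

  intK-*+* : ∀ a b c d → intK (a ℤ.* b ℤ.+ c ℤ.* d) ≡ intK a * intK b + intK c * intK d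
  intK-*+* a b c d = trans (intK-+ (a ℤ.* b) (c ℤ.* d)) (cong₂ _+_ (intK-* a b) (intK-* c d))

  module BasisReduction {J : Pred K 0ℓ} (J-fractional : IsFractionalIdeal J) (N : ℕ) where
    private module J = IsFractionalIdeal J-fractional

    -- Multiplying 1 = kνh + wN by ν gives ν = k(hν²) + N(wν), in which hν² and wν both lie in J;
    -- the coefficients of ν are compared.
    content-coprime : ∀ {ν μ h w} k → J ⊆ [ ν , μ ] → ν ∈ J → h ∈ J ⁻¹ᴵ → w ∈ 𝒪 →
      1# - intK k * ν * h ≡ w * intK (+ N) → ∃[ p ] ∃[ q ] k ℤ.* p ℤ.+ + N ℤ.* q ≡ 1ℤ
    content-coprime {ν} {μ} {h} {w} k J⊆ ν∈ h∈ w∈ eq =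
      build (J⊆ (J.*-clos (h * ν) (h∈ ν ν∈) ν∈)) (J⊆ (J.*-clos w w∈ ν∈))
      where
      open ≡-Reasoning
      build : h * ν * ν ∈ [ ν , μ ] → w * ν ∈ [ ν , μ ] → ∃[ p ] ∃[ q ] k ℤ.* p ℤ.+ + N ℤ.* q ≡ 1ℤ
      build (p , p′ , P≡) (q , q′ , Q≡) = p , q , proj₁ (unique-coords J-fractional J⊆ (k ℤ.* p ℤ.+ + N ℤ.* q) (k ℤ.* p′ ℤ.+ + N ℤ.* q′) 1ℤ 0ℤ (begin
        intK (k ℤ.* p ℤ.+ + N ℤ.* q) * ν + intK (k ℤ.* p′ ℤ.+ + N ℤ.* q′) * μ
          ≡⟨ cong₂ (λ a b → a * ν + b * μ) (intK-*+* k p (+ N) q) (intK-*+* k p′ (+ N) q′) ⟩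
        (intK k * intK p + intK (+ N) * intK q) * ν + (intK k * intK p′ + intK (+ N) * intK q′) * μ
          ≡⟨ solve 8 (λ k n p q p′ q′ ν μ → (k :* p :+ n :* q) :* ν :+ (k :* p′ :+ n :* q′) :* μ := k :* (p :* ν :+ p′ :* μ) :+ n :* (q :* ν :+ q′ :* μ)) refl
               (intK k) (intK (+ N)) (intK p) (intK q) (intK p′) (intK q′) ν μ ⟩
        intK k * (intK p * ν + intK p′ * μ) + intK (+ N) * (intK q * ν + intK q′ * μ)
          ≡⟨ cong₂ (λ a b → intK k * a + intK (+ N) * b) (sym P≡) (sym Q≡) ⟩
        intK k * (h * ν * ν) + intK (+ N) * (w * ν)
          ≡⟨ solve 5 (λ k n h w ν → k :* (h :* ν :* ν) :+ n :* (w :* ν) := k :* (h :* ν :* ν) :+ (w :* n) :* ν) refl (intK k) (intK (+ N)) h w ν ⟩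
        intK k * (h * ν * ν) + (w * intK (+ N)) * ν
          ≡⟨ cong (λ t → intK k * (h * ν * ν) + t * ν) (sym eq) ⟩
        intK k * (h * ν * ν) + (1# - intK k * ν * h) * ν
          ≡⟨ solve 4 (λ k h ν μ → k :* (h :* ν :* ν) :+ (con 1ℤ :- k :* ν :* h) :* ν := con 1ℤ :* ν :+ con 0ℤ :* μ) refl (intK k) h ν μ ⟩
        1# * ν + 0# * μ ∎))

    -- Multiplying 1 = νh + wN by μ gives μ = (hμ)ν + N(wμ). Since hμ = r + sτ is integral and τν =
    -- uν + aμ, the coefficient of μ in (hμ)ν is as, and comparing coefficients of μ yields the
    -- relation.
    index-coprime : ∀ {ν μ h w} u a → J ⊆ [ ν , μ ] → μ ∈ J → h ∈ J ⁻¹ᴵ → w ∈ 𝒪 → τ * ν ≡ intK u * ν + intK a * μ →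
      1# - ν * h ≡ w * intK (+ N) → ∃[ p ] ∃[ q ] a ℤ.* p ℤ.+ + N ℤ.* q ≡ 1ℤ
    index-coprime {ν} {μ} {h} {w} u a J⊆ μ∈ h∈ w∈ τν≡ eq = build (𝒪-coords (h∈ μ μ∈)) (J⊆ (J.*-clos w w∈ μ∈))
      where
      open ≡-Reasoning
      build : (∃[ r ] ∃[ s ] h * μ ≡ intK r + intK s * τ) → w * μ ∈ [ ν , μ ] → ∃[ p ] ∃[ q ] a ℤ.* p ℤ.+ + N ℤ.* q ≡ 1ℤ
      build (r , s , hμ≡) (c , d , wμ≡) = s , d , proj₂ (unique-coords J-fractional J⊆
        (r ℤ.* 1ℤ ℤ.+ s ℤ.* u ℤ.+ + N ℤ.* c) (a ℤ.* s ℤ.+ + N ℤ.* d) 0ℤ 1ℤ (begin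
          intK (r ℤ.* 1ℤ ℤ.+ s ℤ.* u ℤ.+ + N ℤ.* c) * ν + intK (a ℤ.* s ℤ.+ + N ℤ.* d) * μ
            ≡⟨ cong₂ (λ x y → x * ν + y * μ) (trans (intK-+ (r ℤ.* 1ℤ ℤ.+ s ℤ.* u) (+ N ℤ.* c)) (cong₂ _+_ (intK-*+* r 1ℤ s u) (intK-* (+ N) c))) (intK-*+* a s (+ N) d) ⟩
          (intK r * 1# + intK s * intK u + intK (+ N) * intK c) * ν + (intK a * intK s + intK (+ N) * intK d) * μ
            ≡⟨ regroup (intK r) (intK s) (intK u) (intK a) (intK (+ N)) (intK c) (intK d) ⟩
          intK r * ν + intK s * (intK u * ν + intK a * μ) + intK (+ N) * (intK c * ν + intK d * μ)
            ≡⟨ cong₂ (λ x y → intK r * ν + intK s * x + intK (+ N) * y) (sym τν≡) (sym wμ≡) ⟩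
          intK r * ν + intK s * (τ * ν) + intK (+ N) * (w * μ)
            ≡⟨ solve 7 (λ r s t ν n w μ → r :* ν :+ s :* (t :* ν) :+ n :* (w :* μ) := ν :* (r :+ s :* t) :+ (w :* n) :* μ) refl (intK r) (intK s) τ ν (intK (+ N)) w μ ⟩
          ν * (intK r + intK s * τ) + (w * intK (+ N)) * μ
            ≡⟨ cong₂ (λ x y → ν * x + y * μ) (sym hμ≡) (sym eq) ⟩
          ν * (h * μ) + (1# - ν * h) * μ
            ≡⟨ solve 3 (λ h ν μ → ν :* (h :* μ) :+ (con 1ℤ :- ν :* h) :* μ := con 0ℤ :* ν :+ con 1ℤ :* μ) refl h ν μ ⟩
          0# * ν + 1# * μ ∎))
        where
        regroup : ∀ r s u a n c d → (r * 1# + s * u + n * c) * ν + (a * s + n * d) * μ ≡ r * ν + s * (u * ν + a * μ) + n * (c * ν + d * μ)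
        regroup r s u a n c d = solve 9 (λ r s u a n c d ν μ → (r :* con 1ℤ :+ s :* u :+ n :* c) :* ν :+ (a :* s :+ n :* d) :* μ
          := r :* ν :+ s :* (u :* ν :+ a :* μ) :+ n :* (c :* ν :+ d :* μ)) refl r s u a n c d ν μ

    -- Storing a - 1 as a natural number makes a positive by construction. The field `shift` keeps ν
    -- in ν₀ + NJ, so that a congruence of ν₀ modulo 𝔫 passes to ν when J is integral.
    record ReducedBasis (ν₀ : K) : Set where
      field
        {ν μ}     : K
        ν∈        : ν ∈ J
        μ∈        : μ ∈ J
        J⊆        : J ⊆ [ ν , μ ]
        shift     : ∃[ j ] j ∈ J × ν ≡ ν₀ + intK (+ N) * j
        ν≢0       : ν ≢ 0#
        u         : ℤ
        a-1       : ℕ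
        τν≡       : τ * ν ≡ intK u * ν + intK (+ suc a-1) * μ
        a-coprime : ∃[ p ] ∃[ q ] + suc a-1 ℤ.* p ℤ.+ + N ℤ.* q ≡ 1ℤ

    -- The value a = 0 would give τν = uν, against the independence of 1 and τ; a negative a is made
    -- positive by replacing μ with its negative.
    orient : ∀ {ν₀ ν μ} u a → ν ∈ J → μ ∈ J → J ⊆ [ ν , μ ] → (∃[ j ] j ∈ J × ν ≡ ν₀ + intK (+ N) * j) → ν ≢ 0# →
      τ * ν ≡ intK u * ν + intK a * μ → (∃[ p ] ∃[ q ] a ℤ.* p ℤ.+ + N ℤ.* q ≡ 1ℤ) → ReducedBasis ν₀
    orient u (+ suc n) ν∈ μ∈ J⊆ shift ν≢0 τν≡ cop = record
      { ν∈ = ν∈ ; μ∈ = μ∈ ; J⊆ = J⊆ ; shift = shift ; ν≢0 = ν≢0 ; u = u ; a-1 = n ; τν≡ = τν≡ ; a-coprime = cop }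
    orient {ν = ν} {μ} u (+ 0) ν∈ μ∈ J⊆ shift ν≢0 τν≡ cop = ⊥-elim (1≢0ℤ (proj₂ (1,τ-independent (ℤ.- u) 1ℤ (*-cancel ν (intK (ℤ.- u) + 1# * τ) (begin
      ν * (intK (ℤ.- u) + 1# * τ)         ≡⟨ cong (λ t → ν * (t + 1# * τ)) (intK-neg u) ⟩
      ν * (- intK u + 1# * τ)             ≡⟨ solve 3 (λ ν u t → ν :* (:- u :+ con 1ℤ :* t) := t :* ν :- u :* ν) refl ν (intK u) τ ⟩
      τ * ν - intK u * ν                  ≡⟨ cong (_- intK u * ν) τν≡ ⟩
      intK u * ν + 0# * μ - intK u * ν    ≡⟨ solve 2 (λ x μ → x :+ con 0ℤ :* μ :- x := con 0ℤ) refl (intK u * ν) μ ⟩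
      0#                                  ∎) ν≢0))))
      where
      open ≡-Reasoning
      1≢0ℤ : 1ℤ ≢ 0ℤ
      1≢0ℤ ()
    orient {ν = ν} {μ} u a@(-[1+ n ]) ν∈ μ∈ J⊆ shift ν≢0 τν≡ (p , q , eq) = record
      { ν∈ = ν∈ ; μ∈ = J.*-clos (intK ℤ.-1ℤ) (𝒪-intK ℤ.-1ℤ) μ∈ ; J⊆ = λ x∈ → flip (J⊆ x∈) ; shift = shift ; ν≢0 = ν≢0 ; u = u ; a-1 = n
      ; τν≡ = trans τν≡ (cong (λ t → intK u * ν + t) (trans (cong (_* μ) (intK-neg (+ suc n)))
          (solve 2 (λ a μ → (:- a) :* μ := a :* (con ℤ.-1ℤ :* μ)) refl (intK (+ suc n)) μ)))
      ; a-coprime = ℤ.- p , q , trans (ℤS.solve 4 (λ a p n q → a ℤS.:* (ℤS.:- p) ℤS.:+ n ℤS.:* q ℤS.:= (ℤS.:- a) ℤS.:* p ℤS.:+ n ℤS.:* q) refl (+ suc n) p (+ N) q) eq }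
      where
      flip : ∀ {x} → x ∈ [ ν , μ ] → x ∈ [ ν , intK ℤ.-1ℤ * μ ]
      flip (r , s , x≡) = r , ℤ.- s , trans x≡ (trans
        (solve 4 (λ r s ν μ → r :* ν :+ s :* μ := r :* ν :+ (:- s) :* (con ℤ.-1ℤ :* μ)) refl (intK r) (intK s) ν μ)
        (cong (λ t → intK r * ν + t * (intK ℤ.-1ℤ * μ)) (sym (intK-neg s))))

    -- Writing ν₀ = k ν₁ with ν₁ primitive, k is prime to N, so that k ν₁ + N μ₁ is primitive.
    reduced-basis : ∀ {ν₀ h w} → ν₀ ∈ J → h ∈ J ⁻¹ᴵ → w ∈ 𝒪 → 1# - ν₀ * h ≡ w * intK (+ N) → ReducedBasis ν₀
    reduced-basis {ν₀} {h} {w} ν₀∈ h∈ w∈ eq = fromBasis (lattice-basis J-fractional)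
      where
      open ≡-Reasoning
      combination∈ : ∀ r s {x y} → x ∈ J → y ∈ J → intK r * x + intK s * y ∈ J
      combination∈ r s x∈ y∈ = J.+-clos (J.*-clos (intK r) (𝒪-intK r) x∈) (J.*-clos (intK s) (𝒪-intK s) y∈)
      fromPrimitive : ∀ {ν₁ μ₁} k → ν₁ ∈ J → μ₁ ∈ J → J ⊆ [ ν₁ , μ₁ ] → ν₀ ≡ intK k * ν₁ →
        (∃[ p ] ∃[ q ] k ℤ.* p ℤ.+ + N ℤ.* q ≡ 1ℤ) → ReducedBasis ν₀
      fromPrimitive {ν₁} {μ₁} k ν₁∈ μ₁∈ J⊆₁ ν₀≡ (p , q , kp+Nq≡1) = finish (J⊆ (J.*-clos τ τ∈𝒪 ν∈))
        where
        ν μ : K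
        ν = intK k * ν₁ + intK (+ N) * μ₁
        -- The row (-q, p) completes (k, N) to an integer matrix of determinant kp + Nq = 1.
        μ = intK (ℤ.- q) * ν₁ + intK p * μ₁
        ν∈ = combination∈ k (+ N) ν₁∈ μ₁∈
        μ∈ = combination∈ (ℤ.- q) p ν₁∈ μ₁∈
        J⊆ : J ⊆ [ ν , μ ]
        J⊆ x∈ = unimodular-⊆ k (+ N) (ℤ.- q) p (trans
          (ℤS.solve 4 (λ k p n q → k ℤS.:* p ℤS.:- n ℤS.:* (ℤS.:- q) ℤS.:= k ℤS.:* p ℤS.:+ n ℤS.:* q) refl k p (+ N) q) kp+Nq≡1) (J⊆₁ x∈)
        ν≢0 : ν ≢ 0#
        ν≢0 ν≡0 = 1≢0ℤ (proj₁ (independent J-fractional J⊆ 1ℤ 0ℤ (trans (solve 2 (λ ν μ → con 1ℤ :* ν :+ con 0ℤ :* μ := ν) refl ν μ) ν≡0)))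
          where
          1≢0ℤ : 1ℤ ≢ 0ℤ
          1≢0ℤ ()
        -- Passing from ν₀ to ν = ν₀ + Nμ₁ changes νh by N(hμ₁), and hμ₁ is integral, so h stays an
        -- inverse modulo N.
        1-νh : 1# - ν * h ≡ (w - h * μ₁) * intK (+ N)
        1-νh = begin
          1# - (intK k * ν₁ + intK (+ N) * μ₁) * h
            ≡⟨ cong (λ t → 1# - (t + intK (+ N) * μ₁) * h) (sym ν₀≡) ⟩
          1# - (ν₀ + intK (+ N) * μ₁) * h
            ≡⟨ solve 4 (λ ν n μ h → con 1ℤ :- (ν :+ n :* μ) :* h := (con 1ℤ :- ν :* h) :- h :* μ :* n) refl ν₀ (intK (+ N)) μ₁ h ⟩
          (1# - ν₀ * h) - h * μ₁ * intK (+ N)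
            ≡⟨ cong (_- h * μ₁ * intK (+ N)) eq ⟩
          w * intK (+ N) - h * μ₁ * intK (+ N)
            ≡⟨ solve 3 (λ w hμ n → w :* n :- hμ :* n := (w :- hμ) :* n) refl w (h * μ₁) (intK (+ N)) ⟩
          (w - h * μ₁) * intK (+ N) ∎
        finish : τ * ν ∈ [ ν , μ ] → ReducedBasis ν₀
        finish (u , a , τν≡) = orient u a ν∈ μ∈ J⊆ (μ₁ , μ₁∈ , cong (_+ intK (+ N) * μ₁) (sym ν₀≡)) ν≢0 τν≡
          (index-coprime u a J⊆ μ∈ h∈ (𝒪-minus w (h * μ₁) w∈ (h∈ μ₁ μ₁∈)) τν≡ 1-νh)
      fromBasis : (∃[ α ] ∃[ β ] α ∈ J × β ∈ J × J ⊆ [ α , β ]) → ReducedBasis ν₀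
      fromBasis (α , β , α∈ , β∈ , J⊆₀) = coordinates₀ (J⊆₀ ν₀∈)
        where
        coordinates₀ : ν₀ ∈ [ α , β ] → ReducedBasis ν₀
        coordinates₀ (x , y , ν₀≡) = content (bezout x y)
          where
          content : (∃[ k ] ∃[ u ] ∃[ v ] ∃[ X ] ∃[ Y ] x ≡ u ℤ.* k × y ≡ v ℤ.* k × u ℤ.* X ℤ.+ v ℤ.* Y ≡ 1ℤ) → ReducedBasis ν₀
          content (k , u , v , X , Y , x≡ , y≡ , det) =
            fromPrimitive k ν₁∈ (combination∈ (ℤ.- Y) X α∈ β∈) J⊆₁ ν₀≡kν₁ (content-coprime k J⊆₁ ν₁∈ h∈ w∈ (trans (cong (λ t → 1# - t * h) (sym ν₀≡kν₁)) eq))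
            where
            ν₁ : K
            ν₁ = intK u * α + intK v * β
            ν₁∈ : ν₁ ∈ J
            ν₁∈ = combination∈ u v α∈ β∈
            J⊆₁ : J ⊆ [ ν₁ , intK (ℤ.- Y) * α + intK X * β ]
            J⊆₁ x∈ = unimodular-⊆ u v (ℤ.- Y) X (trans
              (ℤS.solve 4 (λ u v X Y → u ℤS.:* X ℤS.:- v ℤS.:* (ℤS.:- Y) ℤS.:= u ℤS.:* X ℤS.:+ v ℤS.:* Y) refl u v X Y) det) (J⊆₀ x∈)
            ν₀≡kν₁ : ν₀ ≡ intK k * ν₁
            ν₀≡kν₁ = begin
              ν₀                                                    ≡⟨ ν₀≡ ⟩
              intK x * α + intK y * β                               ≡⟨ cong₂ (λ s t → s * α + t * β) (trans (cong intK x≡) (intK-* u k)) (trans (cong intK y≡) (intK-* v k)) ⟩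
              intK u * intK k * α + intK v * intK k * β             ≡⟨ solve 5 (λ u v k α β → u :* k :* α :+ v :* k :* β := k :* (u :* α :+ v :* β)) refl (intK u) (intK v) (intK k) α β ⟩
              intK k * (intK u * α + intK v * β)                    ∎

  -- Forms of discriminant dK and their lattices

  dK<0 : ∃[ e ] dK ≡ -[1+ e ]
  dK<0 = negative m m<0 conductor (conductor-square conductor-cases)
    where
    conductor-square : (conductor ≡ 1ℤ × ∃[ k ] m ≡ + 4 ℤ.* k ℤ.+ 1ℤ) ⊎ (conductor ≡ + 2 × ∀ k → m ≢ + 4 ℤ.* k ℤ.+ 1ℤ) →
      ∃[ k ] conductor ℤ.* conductor ≡ + suc k
    conductor-square (inj₁ (f≡1 , _)) = 0 , cong (λ f → f ℤ.* f) f≡1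
    conductor-square (inj₂ (f≡2 , _)) = 3 , cong (λ f → f ℤ.* f) f≡2
    negative : ∀ m → m ℤ.< 0ℤ → ∀ f → (∃[ k ] f ℤ.* f ≡ + suc k) → ∃[ e ] f ℤ.* f ℤ.* m ≡ -[1+ e ]
    negative -[1+ n ] _ f (k , f²≡) = _ , cong (ℤ._* -[1+ n ]) f²≡
    negative (+ n) (ℤ.+<+ ()) f _

  -- Every element of 𝒪 is r + sτ, so stability under τ, tested on the two generators, is all that
  -- has to be checked.
  lattice-submodule : ∀ {α β} → τ * α ∈ [ α , β ] → τ * β ∈ [ α , β ] → IsSubmodule [ α , β ]
  lattice-submodule {α} {β} τα∈ τβ∈ = record { 0∈ = Λ.0∈ ; +-clos = Λ.+-clos ; *-clos = λ a a∈ x∈ → scale (𝒪-coords a∈) x∈ }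
    where
    module Λ = Lattice α β
    scale : ∀ {a x} → (∃[ r ] ∃[ s ] a ≡ intK r + intK s * τ) → x ∈ [ α , β ] → a * x ∈ [ α , β ]
    scale {a} {x} (r , s , a≡) x∈@(p , q , x≡) = resp [ α , β ] (trans
        (solve 4 (λ r s t x → r :* x :+ s :* (t :* x) := (r :+ s :* t) :* x) refl (intK r) (intK s) τ x) (cong (_* x) (sym a≡)))
      (Λ.combination r s x∈ (resp [ α , β ] (trans
        (solve 5 (λ p q t α β → p :* (t :* α) :+ q :* (t :* β) := t :* (p :* α :+ q :* β)) refl (intK p) (intK q) τ α β) (cong (τ *_) (sym x≡)))
        (Λ.combination p q τα∈ τβ∈)))

  lattice-fractional : ∀ {α β} → β ≢ 0# → τ * α ∈ [ α , β ] → τ * β ∈ [ α , β ] → IsFractionalIdeal [ α , β ]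
  lattice-fractional {α} {β} β≢0 τα∈ τβ∈ = record
    { isSubmodule = lattice-submodule τα∈ τβ∈
    ; generators  = α ∷ β ∷ []
    ; generators∈ = Lattice.left α β ∷ Lattice.right α β ∷ []
    ; generated   = λ { (r , s , x≡) → resp (Span (α ∷ β ∷ []))
        (trans (cong (λ t → intK r * α + t) (+-identityʳ (intK s * β))) (sym x≡)) (comb (intK r) (𝒪-intK r) (comb (intK s) (𝒪-intK s) [])) }
    ; nonzero     = β , Lattice.right α β , β≢0
    }

  -- Both sides are (-b + √dK)/2. The inverse of 2a enters as a variable r with 2ar = 1, so the
  -- division inside `ω` is never unfolded.
  root-relation : ∀ a b u r → fromℤ (+ 2 ℤ.* a) ℚ.* r ≡ 1ℚ → b ℤ.+ dK ≡ + 2 ℤ.* u →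
    intK a * ((intK (ℤ.- b) + √dK) * ratK r) ≡ τ - intK u
  root-relation a b u r inv b+D≡2u = *-cancelˡ (intK (+ 2)) (intK≢0 λ ()) (begin
    intK (+ 2) * (intK a * ((intK (ℤ.- b) + √dK) * ratK r))
      ≡⟨ rearrange (intK (+ 2)) (intK a) (intK (ℤ.- b) + √dK) (ratK r) ⟩
    (intK (ℤ.- b) + √dK) * ((intK (+ 2) * intK a) * ratK r)
      ≡⟨ cong ((intK (ℤ.- b) + √dK) *_) (trans (cong (_* ratK r) (sym (intK-* (+ 2) a))) (trans (sym (ratK-* (fromℤ (+ 2 ℤ.* a)) r)) (cong ratK inv))) ⟩
    (intK (ℤ.- b) + √dK) * 1#
      ≡⟨ *-identityʳ _ ⟩
    intK (ℤ.- b) + √dK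
      ≡⟨ cong (λ t → intK t + √dK) (trans (ℤS.solve 2 (λ b D → ℤS.:- b ℤS.:= D ℤS.:- (b ℤS.:+ D)) refl b dK) (cong (λ t → dK ℤ.- t) b+D≡2u)) ⟩
    intK (dK ℤ.- + 2 ℤ.* u) + √dK
      ≡⟨ cong (_+ √dK) (trans (intK-minus dK (+ 2 ℤ.* u)) (cong (λ t → intK dK - t) (intK-* (+ 2) u))) ⟩
    intK dK - intK (+ 2) * intK u + √dK
      ≡⟨ shuffle (intK dK) (intK (+ 2) * intK u) √dK ⟩
    (intK dK + √dK) - intK (+ 2) * intK u
      ≡⟨ cong (_- intK (+ 2) * intK u) (sym 2τ≡) ⟩
    intK (+ 2) * τ - intK (+ 2) * intK u
      ≡⟨ factor (intK (+ 2)) τ (intK u) ⟩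
    intK (+ 2) * (τ - intK u) ∎)
    where
    open ≡-Reasoning
    rearrange : ∀ t a x r → t * (a * (x * r)) ≡ x * ((t * a) * r)
    rearrange = solve 4 (λ t a x r → t :* (a :* (x :* r)) := x :* ((t :* a) :* r)) refl
    shuffle : ∀ d u s → d - u + s ≡ (d + s) - u
    shuffle = solve 3 (λ d u s → d :- u :+ s := (d :+ s) :- u) refl
    factor : ∀ t x u → t * x - t * u ≡ t * (x - u)
    factor = solve 3 (λ t x u → t :* x :- t :* u := t :* (x :- u)) refl

  intK-ac : ∀ a c u → a ℤ.* c ≡ u ℤ.* u ℤ.- u ℤ.* dK ℤ.+ n₀ → intK a * intK c ≡ intK u * intK u - intK u * intK dK + intK n₀
  intK-ac a c u ac≡ = trans (sym (intK-* a c)) (trans (cong intK ac≡)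
    (trans (intK-+ (u ℤ.* u ℤ.- u ℤ.* dK) n₀) (cong (_+ intK n₀)
      (trans (intK-minus (u ℤ.* u) (u ℤ.* dK)) (cong₂ _-_ (intK-* u u) (intK-* u dK))))))

  module FormLattice {N : ℕ} (Q : 𝒬 N dK) where
    open 𝒬 Q

    a≢0 : intK a ≢ 0#
    a≢0 a≡0 = 2a≢0 (trans (fromℤ-* (+ 2) a) (trans (cong (fromℤ (+ 2) ℚ.*_) (cong K.re a≡0)) (ℚ.*-zeroʳ (fromℤ (+ 2)))))

    aω : ∀ u → b ℤ.+ dK ≡ + 2 ℤ.* u → intK a * ω Q ≡ τ - intK u
    aω u = root-relation a b u _ (ℚ.*-inverseʳ (fromℤ (+ 2 ℤ.* a)) ⦃ ℚ.≢-nonZero 2a≢0 ⦄)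

    private
      half = half-trace {dK} {n₀} a b c discriminant≡ 4n₀≡
      u = proj₁ half
      aω≡ : intK a * ω Q ≡ τ - intK u
      aω≡ = aω u (proj₁ (proj₂ half))
      -- The norm of τ - u being ac, one has a(τw) = τ(τ - u) = (dK - u)(τ - u) - ac, hence τw = (dK
      -- - u)w - c. A variable w keeps the explicit quotient `ω Q` out of the computation.
      generic : ∀ w → intK a * w ≡ τ - intK u → τ * w ∈ [ w , 1# ] × τ * 1# ∈ [ w , 1# ]
      generic w aw≡ = (dK ℤ.- u , ℤ.- c , *-cancelˡ (intK a) a≢0 (begin
          intK a * (τ * w)
            ≡⟨ solve 3 (λ a t w → a :* (t :* w) := t :* (a :* w)) refl (intK a) τ w ⟩
          τ * (intK a * w)
            ≡⟨ cong (τ *_) aw≡ ⟩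
          τ * (τ - intK u)
            ≡⟨ solve 2 (λ t u → t :* (t :- u) := t :* t :- t :* u) refl τ (intK u) ⟩
          τ * τ - τ * intK u
            ≡⟨ cong (_- τ * intK u) τ*τ ⟩
          (intK dK * τ - intK n₀) - τ * intK u
            ≡⟨ vieta (intK dK) τ (intK n₀) (intK u) ⟩
          (intK dK - intK u) * (τ - intK u) - (intK u * intK u - intK u * intK dK + intK n₀)
            ≡⟨ cong₂ (λ s t → (intK dK - intK u) * s - t) (sym aw≡) (sym (intK-ac a c u (proj₂ (proj₂ half)))) ⟩
          (intK dK - intK u) * (intK a * w) - intK a * intK c
            ≡⟨ solve 4 (λ d a w c → d :* (a :* w) :- a :* c := a :* (d :* w :+ (:- c) :* con 1ℤ)) refl (intK dK - intK u) (intK a) w (intK c) ⟩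
          intK a * ((intK dK - intK u) * w + (- intK c) * 1#)
            ≡⟨ cong₂ (λ s t → intK a * (s * w + t * 1#)) (sym (intK-minus dK u)) (sym (intK-neg c)) ⟩
          intK a * (intK (dK ℤ.- u) * w + intK (ℤ.- c) * 1#) ∎))
        , (a , u , (begin
          τ * 1#                                ≡⟨ solve 2 (λ t u → t :* con 1ℤ := (t :- u) :+ u :* con 1ℤ) refl τ (intK u) ⟩
          (τ - intK u) + intK u * 1#            ≡⟨ cong (_+ intK u * 1#) (sym aw≡) ⟩
          intK a * w + intK u * 1#              ∎))
        where
        open ≡-Reasoning
        vieta : ∀ d t n u → (d * t - n) - t * u ≡ (d - u) * (t - u) - (u * u - u * d + n)
        vieta = solve 4 (λ d t n u → (d :* t :- n) :- t :* u := (d :- u) :* (t :- u) :- (u :* u :- u :* d :+ n)) refl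
      stable = generic (ω Q) aω≡

    fractional : IsFractionalIdeal [ ω Q , 1# ]
    fractional = lattice-fractional {ω Q} {1#} 1≢0 (proj₁ stable) (proj₂ stable)

    aω∈𝒪 : intK a * ω Q ∈ 𝒪
    aω∈𝒪 = resp 𝒪 (sym aω≡) (𝒪-minus τ (intK u) τ∈𝒪 (𝒪-intK u))

    module _ {𝔫 : Pred K 0ℓ} (𝔫-ideal : IsIntegralIdeal 𝔫) (N∈𝔫 : intK (+ N) ∈ 𝔫) where
      open RayClasses 𝔫 𝔫-ideal using (comaximal-⊆; module 𝔫)

      private
        aK = intK a
        Λ = [ ω Q , 1# ]
        relation : ∃[ y ] ∃[ x ] y ℤ.* + N ℤ.+ x ℤ.* a ≡ 1ℤ
        relation = gcd≡1⇒bezout (+ N) a coprime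
        y = proj₁ relation
        x = proj₁ (proj₂ relation)
        relationK : 1# ≡ aK * intK x + intK y * intK (+ N)
        relationK = trans (cong intK (sym (proj₂ (proj₂ relation)))) (trans (intK-*+* y (+ N) x a)
          (solve 4 (λ y n x a → y :* n :+ x :* a := a :* x :+ y :* n) refl (intK y) (intK (+ N)) (intK x) aK))
        yN∈𝔫 : intK y * intK (+ N) ∈ 𝔫
        yN∈𝔫 = 𝔫.*-clos (intK y) (𝒪-intK y) N∈𝔫
        ax∈ : aK * intK x ∈ ⟨ aK ⟩
        ax∈ = intK x , 𝒪-intK x , refl
        integral : ∀ w → aK * w ∈ 𝒪 → ∀ {t s} → t ∈ [ w , 1# ] → s ∈ ⟨ aK ⟩ → t * s ∈ 𝒪
        integral w aw∈ (p , q , t≡) (z , z∈ , s≡) = resp 𝒪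
          (trans (solve 5 (λ p q a w z → (p :* (a :* w) :+ q :* a) :* z := (p :* w :+ q :* con 1ℤ) :* (a :* z)) refl (intK p) (intK q) aK w z)
            (sym (cong₂ _*_ t≡ s≡)))
          (𝒪-* (intK p * (aK * w) + intK q * aK) z
            (𝒪-+ (intK p * (aK * w)) (intK q * aK) (𝒪-* (intK p) (aK * w) (𝒪-intK p) aw∈) (𝒪-* (intK q) aK (𝒪-intK q) (𝒪-intK a))) z∈)
        a-ideal : IsIntegralIdeal ⟨ aK ⟩
        a-ideal = principal-integral (𝒪-intK a) a≢0

      -- The lattice Λ is the quotient of Λ⟨a⟩ by ⟨a⟩. The first is integral because aω is, and
      -- contains ⟨a⟩ because 1 lies in Λ; ⟨a⟩ is comaximal with 𝔫 because a is prime to N, which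
      -- lies in 𝔫.
      primeTo : [ ω Q , 1# ] PrimeTo 𝔫
      primeTo = record
        { 𝔟 = Λ · ⟨ aK ⟩ ; 𝔠 = ⟨ aK ⟩
        ; 𝔟-ideal = record
            { isFractionalIdeal = ·-fractional fractional (IsIntegralIdeal.isFractionalIdeal a-ideal)
            ; ⊆𝒪 = ·-⊆ {Λ} {⟨ aK ⟩} 𝒪-submodule (integral (ω Q) aω∈𝒪) }
        ; 𝔠-ideal = a-ideal
        ; 𝔟-coprime = comaximal-⊆ {⟨ aK ⟩} {Λ · ⟨ aK ⟩} (λ {t} t∈ → resp (Λ · ⟨ aK ⟩) (*-identityˡ t) (·-single {Λ} {⟨ aK ⟩} (Lattice.right (ω Q) 1#) t∈)) 𝔠-coprime
        ; 𝔠-coprime = 𝔠-coprime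
        ; quotient = ≐-refl {Λ · ⟨ aK ⟩} }
        where
        𝔠-coprime : Comaximal ⟨ aK ⟩ 𝔫
        𝔠-coprime = aK * intK x , intK y * intK (+ N) , ax∈ , yN∈𝔫 , relationK

  -- A common divisor g of the coefficients makes (τ - u) / g integral, but τ is part of a basis of 𝒪.
  form-primitive : ∀ a′ b′ c′ u g → g ≢ 0ℤ → b′ ℤ.* g ℤ.+ dK ≡ + 2 ℤ.* u →
    (a′ ℤ.* g) ℤ.* (c′ ℤ.* g) ≡ u ℤ.* u ℤ.- u ℤ.* dK ℤ.+ n₀ → ∃[ s ] s ℤ.* g ≡ 1ℤ
  form-primitive a′ b′ c′ u g g≢0 b≡ ac≡ = build (inverse (intK g) (intK≢0 g≢0))
    where
    open ≡-Reasoning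
    build : (∃[ r ] intK g * r ≡ 1#) → ∃[ s ] s ℤ.* g ≡ 1ℤ
    build (r , gr≡1) = coefficient (𝒪-coords θ∈)
      where
      -- As τ - u has minimal polynomial X² + bX + ac with b = b′g and ac = a′c′g², its quotient θ
      -- by g is a root of X² + b′X + a′c′.
      θ = r * (τ - intK u)
      gθ : intK g * θ ≡ τ - intK u
      gθ = trans (sym (*-assoc (intK g) r (τ - intK u))) (trans (cong (_* (τ - intK u)) gr≡1) (*-identityˡ _))
      b′g : intK b′ * intK g ≡ intK (+ 2) * intK u - intK dK
      b′g = trans (sym (intK-* b′ g)) (trans (cong intK (trans (ℤS.solve 2 (λ b D → b ℤS.:= (b ℤS.:+ D) ℤS.:- D) refl (b′ ℤ.* g) dK) (cong (ℤ._- dK) b≡)))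
        (trans (intK-minus (+ 2 ℤ.* u) dK) (cong (_- intK dK) (intK-* (+ 2) u))))
      a′gc′g : (intK a′ * intK g) * (intK c′ * intK g) ≡ intK u * intK u - intK u * intK dK + intK n₀
      a′gc′g = trans (cong₂ _*_ (sym (intK-* a′ g)) (sym (intK-* c′ g))) (intK-ac (a′ ℤ.* g) (c′ ℤ.* g) u ac≡)
      scaled : ∀ g a b c t → g * (g * (a * c + t * (b + t * 1#))) ≡ (a * g) * (c * g) + (g * t) * (b * g + g * t)
      scaled = solve 5 (λ g a b c t → g :* (g :* (a :* c :+ t :* (b :+ t :* con 1ℤ))) := (a :* g) :* (c :* g) :+ (g :* t) :* (b :* g :+ g :* t)) refl
      vieta : ∀ u d n t → (u * u - u * d + n) + (t - u) * ((intK (+ 2) * u - d) + (t - u)) ≡ t * t - (d * t - n)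
      vieta = solve 4 (λ u d n t → (u :* u :- u :* d :+ n) :+ (t :- u) :* ((con (+ 2) :* u :- d) :+ (t :- u)) := t :* t :- (d :* t :- n)) refl
      root : intK (a′ ℤ.* c′) + θ * (intK b′ + θ * 1#) ≡ 0#
      root = *-cancelˡ (intK g) (intK≢0 g≢0) (trans (*-cancelˡ (intK g) (intK≢0 g≢0) (begin
        intK g * (intK g * (intK (a′ ℤ.* c′) + θ * (intK b′ + θ * 1#)))
          ≡⟨ cong (λ e → intK g * (intK g * (e + θ * (intK b′ + θ * 1#)))) (intK-* a′ c′) ⟩
        intK g * (intK g * (intK a′ * intK c′ + θ * (intK b′ + θ * 1#)))
          ≡⟨ scaled (intK g) (intK a′) (intK b′) (intK c′) θ ⟩
        (intK a′ * intK g) * (intK c′ * intK g) + (intK g * θ) * (intK b′ * intK g + intK g * θ)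
          ≡⟨ cong₂ (λ s t → (intK a′ * intK g) * (intK c′ * intK g) + s * (t + s)) gθ b′g ⟩
        (intK a′ * intK g) * (intK c′ * intK g) + (τ - intK u) * ((intK (+ 2) * intK u - intK dK) + (τ - intK u))
          ≡⟨ cong (λ t → t + (τ - intK u) * ((intK (+ 2) * intK u - intK dK) + (τ - intK u))) a′gc′g ⟩
        (intK u * intK u - intK u * intK dK + intK n₀) + (τ - intK u) * ((intK (+ 2) * intK u - intK dK) + (τ - intK u))
          ≡⟨ vieta (intK u) (intK dK) (intK n₀) τ ⟩
        τ * τ - (intK dK * τ - intK n₀)
          ≡⟨ x≡y⇒x-y≡0 τ*τ ⟩
        0#
          ≡⟨ sym (zeroʳ (intK g)) ⟩
        intK g * 0# ∎)) (sym (zeroʳ (intK g))))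
      θ∈ : θ ∈ 𝒪
      θ∈ = a′ ℤ.* c′ ∷ b′ ∷ [] , root
      coefficient : (∃[ p ] ∃[ s ] θ ≡ intK p + intK s * τ) → ∃[ s ] s ℤ.* g ≡ 1ℤ
      -- The coefficient of τ in gθ = τ - u is compared: it is sg on the left and 1 on the right.
      coefficient (p , s , θ≡) = s , ℤ.i-j≡0⇒i≡j (s ℤ.* g) 1ℤ (proj₂ (1,τ-independent (g ℤ.* p ℤ.+ u) (s ℤ.* g ℤ.- 1ℤ) (begin
        intK (g ℤ.* p ℤ.+ u) + intK (s ℤ.* g ℤ.- 1ℤ) * τ
          ≡⟨ cong₂ (λ x y → x + y * τ) (trans (intK-+ (g ℤ.* p) u) (cong (_+ intK u) (intK-* g p))) (trans (intK-minus (s ℤ.* g) 1ℤ) (cong (_- 1#) (intK-* s g))) ⟩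
        (intK g * intK p + intK u) + (intK s * intK g - 1#) * τ
          ≡⟨ regroup (intK g) (intK p) (intK u) (intK s) τ ⟩
        intK g * (intK p + intK s * τ) - (τ - intK u)
          ≡⟨ cong (λ t → intK g * t - (τ - intK u)) (sym θ≡) ⟩
        intK g * θ - (τ - intK u)
          ≡⟨ x≡y⇒x-y≡0 gθ ⟩
        0# ∎)))
        where
        regroup : ∀ g p u s t → (g * p + u) + (s * g - 1#) * t ≡ g * (p + s * t) - (t - u)
        regroup = solve 5 (λ g p u s t → (g :* p :+ u) :+ (s :* g :- con 1ℤ) :* t := g :* (p :+ s :* t) :- (t :- u)) refl

  -- The choice b = 2u - dK makes aω equal to τ - u, and the discriminant becomes dK² - 4n₀ = dK.
  -- The form is definite because a > 0 > dK, and primitive because dK is the discriminant of the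
  -- full ring of integers.
  form : ∀ {N} n u c → + suc n ℤ.* c ≡ u ℤ.* u ℤ.- u ℤ.* dK ℤ.+ n₀ →
    (∃[ p ] ∃[ q ] + suc n ℤ.* p ℤ.+ + N ℤ.* q ≡ 1ℤ) →
    Σ[ Q ∈ 𝒬 N dK ] 𝒬.a Q ≡ + suc n × 𝒬.b Q ℤ.+ dK ≡ + 2 ℤ.* u
  form {N} n u c ac≡ (p , q , cop) = record
    { form             = record { a = a ; b = b ; c = c }
    ; isPrimitive      = primitive-gcd
    ; positiveDefinite = λ x y → form-positive n (proj₁ dK<0) b c x y (trans disc (proj₂ dK<0))
    ; discriminant≡    = disc
    ; coprime          = bezout⇒gcd≡1 (+ N) a q p (trans (ℤS.solve 4 (λ q n p a → q ℤS.:* n ℤS.:+ p ℤS.:* a ℤS.:= a ℤS.:* p ℤS.:+ n ℤS.:* q) refl q (+ N) p a) cop)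
    } , refl , b+D
    where
    open ≡-Reasoning
    a b : ℤ
    a = + suc n
    b = + 2 ℤ.* u ℤ.- dK
    b+D : b ℤ.+ dK ≡ + 2 ℤ.* u
    b+D = ℤS.solve 2 (λ u D → (u ℤS.:- D) ℤS.:+ D ℤS.:= u) refl (+ 2 ℤ.* u) dK
    disc : b ℤ.* b ℤ.- + 4 ℤ.* a ℤ.* c ≡ dK
    disc = begin
      b ℤ.* b ℤ.- + 4 ℤ.* a ℤ.* c
        ≡⟨ cong (λ t → b ℤ.* b ℤ.- t) (trans (ℤ.*-assoc (+ 4) a c) (cong (+ 4 ℤ.*_) ac≡)) ⟩
      b ℤ.* b ℤ.- + 4 ℤ.* (u ℤ.* u ℤ.- u ℤ.* dK ℤ.+ n₀)
        ≡⟨ expand u dK n₀ ⟩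
      dK ℤ.* dK ℤ.- + 4 ℤ.* n₀
        ≡⟨ cong (λ t → dK ℤ.* dK ℤ.- t) 4n₀≡ ⟩
      dK ℤ.* dK ℤ.- (dK ℤ.* dK ℤ.- dK)
        ≡⟨ collapse dK ⟩
      dK ∎
      where
      expand : ∀ u D n → (+ 2 ℤ.* u ℤ.- D) ℤ.* (+ 2 ℤ.* u ℤ.- D) ℤ.- + 4 ℤ.* (u ℤ.* u ℤ.- u ℤ.* D ℤ.+ n) ≡ D ℤ.* D ℤ.- + 4 ℤ.* n
      expand = ℤS.solve 3 (λ u D n → (ℤS.con (+ 2) ℤS.:* u ℤS.:- D) ℤS.:* (ℤS.con (+ 2) ℤS.:* u ℤS.:- D) ℤS.:- ℤS.con (+ 4) ℤS.:* (u ℤS.:* u ℤS.:- u ℤS.:* D ℤS.:+ n)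
        ℤS.:= D ℤS.:* D ℤS.:- ℤS.con (+ 4) ℤS.:* n) refl
      collapse : ∀ D → D ℤ.* D ℤ.- (D ℤ.* D ℤ.- D) ≡ D
      collapse = ℤS.solve 1 (λ D → D ℤS.:* D ℤS.:- (D ℤS.:* D ℤS.:- D) ℤS.:= D) refl
    g = ℤ.gcd (ℤ.gcd a b) c
    divisors = gcd₃-divides a b c
    g∣a = proj₁ divisors
    g∣b = proj₁ (proj₂ divisors)
    g∣c = proj₂ (proj₂ divisors)
    g≢0 : g ≢ 0ℤ
    g≢0 g≡0 = a≢0 (trans (proj₂ g∣a) (trans (cong (proj₁ g∣a ℤ.*_) g≡0) (ℤ.*-zeroʳ (proj₁ g∣a))))
      where
      a≢0 : a ≢ 0ℤ
      a≢0 ()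
    primitive-gcd : g ≡ 1ℤ
    primitive-gcd = gcd₃-unit a b c (form-primitive (proj₁ g∣a) (proj₁ g∣b) (proj₁ g∣c) u g g≢0
        (trans (cong (ℤ._+ dK) (sym (proj₂ g∣b))) b+D)
        (trans (cong₂ ℤ._*_ (sym (proj₂ g∣a)) (sym (proj₂ g∣c))) ac≡))

  -- The form attached to an ideal with an adapted basis

  module _ {J : Pred K 0ℓ} (J-fractional : IsFractionalIdeal J) {N : ℕ} {ν₀ : K} (R : BasisReduction.ReducedBasis J-fractional N ν₀) where
    private
      module J = IsFractionalIdeal J-fractional
    open BasisReduction.ReducedBasis R

    -- Multiplication by τ is τν = uν + aμ, τμ = c′ν + dμ, a matrix of trace dK and determinant n₀.
    -- Hence d = dK - u and a(-c′) = u² - u dK + n₀, so -c′ is the last coefficient of a form with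
    -- aω = τ - u. Then aνω = (τ - u)ν = aμ, so νω = μ and J = [ν, μ] = ν[ω, 1].
    lattice-form : Σ[ Q ∈ 𝒬 N dK ] J ≐ ⟨ ν ⟩ · [ ω Q , 1# ]
    lattice-form = fromProduct (J⊆ (J.*-clos τ τ∈𝒪 μ∈))
      where
      open ≡-Reasoning
      a : ℤ
      a = + suc a-1
      aK≢0 : intK a ≢ 0#
      aK≢0 = intK≢0 λ ()
      aμ≡ : intK a * μ ≡ (τ - intK u) * ν
      aμ≡ = trans (solve 2 (λ p q → q := (p :+ q) :- p) refl (intK u * ν) (intK a * μ)) (trans (cong (_- intK u * ν) (sym τν≡))
        (solve 3 (λ t u ν → t :* ν :- u :* ν := (t :- u) :* ν) refl τ (intK u) ν))
      fromProduct : τ * μ ∈ [ ν , μ ] → Σ[ Q ∈ 𝒬 N dK ] J ≐ ⟨ ν ⟩ · [ ω Q , 1# ]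
      fromProduct (c′ , d , τμ≡) = fromForm (form a-1 u (ℤ.- c′) ac≡ a-coprime)
        where
        -- This is τ(aμ) = a(τμ), written as a multiple of ν by means of aμ = (τ - u)ν. The
        -- coefficients of 1 and τ are the determinant and trace conditions on the matrix of τ.
        relation : intK (d ℤ.* u ℤ.- a ℤ.* c′ ℤ.- n₀) + intK (dK ℤ.- u ℤ.- d) * τ ≡ 0#
        relation = *-cancel ν _ (begin
          ν * (intK (d ℤ.* u ℤ.- a ℤ.* c′ ℤ.- n₀) + intK (dK ℤ.- u ℤ.- d) * τ)
            ≡⟨ cong₂ (λ s t → ν * (s + t * τ))
                 (trans (intK-minus (d ℤ.* u ℤ.- a ℤ.* c′) n₀) (cong (_- intK n₀) (trans (intK-minus (d ℤ.* u) (a ℤ.* c′)) (cong₂ _-_ (intK-* d u) (intK-* a c′)))))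
                 (trans (intK-minus (dK ℤ.- u) d) (cong (_- intK d) (intK-minus dK u))) ⟩
          ν * ((intK d * intK u - intK a * intK c′ - intK n₀) + (intK dK - intK u - intK d) * τ)
            ≡⟨ expand ν (intK d) (intK u) (intK a) (intK c′) (intK n₀) (intK dK) τ ⟩
          (intK dK * τ - intK n₀) * ν - τ * (intK u * ν) - (intK a * intK c′ * ν + intK d * ((τ - intK u) * ν))
            ≡⟨ cong₂ (λ s t → s * ν - τ * (intK u * ν) - (intK a * intK c′ * ν + intK d * t)) (sym τ*τ) (sym aμ≡) ⟩
          τ * τ * ν - τ * (intK u * ν) - (intK a * intK c′ * ν + intK d * (intK a * μ))
            ≡⟨ contract τ ν (intK u) (intK a) (intK c′) (intK d) μ ⟩
          τ * ((τ - intK u) * ν) - intK a * (intK c′ * ν + intK d * μ)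
            ≡⟨ cong₂ (λ s t → τ * s - intK a * t) (sym aμ≡) (sym τμ≡) ⟩
          τ * (intK a * μ) - intK a * (τ * μ)
            ≡⟨ solve 3 (λ t a μ → t :* (a :* μ) :- a :* (t :* μ) := con 0ℤ) refl τ (intK a) μ ⟩
          0# ∎) ν≢0
          where
          expand : ∀ ν d u a c n D t → ν * ((d * u - a * c - n) + (D - u - d) * t) ≡ (D * t - n) * ν - t * (u * ν) - (a * c * ν + d * ((t - u) * ν))
          expand = solve 8 (λ ν d u a c n D t → ν :* ((d :* u :- a :* c :- n) :+ (D :- u :- d) :* t)
            := (D :* t :- n) :* ν :- t :* (u :* ν) :- (a :* c :* ν :+ d :* ((t :- u) :* ν))) refl
          contract : ∀ t ν u a c d μ → t * t * ν - t * (u * ν) - (a * c * ν + d * (a * μ)) ≡ t * ((t - u) * ν) - a * (c * ν + d * μ)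
          contract = solve 7 (λ t ν u a c d μ → t :* t :* ν :- t :* (u :* ν) :- (a :* c :* ν :+ d :* (a :* μ)) := t :* ((t :- u) :* ν) :- a :* (c :* ν :+ d :* μ)) refl
        coefficients = 1,τ-independent (d ℤ.* u ℤ.- a ℤ.* c′ ℤ.- n₀) (dK ℤ.- u ℤ.- d) relation
        d≡ : dK ℤ.- u ≡ d
        d≡ = ℤ.i-j≡0⇒i≡j (dK ℤ.- u) d (proj₂ coefficients)
        ac≡ : a ℤ.* (ℤ.- c′) ≡ u ℤ.* u ℤ.- u ℤ.* dK ℤ.+ n₀
        ac≡ = begin
          a ℤ.* (ℤ.- c′)
            ≡⟨ ℤS.solve 5 (λ a c d u n → a ℤS.:* (ℤS.:- c) ℤS.:= (d ℤS.:* u ℤS.:- a ℤS.:* c ℤS.:- n) ℤS.:- d ℤS.:* u ℤS.:+ n) refl a c′ d u n₀ ⟩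
          (d ℤ.* u ℤ.- a ℤ.* c′ ℤ.- n₀) ℤ.- d ℤ.* u ℤ.+ n₀
            ≡⟨ cong₂ (λ s t → s ℤ.- t ℤ.* u ℤ.+ n₀) (proj₁ coefficients) (sym d≡) ⟩
          0ℤ ℤ.- (dK ℤ.- u) ℤ.* u ℤ.+ n₀
            ≡⟨ finish u dK n₀ ⟩
          u ℤ.* u ℤ.- u ℤ.* dK ℤ.+ n₀ ∎
          where
          finish : ∀ u D n → 0ℤ ℤ.- (D ℤ.- u) ℤ.* u ℤ.+ n ≡ u ℤ.* u ℤ.- u ℤ.* D ℤ.+ n
          finish = ℤS.solve 3 (λ u D n → ℤS.con 0ℤ ℤS.:- (D ℤS.:- u) ℤS.:* u ℤS.:+ n ℤS.:= u ℤS.:* u ℤS.:- u ℤS.:* D ℤS.:+ n) refl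
        fromForm : Σ[ Q ∈ 𝒬 N dK ] 𝒬.a Q ≡ a × 𝒬.b Q ℤ.+ dK ≡ + 2 ℤ.* u → Σ[ Q ∈ 𝒬 N dK ] J ≐ ⟨ ν ⟩ · [ ω Q , 1# ]
        fromForm (Q , a≡ , b+D) = Q , equal (ω Q) (trans (cong (λ t → intK t * ω Q) (sym a≡)) (FormLattice.aω Q u b+D))
          where
          equal : ∀ w → intK a * w ≡ τ - intK u → J ≐ ⟨ ν ⟩ · [ w , 1# ]
          equal w aw≡ = (λ x∈ → to (J⊆ x∈)) , ·-⊆ {⟨ ν ⟩} {[ w , 1# ]} J.isSubmodule from
            where
            νw≡μ : ν * w ≡ μ
            νw≡μ = *-cancelˡ (intK a) aK≢0 (begin
              intK a * (ν * w)        ≡⟨ solve 3 (λ a ν w → a :* (ν :* w) := (a :* w) :* ν) refl (intK a) ν w ⟩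
              intK a * w * ν          ≡⟨ cong (_* ν) aw≡ ⟩
              (τ - intK u) * ν        ≡⟨ sym aμ≡ ⟩
              intK a * μ              ∎)
            to : ∀ {x} → x ∈ [ ν , μ ] → x ∈ ⟨ ν ⟩ · [ w , 1# ]
            to {x} (r , s , x≡) = resp (⟨ ν ⟩ · [ w , 1# ]) (begin
                ν * (intK s * w + intK r * 1#)      ≡⟨ solve 4 (λ ν s w r → ν :* (s :* w :+ r :* con 1ℤ) := r :* ν :+ s :* (ν :* w)) refl ν (intK s) w (intK r) ⟩
                intK r * ν + intK s * (ν * w)       ≡⟨ cong (λ t → intK r * ν + intK s * t) νw≡μ ⟩
                intK r * ν + intK s * μ             ≡⟨ sym x≡ ⟩
                x                                   ∎)
              (·-single {⟨ ν ⟩} {[ w , 1# ]} (ν∈⟨ν⟩ ν) (s , r , refl))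
            from : ∀ {x y} → x ∈ ⟨ ν ⟩ → y ∈ [ w , 1# ] → x * y ∈ J
            from {x} {y} (t , t∈ , x≡) (r , s , y≡) = resp J (begin
                t * (intK s * ν + intK r * μ)         ≡⟨ cong (λ e → t * (intK s * ν + intK r * e)) (sym νw≡μ) ⟩
                t * (intK s * ν + intK r * (ν * w))   ≡⟨ solve 5 (λ t s ν r w → t :* (s :* ν :+ r :* (ν :* w)) := (ν :* t) :* (r :* w :+ s :* con 1ℤ)) refl t (intK s) ν (intK r) w ⟩
                (ν * t) * (intK r * w + intK s * 1#)  ≡⟨ cong₂ _*_ (sym x≡) (sym y≡) ⟩
                x * y                                 ∎)
              (J.*-clos t t∈ (J.+-clos (J.*-clos (intK s) (𝒪-intK s) ν∈) (J.*-clos (intK r) (𝒪-intK r) μ∈)))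

  -- A form in every ray class

  module RayClassOfForm (𝔫 : Pred K 0ℓ) (𝔫-ideal : IsIntegralIdeal 𝔫) (N : ℕ) (0<N : 0 ℕ.< N) (N∈𝔫 : intK (+ N) ∈ 𝔫) where
    open RayClasses 𝔫 𝔫-ideal
    open FormClasses 𝔫 𝔫-ideal N
    open Modulus 𝔫 𝔫-ideal
    open 𝓘

    lattices : LatticesIn𝓘
    lattices Q = FormLattice.fractional Q , FormLattice.primeTo Q 𝔫-ideal N∈𝔫

    representative : (I : 𝓘) → Σ[ Q ∈ 𝒬 N dK ] φ lattices Q ∼ I
    representative I = fromIntegral (integral-representative I)
      where
      fromIntegral : Σ[ J ∈ 𝓘 ] J ∼ I × ideal J ⊆ 𝒪 × ∃[ e ] e ∈ ideal J × 1# - e ∈ 𝔫 → Σ[ Q ∈ 𝒬 N dK ] φ lattices Q ∼ I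
      fromIntegral (J , J∼I , J⊆𝒪 , e , e∈ , e≡1) = fromUnit (unit-generator (fractional J) J⊆𝒪 N 0<N N∈𝔫 e∈ e≡1)
        where
        open BasisReduction (fractional J) N using (ReducedBasis; reduced-basis)
        fromBasis : ∀ {ν₀} → 1# - ν₀ ∈ 𝔫 → ReducedBasis ν₀ → Σ[ Q ∈ 𝒬 N dK ] φ lattices Q ∼ I
        -- The equality J = ν[ω, 1] with ν ≡ 1 (mod 𝔫) is a witness that J and the lattice of Q
        -- share a ray class.
        fromBasis {ν₀} ν₀≡1 R = proj₁ Q , ∼-trans (φ lattices (proj₁ Q)) J I
            (∼-sym J (φ lattices (proj₁ Q)) (R.ν , ≡1⇒≡*1 (J⊆𝒪 R.ν∈) R.ν≢0 (ν≡1 R.shift) , proj₂ Q)) J∼I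
          where
          module R = ReducedBasis R
          Q : Σ[ Q ∈ 𝒬 N dK ] ideal J ≐ ⟨ R.ν ⟩ · [ ω Q , 1# ]
          Q = lattice-form (fractional J) R
          ν≡1 : (∃[ j ] j ∈ ideal J × R.ν ≡ ν₀ + intK (+ N) * j) → 1# - R.ν ∈ 𝔫
          ν≡1 (j , j∈ , ν≡) = resp 𝔫
            (trans (solve 3 (λ ν n j → (con 1ℤ :- ν) :+ (:- j) :* n := con 1ℤ :- (ν :+ n :* j)) refl ν₀ (intK (+ N)) j) (cong (λ t → 1# - t) (sym ν≡)))
            (𝔫.+-clos ν₀≡1 (𝔫.*-clos (- j) (𝒪-neg j (J⊆𝒪 j∈)) N∈𝔫))
        fromUnit : (∃[ ν ] ∃[ h ] ∃[ w ] ν ∈ ideal J × h ∈ ideal J ⁻¹ᴵ × w ∈ 𝒪 × 1# - ν ∈ 𝔫 × 1# - ν * h ≡ w * intK (+ N)) → Σ[ Q ∈ 𝒬 N dK ] φ lattices Q ∼ I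
        fromUnit (ν , h , w , ν∈ , h∈ , w∈ , ν≡1 , unit) = fromBasis ν≡1 (reduced-basis ν∈ h∈ w∈ unit)

-- Transport of a group structure along a section

module TransportedGroup {c ℓ b} (G : AbelianGroup c ℓ) {B : Set b} (f : B → AbelianGroup.Carrier G)
                        (section : AbelianGroup.Carrier G → B)
                        (f-section : ∀ x → AbelianGroup._≈_ G (f (section x)) x) where
  private module G = AbelianGroup G

  infix 4 _~_
  _~_ : B → B → Set ℓ
  x ~ y = f x G.≈ f y

  -- Any preimage of the product would do, since `_~_` only sees values of f; the section fixes one,
  -- and f is a homomorphism up to the equality of the target.
  mul : Op₂ B
  mul x y = section (f x G.∙ f y)

  one : B
  one = section G.ε

  inv : Op₁ B
  inv x = section (f x G.⁻¹)

  surjective : Surjective _~_ G._≈_ f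
  surjective x = section x , λ z~ → G.trans z~ (f-section x)

  bijective : Bijective _~_ G._≈_ f
  bijective = (λ eq → eq) , surjective

  isIsomorphism : GroupMorphisms.IsGroupIsomorphism (record { _≈_ = _~_ ; _∙_ = mul ; ε = one ; _⁻¹ = inv }) G.rawGroup f
  isIsomorphism = record
    { isGroupMonomorphism = record
      { isGroupHomomorphism = record
        { isMonoidHomomorphism = record
          { isMagmaHomomorphism = record
            { isRelHomomorphism = record { cong = λ eq → eq }
            ; homo              = λ x y → f-section (f x G.∙ f y)
            }
          ; ε-homo = f-section G.ε
          }
        ; ⁻¹-homo = λ x → f-section (f x G.⁻¹)
        }
      ; injective = λ eq → eq
      }
    ; surjective = surjective
    }

  isGroup : IsGroup _~_ mul one inv
  isGroup = GroupMonomorphism.isGroup (GroupMorphisms.IsGroupIsomorphism.isGroupMonomorphism isIsomorphism) G.isGroup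

theorem2p2 : (F : ImaginaryQuadraticField) →
  let open QuadraticField F in
  (𝔫 : Pred K 0ℓ) (𝔫-ideal : IsIntegralIdeal 𝔫) →
  (N : ℕ) → IsLeastPositiveInteger N 𝔫 →
  let open RayClasses 𝔫 𝔫-ideal using (rayClassGroup)
      open FormClasses 𝔫 𝔫-ideal N
      module 𝒞 = AbelianGroup rayClassGroup
  in
  Σ[ in𝓘 ∈ LatticesIn𝓘 ]
    Congruent _~_ 𝒞._≈_ (φ in𝓘) ×
    Bijective _~_ 𝒞._≈_ (φ in𝓘) ×
    (Σ[ mul ∈ Op₂ (𝒬 N dK) ] Σ[ one ∈ 𝒬 N dK ] Σ[ inv ∈ Op₁ (𝒬 N dK) ]
      (IsGroup _~_ mul one inv ×
       GroupMorphisms.IsGroupIsomorphism (rawGroup mul one inv) 𝒞.rawGroup (φ in𝓘)))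
theorem2p2 F 𝔫 𝔫-ideal N N-least =
  lattices , (λ {Q} {Q′} Q~Q′ → Q~Q′) , T.bijective , T.mul , T.one , T.inv , T.isGroup , T.isIsomorphism
  where
  open QuadraticField F
  open RayClasses 𝔫 𝔫-ideal using (𝓘; rayClassGroup)
  open FormClasses 𝔫 𝔫-ideal N using (φ)
  open IsLeastPositiveInteger N-least
  open QuadraticOrder.RayClassOfForm F 𝔫 𝔫-ideal N positive member
  module T = TransportedGroup rayClassGroup (φ lattices) (λ I → proj₁ (representative I)) (λ I → proj₂ (representative I))
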